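{- Let $\mu$ be a given partition, $k$ a nonnegative integer and $\nu=(\nu_1,\ldots,\nu_\ell)$ an integer partition. Write $g(\lambda)=p_\nu(h_\square^2:\square\in\lambda)=\prod_{i=1}^\ell\sum_{\square\in\lambda}h_\square^{2\nu_i}$. Then $$\sum_{|\lambda/\mu|=n}f_{\lambda/\mu}D^k\Bigl(\frac{g(\lambda)}{H_\lambda}\Bigr)=\sum_{0\le i\le|\nu|+\ell-k}d_{i+k}\binom{n}{i}$$ is a polynomial in $n$, where $d_i=D^i\bigl(g(\lambda)/H_\lambda\bigr)\big|_{\lambda=\mu}$. In particular, $$\frac{1}{(n+|\mu|)!}\sum_{|\lambda/\mu|=n}f_\lambda f_{\lambda/\mu}\,p_\nu(h_\square^2:\square\in\lambda)$$ is a polynomial in $n$ of degree at most $|\nu|+\ell$.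
   Context: The sum over $|\lambda/\mu|=n$ ranges over partitions $\lambda\supseteq\mu$ with $|\lambda|-|\mu|=n$; $f_{\lambda/\mu}$ is the number of standard Young tableaux of skew shape $\lambda/\mu$ and $f_\lambda=f_{\lambda/\emptyset}$. $h_\square$ is the hook length (arm + leg + 1), $H_\lambda=\prod_{\square\in\lambda}h_\square$, $H_\emptyset=1$. $p_\nu$ is the power sum symmetric function, evaluated at the values $h_\square^2$, $\square\in\lambda$ (other variables $0$). For a function $g$ on partitions, $Dg(\lambda)=\sum_{\lambda^+}g(\lambda^+)-g(\lambda)$, where $\lambda^+$ ranges over partitions obtained from $\lambda$ by adding one box; $D^0g=g$, $D^kg=D(D^{k-1}g)$. -}

module Defs where

open import Data.Nat as ℕ using (ℕ; zero; suc; _+_; _*_; _∸_; _^_; _≤_; _<_; _<ᵇ_; _≤ᵇ_; _≡ᵇ_)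
open import Data.Nat.Combinatorics using (_C_)
open import Data.Nat using (_!)
open import Data.Bool using (Bool; true; false; _∧_; _∨_; if_then_else_)
open import Data.List as L using (List; []; _∷_; map; filter; concat; length; upTo; foldr; zip; allFin)
open import Data.List.Properties using (≡-dec)
open import Data.Nat.ListAction using (sum; product)
open import Data.Bool.ListAction using (and)
open import Data.Product using (_×_; _,_)
open import Data.Integer using (+_)
open import Data.Rational as Q using (ℚ; 0ℚ; 1ℚ)
open import Relation.Binary.PropositionalEquality using (_≡_)
open import Relation.Nullary.Decidable using (⌊_⌋)
import Data.Nat.Properties as NP

Partition : Set
Partition = List ℕ

data Decreasing : List ℕ → Set where
  []  : Decreasing []
  [_] : ∀ x → Decreasing (x ∷ [])
  _∷_ : ∀ {x y ys} → y ≤ x → Decreasing (y ∷ ys) → Decreasing (x ∷ y ∷ ys)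

data AllPositive : List ℕ → Set where
  []  : AllPositive []
  _∷_ : ∀ {x xs} → 0 < x → AllPositive xs → AllPositive (x ∷ xs)

IsPartition : List ℕ → Set
IsPartition xs = Decreasing xs × AllPositive xs

size : Partition → ℕ
size = sum

rowLen : Partition → ℕ → ℕ
rowLen []       _       = 0
rowLen (x ∷ xs) zero    = x
rowLen (x ∷ xs) (suc i) = rowLen xs i

colLen : Partition → ℕ → ℕ
colLen λ' j = length (filter (λ r → j ℕ.<? r) λ')

cells : Partition → List (ℕ × ℕ)
cells λ' = concat (L.map (λ p → go p) (zip (upTo (length λ')) λ'))
  where
  go : ℕ × ℕ → List (ℕ × ℕ)
  go (i , r) = map (λ j → (i , j)) (upTo r)

hook : Partition → ℕ × ℕ → ℕ
hook λ' (i , j) = suc ((rowLen λ' i ∸ suc j) + (colLen λ' j ∸ suc i))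

H : Partition → ℕ
H λ' = product (map (hook λ') (cells λ'))

pHook : Partition → Partition → ℕ
pHook ν λ' = product (map (λ a → sum (map (λ c → hook λ' c ^ (2 * a)) (cells λ'))) ν)

incrRow : Partition → ℕ → Partition
incrRow []       _       = 1 ∷ []
incrRow (x ∷ xs) zero    = suc x ∷ xs
incrRow (x ∷ xs) (suc i) = x ∷ incrRow xs i

addableᵇ : Partition → ℕ → Bool
addableᵇ λ' zero    = true
addableᵇ λ' (suc i) = rowLen λ' (suc i) <ᵇ rowLen λ' i

addBox : Partition → List Partition
addBox λ' = map (incrRow λ') (filter (λ i → Data.Bool.T? (addableᵇ λ' i)) (upTo (suc (length λ'))))
  where import Data.Bool

-- Standard Young tableaux of skew shape λ/μ, encoded as saturated chains
-- μ = λ⁰ ⊂ λ¹ ⊂ ... ⊂ λⁿ = λ (box labelled t is λᵗ/λᵗ⁻¹).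
-- chainEnds n μ lists the end points of all such chains of length n
-- (with multiplicity).

chainEnds : ℕ → Partition → List Partition
chainEnds zero    μ = μ ∷ []
chainEnds (suc n) μ = concat (map (chainEnds n) (addBox μ))

_≟P_ = ≡-dec ℕ._≟_

f : Partition → Partition → ℕ
f λ' μ = length (filter (λ ρ → ρ ≟P λ') (chainEnds (size λ' ∸ size μ) μ))

fStraight : Partition → ℕ
fStraight λ' = f λ' []

partsB : ℕ → ℕ → ℕ → List Partition
partsB _        zero    _ = [] ∷ []
partsB zero     (suc m) _ = []
partsB (suc fu) (suc m) b =
  concat (map (λ k → map (suc k ∷_) (partsB fu (suc m ∸ suc k) (suc k)))
              (filter (λ k → suc k ℕ.≤? ℕ._⊓_ (suc m) b) (upTo (suc m))))

partitionsOf : ℕ → List Partition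
partitionsOf m = partsB m m m

containsᵇ : Partition → Partition → Bool
containsᵇ μ λ' = and (map (λ i → rowLen μ i ≤ᵇ rowLen λ' i) (upTo (length μ)))

skewShapes : Partition → ℕ → List Partition
skewShapes μ n = filter (λ λ' → Data.Bool.T? (containsᵇ μ λ')) (partitionsOf (size μ + n))
  where import Data.Bool

ΣQ : List ℚ → ℚ
ΣQ = foldr Q._+_ 0ℚ

-- a / b in ℚ (b = 0 never occurs below since hook lengths are ≥ 1)
_÷_ : ℕ → ℕ → ℚ
a ÷ zero  = 0ℚ
a ÷ suc b = (+ a) Q./ suc b

fromℕ : ℕ → ℚ
fromℕ a = a ÷ 1

D : (Partition → ℚ) → (Partition → ℚ)
D g λ' = ΣQ (map g (addBox λ')) Q.- g λ'

Dpow : ℕ → (Partition → ℚ) → (Partition → ℚ)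
Dpow zero    g = g
Dpow (suc k) g = D (Dpow k g)

gOverH : Partition → Partition → ℚ
gOverH ν λ' = pHook ν λ' ÷ H λ'

skewSum : Partition → ℕ → (Partition → ℚ) → ℚ
skewSum μ n F = ΣQ (map (λ λ' → fromℕ (f λ' μ) Q.* F λ') (skewShapes μ n))

sumBelow : ℕ → (ℕ → ℚ) → ℚ
sumBelow m a = ΣQ (map a (upTo m))

-- Write G for the Frobenius form of 1 / H. If λ has addable boxes with contents x, then G(λ⁺) / G(λ) is the residue
-- at x of the quotient of ∏ (z - y) by ∏ (z - x), so Σ_{λ⁺} x^m G(λ⁺) / G(λ) is a divided difference, and by Newton's
-- identity a polynomial of weight m in the power sums p_k = Σ x^k - Σ y^k. Adding the box x changes p_k by the second
-- difference of z^k at x, of degree k - 2; hence D maps (weight d) · G to (weight d - 2) · G and kills weight 0.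
-- A sum Σ h^(2k) over all hooks is, up to a constant, half the signed sum of ψ(a - b) over pairs of contents, where ψ is
-- a polynomial of degree 2k + 2 with second difference z^(2k); so p_ν(h²) has weight 2 (|ν| + ℓ).
-- Finally a skew sum is a sum over chains, that is (1 + D)^n at μ, and the hook length formula, which follows from
-- a divided difference over the removable boxes, turns f_λ / |λ|! into 1 / H_λ.
module Submission where

-- `D` lowers the weight because the zeroth moment of the ratios G(λ⁺) / G(λ) is 1: in the sum of
-- a(λ⁺) G(λ⁺) the part a(λ) G(λ) is exactly what `D` subtracts, and only the increments of a
-- remain. As each application costs 2, the even bound 2 (|ν| + ℓ) makes every power of `D` beyond
-- |ν| + ℓ vanish, which is the cut-off of the binomial sum. The corners of a partition do not
-- follow the recursion on a list of rows. Therefore each row, addable or not, carries one outer and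
-- one inner point, and the bottom carries one more outer point. Rows that admit no box do no harm,
-- since the formula for `G` vanishes there. Sums then run over all rows, and identities are proved
-- by induction on the rows with a variable offset `c` of the contents. Evenness of the exponents
-- enters through the hook sums: a pair of points occurs both as ψ(a - b) and as ψ(b - a), and an
-- even second difference merges the two.

module HookDifferences where

  open import Defs
  open import Algebra.Bundles using (CommutativeRing; CommutativeSemiring)
  open import Data.Bool using (true; false; if_then_else_; T; T?)
  open import Data.Bool.ListAction using (and)
  import Data.Integer as ℤ
  import Data.Integer.Properties as ℤ
  open import Data.List using (List; []; _∷_; _++_; map; concat; filter; length; upTo; applyUpTo; downFrom; zip)
  open import Data.List.Properties
    using (map-∘; map-++; map-id; map-cong; map-cong-local; map-applyUpTo; map-upTo; reverse-upTo; filter-accept;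
           filter-reject; ++-identityʳ; ++-assoc; ∷-injectiveˡ; ∷-injectiveʳ; length-map)
  open import Data.List.Relation.Binary.Permutation.Propositional as Perm
    using (_↭_; ↭-trans; ↭-sym; ↭-reflexive; prep; module PermutationReasoning)
  open import Data.List.Relation.Binary.Permutation.Propositional.Properties
    using (++⁺; ++⁺ˡ; ++⁺ʳ; ++-comm; ↭-reverse) renaming (map⁺ to ↭-map⁺; shift to ↭-shift)
  open import Data.List.Relation.Unary.All as All using (All; []; _∷_)
  import Data.List.Relation.Unary.All.Properties as All
  open import Data.List.Relation.Unary.AllPairs using (AllPairs; []; _∷_)
  import Data.Nat as ℕ
  open ℕ using (ℕ; zero; suc)
  open import Data.Nat.Combinatorics using (_C_; nCk+nC[k+1]≡[n+1]C[k+1]; k>n⇒nCk≡0; nCk≡nC[n∸k]; nCn≡1)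
  import Data.Nat.Coprimality as Coprime
  open Coprime using (Coprime)
  open import Data.Nat.ListAction using (sum; product)
  open import Data.Nat.ListAction.Properties using (product-++; product-↭)
  import Data.Nat.Properties as ℕ
  open import Data.Nat.Tactic.RingSolver using () renaming (solve-∀ to ℕ-solve-∀)
  open import Data.Product using (_×_; _,_; proj₁; proj₂; Σ; Σ-syntax; ∃-syntax)
  open import Data.Rational using (ℚ; mkℚ; 0ℚ; 1ℚ; _+_; _*_; _-_; -_; 1/_; ≢-nonZero; toℚᵘ)
  open import Data.Rational.Properties
  import Data.Rational.Unnormalised as ℚᵘ
  import Data.Rational.Unnormalised.Properties as ℚᵘ
  open import Algebra.Properties.Semiring.Exp
    (CommutativeSemiring.semiring (CommutativeRing.commutativeSemiring +-*-commutativeRing)) using (_^_; ^-homo-*; ^-assocʳ)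
  open import Data.Sum using (inj₁; inj₂)
  open import Function using (_∘_; id)
  open import Level using (Level)
  open import Relation.Binary.PropositionalEquality
  open import Relation.Nullary using (Dec; yes; no; does; ¬_; contradiction)
  open import Relation.Nullary.Decidable using (dec⇒maybe)
  open import Relation.Unary using (Pred; Decidable)
  open import Tactic.RingSolver using (solve-∀)
  open import Tactic.RingSolver.Core.AlmostCommutativeRing using (AlmostCommutativeRing; fromCommutativeRing)
  open ≡-Reasoning

  -- Arithmetic and finite sums in ℚ

  ℚ-ring : AlmostCommutativeRing _ _
  ℚ-ring = fromCommutativeRing +-*-commutativeRing (λ x → dec⇒maybe (0ℚ ≟ x))

  -- fromℕ unfolds to gcd computations on open terms, which defeats unification; ι keeps it folded.
  opaque
    ι : ℕ → ℚ
    ι = fromℕ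

    ι-fromℕ : ∀ n → fromℕ n ≡ ι n
    ι-fromℕ n = refl

    ι-0 : ι 0 ≡ 0ℚ
    ι-0 = refl

    ι-1 : ι 1 ≡ 1ℚ
    ι-1 = refl

    private
      coprime-1 : ∀ n → Coprime n 1
      coprime-1 n = Coprime.sym (Coprime.1-coprimeTo n)

      ι-mkℚ : ∀ n → ι n ≡ mkℚ (ℤ.+ n) 0 (coprime-1 n)
      ι-mkℚ n = normalize-coprime (coprime-1 n)

    ι-+ : ∀ m n → ι (m ℕ.+ n) ≡ ι m + ι n
    ι-+ m n = begin
      ι (m ℕ.+ n)
        ≡⟨ cong (Data.Rational._/ 1) (sym (cong₂ ℤ._+_ (ℤ.*-identityʳ (ℤ.+ m)) (ℤ.*-identityʳ (ℤ.+ n)))) ⟩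
      mkℚ (ℤ.+ m) 0 (coprime-1 m) + mkℚ (ℤ.+ n) 0 (coprime-1 n)      ≡⟨ sym (cong₂ _+_ (ι-mkℚ m) (ι-mkℚ n)) ⟩
      ι m + ι n                                                      ∎

    ι-* : ∀ m n → ι (m ℕ.* n) ≡ ι m * ι n
    ι-* m n = begin
      ι (m ℕ.* n)                                                    ≡⟨ cong (Data.Rational._/ 1) (ℤ.pos-* m n) ⟩
      mkℚ (ℤ.+ m) 0 (coprime-1 m) * mkℚ (ℤ.+ n) 0 (coprime-1 n)      ≡⟨ sym (cong₂ _*_ (ι-mkℚ m) (ι-mkℚ n)) ⟩
      ι m * ι n                                                      ∎

    ι-suc≢0 : ∀ n → ι (suc n) ≢ 0ℚ
    ι-suc≢0 n eq with trans (sym (ι-mkℚ (suc n))) eq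
    ... | ()

    ÷-cancel : ∀ a b .{{_ : ℕ.NonZero b}} → ι b * (a ÷ b) ≡ ι a
    ÷-cancel a (suc b) = toℚᵘ-injective (begin′
      toℚᵘ (ι (suc b) * (a ÷ suc b))                   ≈⟨ toℚᵘ-homo-* (ι (suc b)) (a ÷ suc b) ⟩
      toℚᵘ (ι (suc b)) ℚᵘ.* toℚᵘ (a ÷ suc b)           ≈⟨ ℚᵘ.*-cong (toℚᵘ-fromℚᵘ (ℚᵘ.mkℚᵘ (ℤ.+ suc b) 0)) (toℚᵘ-fromℚᵘ (ℚᵘ.mkℚᵘ (ℤ.+ a) b)) ⟩
      ℚᵘ.mkℚᵘ (ℤ.+ suc b) 0 ℚᵘ.* ℚᵘ.mkℚᵘ (ℤ.+ a) b     ≈⟨ ℚᵘ.*≡* cross ⟩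
      ℚᵘ.mkℚᵘ (ℤ.+ a) 0                                ≈⟨ ℚᵘ.≃-sym (toℚᵘ-fromℚᵘ (ℚᵘ.mkℚᵘ (ℤ.+ a) 0)) ⟩
      toℚᵘ (ι a) ∎′)
      where
      open ℚᵘ.≃-Reasoning renaming (begin_ to begin′_; _∎ to _∎′)
      cross : ℤ.+ suc b ℤ.* ℤ.+ a ℤ.* ℤ.1ℤ ≡ ℤ.+ a ℤ.* (ℤ.+ suc (b ℕ.+ 0))
      cross = trans (ℤ.*-identityʳ (ℤ.+ suc b ℤ.* ℤ.+ a)) (trans (ℤ.*-comm (ℤ.+ suc b) (ℤ.+ a)) (cong (λ k → ℤ.+ a ℤ.* (ℤ.+ suc k)) (sym (ℕ.+-identityʳ b))))

  ι-suc : ∀ n → ι (suc n) ≡ 1ℚ + ι n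
  ι-suc n = trans (ι-+ 1 n) (cong (_+ ι n) ι-1)

  -- Total, with a default value at 0, so that quotients can be written inside functions of a free
  -- variable `z`; nonvanishing is asked for only where a factor is cancelled.
  inv : ℚ → ℚ
  inv p with p ≟ 0ℚ
  ... | yes _   = 0ℚ
  ... | no  p≢0 = (1/ p) {{≢-nonZero p≢0}}

  inv-cancel : ∀ {p} → p ≢ 0ℚ → p * inv p ≡ 1ℚ
  inv-cancel {p} p≢0 with p ≟ 0ℚ
  ... | yes p≡0  = contradiction p≡0 p≢0
  ... | no  p≢0′ = *-inverseʳ p {{≢-nonZero p≢0′}}

  *-cancelˡ : ∀ {p a b} → p ≢ 0ℚ → p * a ≡ p * b → a ≡ b
  *-cancelˡ {p} {a} {b} p≢0 eq = begin
    a                ≡⟨ expand a ⟩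
    inv p * (p * a)  ≡⟨ cong (inv p *_) eq ⟩
    inv p * (p * b)  ≡⟨ sym (expand b) ⟩
    b                ∎
    where
    expand : ∀ c → c ≡ inv p * (p * c)
    expand c = trans (sym (*-identityˡ c)) (trans (cong (_* c) (sym (inv-cancel p≢0))) (shuffle p (inv p) c))
      where
      shuffle : ∀ p i c → p * i * c ≡ i * (p * c)
      shuffle = solve-∀ ℚ-ring

  private variable
    ℓ : Level
    A B : Set

  ∑ : List A → (A → ℚ) → ℚ
  ∑ xs F = ΣQ (map F xs)

  ∑-cong-All : ∀ {F G : A → ℚ} {xs} → All (λ x → F x ≡ G x) xs → ∑ xs F ≡ ∑ xs G
  ∑-cong-All []        = refl
  ∑-cong-All (eq ∷ eqs) = cong₂ _+_ eq (∑-cong-All eqs)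

  ∑-cong : ∀ {F G : A → ℚ} → (∀ x → F x ≡ G x) → ∀ xs → ∑ xs F ≡ ∑ xs G
  ∑-cong eq xs = cong ΣQ (map-cong eq xs)

  ∑-zero : ∀ (xs : List A) → ∑ xs (λ _ → 0ℚ) ≡ 0ℚ
  ∑-zero []       = refl
  ∑-zero (x ∷ xs) = trans (+-identityˡ _) (∑-zero xs)

  ∑-distrib-+ : ∀ (F G : A → ℚ) xs → ∑ xs (λ x → F x + G x) ≡ ∑ xs F + ∑ xs G
  ∑-distrib-+ F G []       = refl
  ∑-distrib-+ F G (x ∷ xs) = trans (cong (F x + G x +_) (∑-distrib-+ F G xs)) (shuffle (F x) (G x) (∑ xs F) (∑ xs G))
    where
    shuffle : ∀ a b c d → a + b + (c + d) ≡ a + c + (b + d)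
    shuffle = solve-∀ ℚ-ring

  ∑-distribˡ-* : ∀ c (F : A → ℚ) xs → ∑ xs (λ x → c * F x) ≡ c * ∑ xs F
  ∑-distribˡ-* c F []       = sym (*-zeroʳ c)
  ∑-distribˡ-* c F (x ∷ xs) = trans (cong (c * F x +_) (∑-distribˡ-* c F xs)) (sym (*-distribˡ-+ c (F x) (∑ xs F)))

  ∑-swap : ∀ (F : A → B → ℚ) xs ys → ∑ xs (λ x → ∑ ys (F x)) ≡ ∑ ys (λ y → ∑ xs (λ x → F x y))
  ∑-swap F []       ys = sym (∑-zero ys)
  ∑-swap F (x ∷ xs) ys = trans (cong (∑ ys (F x) +_) (∑-swap F xs ys)) (sym (∑-distrib-+ (F x) (λ y → ∑ xs (λ x → F x y)) ys))

  ∑-++ : ∀ (F : A → ℚ) xs ys → ∑ (xs ++ ys) F ≡ ∑ xs F + ∑ ys F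
  ∑-++ F []       ys = sym (+-identityˡ _)
  ∑-++ F (x ∷ xs) ys = trans (cong (F x +_) (∑-++ F xs ys)) (sym (+-assoc (F x) (∑ xs F) (∑ ys F)))

  ∑-map : ∀ (F : B → ℚ) (h : A → B) xs → ∑ (map h xs) F ≡ ∑ xs (F ∘ h)
  ∑-map F h xs = cong ΣQ (sym (map-∘ xs))

  ∑-concat-map : ∀ (F : B → ℚ) (h : A → List B) xs → ∑ (concat (map h xs)) F ≡ ∑ xs (λ x → ∑ (h x) F)
  ∑-concat-map F h []       = refl
  ∑-concat-map F h (x ∷ xs) = trans (∑-++ F (h x) (concat (map h xs))) (cong (∑ (h x) F +_) (∑-concat-map F h xs))

  ∑-↭ : ∀ (φ : ℕ → ℚ) {xs ys} → xs ↭ ys → ∑ xs φ ≡ ∑ ys φ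
  ∑-↭ φ Perm.refl         = refl
  ∑-↭ φ (Perm.prep x σ)   = cong (φ x +_) (∑-↭ φ σ)
  ∑-↭ φ (Perm.swap {xs} {ys} x y σ) = trans (cong (λ s → φ x + (φ y + s)) (∑-↭ φ σ)) (exchange (φ x) (φ y) (∑ ys φ))
    where
    exchange : ∀ a b s → a + (b + s) ≡ b + (a + s)
    exchange = solve-∀ ℚ-ring
  ∑-↭ φ (Perm.trans σ τ)  = trans (∑-↭ φ σ) (∑-↭ φ τ)

  indicator : ∀ {P : Set ℓ} → Dec P → ℚ
  indicator d = if does d then 1ℚ else 0ℚ

  indicator-yes : ∀ {P : Set ℓ} (d : Dec P) → P → indicator d ≡ 1ℚ
  indicator-yes (yes _) _ = refl
  indicator-yes (no ¬p) p = contradiction p ¬p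

  indicator-no : ∀ {P : Set ℓ} (d : Dec P) → ¬ P → indicator d ≡ 0ℚ
  indicator-no (no _)  _  = refl
  indicator-no (yes p) ¬p = contradiction p ¬p

  ∑-filter : ∀ {P : Pred A ℓ} (P? : Decidable P) (F : A → ℚ) xs →
    ∑ (filter P? xs) F ≡ ∑ xs (λ x → indicator (P? x) * F x)
  ∑-filter P? F []       = refl
  ∑-filter P? F (x ∷ xs) with does (P? x)
  ... | true  = cong₂ _+_ (sym (*-identityˡ (F x))) (∑-filter P? F xs)
  ... | false = trans (∑-filter P? F xs) (trans (sym (+-identityˡ _)) (cong (_+ ∑ xs _) (sym (*-zeroˡ (F x)))))

  ι-length-filter : ∀ {P : Pred A ℓ} (P? : Decidable P) xs →
    ι (length (filter P? xs)) ≡ ∑ xs (λ x → indicator (P? x))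
  ι-length-filter P? []       = ι-0
  ι-length-filter P? (x ∷ xs) with does (P? x)
  ... | true  = trans (ι-suc (length (filter P? xs))) (cong (1ℚ +_) (ι-length-filter P? xs))
  ... | false = trans (ι-length-filter P? xs) (sym (+-identityˡ _))

  ∑-upTo-suc : ∀ (F : ℕ → ℚ) n → ∑ (upTo (suc n)) F ≡ F 0 + ∑ (upTo n) (F ∘ suc)
  ∑-upTo-suc F n = cong (λ l → F 0 + ΣQ l) (trans (map-applyUpTo suc F n) (sym (map-applyUpTo id (F ∘ suc) n)))

  ∑-upTo-cong : ∀ {F G : ℕ → ℚ} n → (∀ i → i ℕ.< n → F i ≡ G i) → ∑ (upTo n) F ≡ ∑ (upTo n) G
  ∑-upTo-cong zero    eq = refl
  ∑-upTo-cong {F} {G} (suc n) eq = begin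
    ∑ (upTo (suc n)) F           ≡⟨ ∑-upTo-suc F n ⟩
    F 0 + ∑ (upTo n) (F ∘ suc)   ≡⟨ cong₂ _+_ (eq 0 (ℕ.s≤s ℕ.z≤n)) (∑-upTo-cong n (λ i i<n → eq (suc i) (ℕ.s≤s i<n))) ⟩
    G 0 + ∑ (upTo n) (G ∘ suc)   ≡⟨ sym (∑-upTo-suc G n) ⟩
    ∑ (upTo (suc n)) G           ∎

  ∑-upTo-last : ∀ (F : ℕ → ℚ) n → ∑ (upTo (suc n)) F ≡ ∑ (upTo n) F + F n
  ∑-upTo-last F zero    = trans (+-identityʳ (F 0)) (sym (+-identityˡ (F 0)))
  ∑-upTo-last F (suc n) = begin
    ∑ (upTo (suc (suc n))) F                    ≡⟨ ∑-upTo-suc F (suc n) ⟩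
    F 0 + ∑ (upTo (suc n)) (F ∘ suc)            ≡⟨ cong (F 0 +_) (∑-upTo-last (F ∘ suc) n) ⟩
    F 0 + (∑ (upTo n) (F ∘ suc) + F (suc n))    ≡⟨ sym (+-assoc (F 0) _ (F (suc n))) ⟩
    F 0 + ∑ (upTo n) (F ∘ suc) + F (suc n)      ≡⟨ cong (_+ F (suc n)) (sym (∑-upTo-suc F n)) ⟩
    ∑ (upTo (suc n)) F + F (suc n)              ∎

  ∑-upTo-extend : ∀ (F : ℕ → ℚ) m k → (∀ i → m ℕ.≤ i → F i ≡ 0ℚ) → ∑ (upTo (k ℕ.+ m)) F ≡ ∑ (upTo m) F
  ∑-upTo-extend F m zero    vanish = refl
  ∑-upTo-extend F m (suc k) vanish = begin
    ∑ (upTo (suc (k ℕ.+ m))) F             ≡⟨ ∑-upTo-last F (k ℕ.+ m) ⟩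
    ∑ (upTo (k ℕ.+ m)) F + F (k ℕ.+ m)     ≡⟨ cong₂ _+_ (∑-upTo-extend F m k vanish) (vanish _ (ℕ.m≤n+m m k)) ⟩
    ∑ (upTo m) F + 0ℚ                      ≡⟨ +-identityʳ _ ⟩
    ∑ (upTo m) F                           ∎

  -- The bounds need not be compared: both sums equal the one with bound m + n.
  ∑-upTo-vanish : ∀ (F : ℕ → ℚ) {m n} → (∀ i → m ℕ.≤ i → F i ≡ 0ℚ) → (∀ i → n ℕ.≤ i → F i ≡ 0ℚ) →
    ∑ (upTo m) F ≡ ∑ (upTo n) F
  ∑-upTo-vanish F {m} {n} vm vn = begin
    ∑ (upTo m) F           ≡⟨ sym (∑-upTo-extend F m n vm) ⟩
    ∑ (upTo (n ℕ.+ m)) F   ≡⟨ cong (λ k → ∑ (upTo k) F) (ℕ.+-comm n m) ⟩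
    ∑ (upTo (m ℕ.+ n)) F   ≡⟨ ∑-upTo-extend F n m vn ⟩
    ∑ (upTo n) F           ∎

  ∑-upTo-single : ∀ (F : ℕ → ℚ) {k n} → k ℕ.< n → (∀ i → i ≢ k → F i ≡ 0ℚ) → ∑ (upTo n) F ≡ F k
  ∑-upTo-single F {zero}  {suc n} _ vanish = trans (∑-upTo-suc F n)
    (trans (cong (F 0 +_) (trans (∑-cong (λ i → vanish (suc i) (λ ())) (upTo n)) (∑-zero (upTo n)))) (+-identityʳ (F 0)))
  ∑-upTo-single F {suc k} {suc n} (ℕ.s≤s k<n) vanish = trans (∑-upTo-suc F n)
    (trans (cong₂ _+_ (vanish 0 (λ ())) (∑-upTo-single (F ∘ suc) k<n (λ i i≢k → vanish (suc i) (i≢k ∘ ℕ.suc-injective)))) (+-identityˡ _))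

  -- Divided differences

  infix 4 _#_
  -- A nonzero difference, rather than an inequality of the points, is the form that `inv-cancel`
  -- consumes.
  _#_ : ℚ → ℚ → Set
  a # b = a - b ≢ 0ℚ

  #-sym : ∀ a b → a # b → b # a
  #-sym a b a#b eq = a#b (trans (flip a b) (cong -_ eq))
    where
    flip : ∀ a b → a - b ≡ - (b - a)
    flip = solve-∀ ℚ-ring

  ∏-diff : ℚ → List ℚ → ℚ
  ∏-diff z []       = 1ℚ
  ∏-diff z (y ∷ Y) = (z - y) * ∏-diff z Y

  ∏-inv : ℚ → List ℚ → ℚ
  ∏-inv z []       = 1ℚ
  ∏-inv z (x ∷ X) = inv (z - x) * ∏-inv z X

  -- For distinct points this is Σ_{x ∈ X} φ(x) / ∏_{x′ ≠ x} (x - x′), the divided difference of φ at X.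
  δ[_] : List ℚ → (ℚ → ℚ) → ℚ
  δ[ [] ]     φ = 0ℚ
  δ[ x ∷ X ] φ = φ x * ∏-inv x X + δ[ X ] (λ z → φ z * inv (z - x))

  δ-cong : ∀ {φ χ X} → All (λ x → φ x ≡ χ x) X → δ[ X ] φ ≡ δ[ X ] χ
  δ-cong []                        = refl
  δ-cong {X = x ∷ X} (eq ∷ eqs) = cong₂ _+_ (cong (_* ∏-inv x X) eq) (δ-cong (All.map (λ {z} e → cong (_* inv (z - x)) e) eqs))

  δ-ext : ∀ {φ χ : ℚ → ℚ} → (∀ x → φ x ≡ χ x) → ∀ X → δ[ X ] φ ≡ δ[ X ] χ
  δ-ext eq X = δ-cong (All.universal eq X)

  δ-linear : ∀ a b (φ χ : ℚ → ℚ) X → δ[ X ] (λ z → a * φ z + b * χ z) ≡ a * δ[ X ] φ + b * δ[ X ] χ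
  δ-linear a b φ χ []       = zero-lemma a b
    where
    zero-lemma : ∀ a b → 0ℚ ≡ a * 0ℚ + b * 0ℚ
    zero-lemma = solve-∀ ℚ-ring
  δ-linear a b φ χ (x ∷ X) = begin
    (a * φ x + b * χ x) * ∏-inv x X + δ[ X ] (λ z → (a * φ z + b * χ z) * inv (z - x))
      ≡⟨ cong ((a * φ x + b * χ x) * ∏-inv x X +_) (trans (δ-ext (λ z → distrib a b (φ z) (χ z) (inv (z - x))) X) (δ-linear a b _ _ X)) ⟩
    (a * φ x + b * χ x) * ∏-inv x X + (a * δ[ X ] (λ z → φ z * inv (z - x)) + b * δ[ X ] (λ z → χ z * inv (z - x)))
      ≡⟨ shuffle a b (φ x) (χ x) (∏-inv x X) _ _ ⟩
    a * δ[ x ∷ X ] φ + b * δ[ x ∷ X ] χ ∎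
    where
    distrib : ∀ a b p q i → (a * p + b * q) * i ≡ a * (p * i) + b * (q * i)
    distrib = solve-∀ ℚ-ring
    shuffle : ∀ a b p q i s t → (a * p + b * q) * i + (a * s + b * t) ≡ a * (p * i + s) + b * (q * i + t)
    shuffle = solve-∀ ℚ-ring

  δ-scale : ∀ a (φ : ℚ → ℚ) X → δ[ X ] (λ z → a * φ z) ≡ a * δ[ X ] φ
  δ-scale a φ X = begin
    δ[ X ] (λ z → a * φ z)               ≡⟨ δ-ext (λ z → pad a (φ z)) X ⟩
    δ[ X ] (λ z → a * φ z + 0ℚ * φ z)    ≡⟨ δ-linear a 0ℚ φ φ X ⟩
    a * δ[ X ] φ + 0ℚ * δ[ X ] φ         ≡⟨ sym (pad a (δ[ X ] φ)) ⟩
    a * δ[ X ] φ                         ∎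
    where
    pad : ∀ a p → a * p ≡ a * p + 0ℚ * p
    pad = solve-∀ ℚ-ring

  -- The head summand contains x - x; in the others the new factor cancels the `inv (z - x)` that
  -- the recursion of `δ[_]` inserts.
  δ-drop-head : ∀ {X} x (φ : ℚ → ℚ) → All (x #_) X → δ[ x ∷ X ] (λ z → (z - x) * φ z) ≡ δ[ X ] φ
  δ-drop-head {X} x φ x#X = begin
    (x - x) * φ x * ∏-inv x X + δ[ X ] (λ z → (z - x) * φ z * inv (z - x))
      ≡⟨ cong₂ _+_ (kill x (φ x) (∏-inv x X)) (δ-cong (All.map (λ {z} → cancel z) x#X)) ⟩
    0ℚ + δ[ X ] φ                                                             ≡⟨ +-identityˡ _ ⟩
    δ[ X ] φ                                                                  ∎
    where
    kill : ∀ x p i → (x - x) * p * i ≡ 0ℚ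
    kill = solve-∀ ℚ-ring
    shuffle : ∀ a p i → a * p * i ≡ a * i * p
    shuffle = solve-∀ ℚ-ring
    cancel : ∀ z → x # z → (z - x) * φ z * inv (z - x) ≡ φ z
    cancel z x#z = trans (shuffle (z - x) (φ z) (inv (z - x))) (trans (cong (_* φ z) (inv-cancel (#-sym x z x#z))) (*-identityˡ (φ z)))

  -- Divided differences are symmetric in the points, but the recursion exposes only the head.
  -- Removing the second point is the one further case needed, to play the two first points against
  -- each other in `δ-∏-leading`.
  δ-drop-second : ∀ {X} x x′ (φ : ℚ → ℚ) → x # x′ → All (x′ #_) X → δ[ x ∷ x′ ∷ X ] (λ z → (z - x′) * φ z) ≡ δ[ x ∷ X ] φ
  δ-drop-second {X} x x′ φ x#x′ x′#X = cong₂ _+_ first (trans (δ-ext (λ z → *-assoc (z - x′) (φ z) (inv (z - x))) (x′ ∷ X)) (δ-drop-head x′ _ x′#X))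
    where
    shuffle : ∀ a p i j → a * p * (i * j) ≡ a * i * (p * j)
    shuffle = solve-∀ ℚ-ring
    first : (x - x′) * φ x * ∏-inv x (x′ ∷ X) ≡ φ x * ∏-inv x X
    first = trans (shuffle (x - x′) (φ x) (inv (x - x′)) (∏-inv x X)) (trans (cong (_* (φ x * ∏-inv x X)) (inv-cancel x#x′)) (*-identityˡ _))

  Distinct : List ℚ → Set
  Distinct = AllPairs _#_

  -- The divided difference of a monic polynomial at as many points as its degree, and at one point
  -- more. The two are proved together: z - y = (z - x) + (x - y) reduces the first to fewer points
  -- and to the second, while x - x′ = (z - x′) - (z - x) writes the second as a difference of two
  -- instances of the first with one point less.
  δ-∏-subleading : ∀ X Y → Distinct X → length X ≡ length Y → δ[ X ] (λ z → ∏-diff z Y) ≡ ΣQ X - ΣQ Y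
  δ-∏-leading : ∀ X Y → Distinct X → length X ≡ suc (length Y) → δ[ X ] (λ z → ∏-diff z Y) ≡ 1ℚ

  δ-∏-subleading []       []       _            _  = refl
  δ-∏-subleading (x ∷ X) (y ∷ Y) (x#X ∷ dX) eq = begin
    δ[ x ∷ X ] (λ z → (z - y) * ∏-diff z Y)
      ≡⟨ δ-ext (λ z → split z x y (∏-diff z Y)) (x ∷ X) ⟩
    δ[ x ∷ X ] (λ z → 1ℚ * ((z - x) * ∏-diff z Y) + (x - y) * ∏-diff z Y)
      ≡⟨ δ-linear 1ℚ (x - y) (λ z → (z - x) * ∏-diff z Y) (λ z → ∏-diff z Y) (x ∷ X) ⟩
    1ℚ * δ[ x ∷ X ] (λ z → (z - x) * ∏-diff z Y) + (x - y) * δ[ x ∷ X ] (λ z → ∏-diff z Y)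
      ≡⟨ cong₂ (λ s t → 1ℚ * s + (x - y) * t) (trans (δ-drop-head x _ x#X) (δ-∏-subleading X Y dX (ℕ.suc-injective eq))) (δ-∏-leading (x ∷ X) Y (x#X ∷ dX) eq) ⟩
    1ℚ * (ΣQ X - ΣQ Y) + (x - y) * 1ℚ
      ≡⟨ collect x y (ΣQ X) (ΣQ Y) ⟩
    x + ΣQ X - (y + ΣQ Y) ∎
    where
    split : ∀ z x y p → (z - y) * p ≡ 1ℚ * ((z - x) * p) + (x - y) * p
    split = solve-∀ ℚ-ring
    collect : ∀ x y s t → 1ℚ * (s - t) + (x - y) * 1ℚ ≡ x + s - (y + t)
    collect = solve-∀ ℚ-ring

  δ-∏-leading (x ∷ [])          [] _                                  _  = refl
  δ-∏-leading (x ∷ x′ ∷ X) Y ((x#x′ ∷ x#X) ∷ (x′#X ∷ dX)) eq = *-cancelˡ x#x′ (begin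
    (x - x′) * δ[ x ∷ x′ ∷ X ] π
      ≡⟨ sym (δ-scale (x - x′) π (x ∷ x′ ∷ X)) ⟩
    δ[ x ∷ x′ ∷ X ] (λ z → (x - x′) * π z)
      ≡⟨ δ-ext (λ z → split z x x′ (π z)) (x ∷ x′ ∷ X) ⟩
    δ[ x ∷ x′ ∷ X ] (λ z → 1ℚ * ((z - x′) * π z) + (- 1ℚ) * ((z - x) * π z))
      ≡⟨ δ-linear 1ℚ (- 1ℚ) (λ z → (z - x′) * π z) (λ z → (z - x) * π z) (x ∷ x′ ∷ X) ⟩
    1ℚ * δ[ x ∷ x′ ∷ X ] (λ z → (z - x′) * π z) + (- 1ℚ) * δ[ x ∷ x′ ∷ X ] (λ z → (z - x) * π z)
      ≡⟨ cong₂ (λ s t → 1ℚ * s + (- 1ℚ) * t)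
          (trans (δ-drop-second x x′ π x#x′ x′#X) (δ-∏-subleading (x ∷ X) Y (x#X ∷ dX) (ℕ.suc-injective eq)))
          (trans (δ-drop-head x π (x#x′ ∷ x#X)) (δ-∏-subleading (x′ ∷ X) Y (x′#X ∷ dX) (ℕ.suc-injective eq))) ⟩
    1ℚ * (x + ΣQ X - ΣQ Y) + (- 1ℚ) * (x′ + ΣQ X - ΣQ Y)
      ≡⟨ collect x x′ (ΣQ X) (ΣQ Y) ⟩
    (x - x′) * 1ℚ ∎)
    where
    π : ℚ → ℚ
    π z = ∏-diff z Y
    split : ∀ z x x′ p → (x - x′) * p ≡ 1ℚ * ((z - x′) * p) + (- 1ℚ) * ((z - x) * p)
    split = solve-∀ ℚ-ring
    collect : ∀ x x′ s t → 1ℚ * (x + s - t) + (- 1ℚ) * (x′ + s - t) ≡ (x - x′) * 1ℚ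
    collect = solve-∀ ℚ-ring

  -- Addable boxes and the weights H λ / H λ⁺

  -- Contents (column minus row) of the boxes which may be added to a row or below the last row. When row i + 1 has the
  -- length of row i, nothing can be added to it, and its point in outer also occurs in inner: the two cancel in
  -- ∏ (z - inner) / ∏ (z - outer), which therefore only depends on the corners. The offset c is 0 for a full partition.
  outer : ℚ → Partition → List ℚ
  outer c []       = c ∷ []
  outer c (r ∷ rs) = (c + ι r) ∷ outer (c - 1ℚ) rs

  inner : ℚ → Partition → List ℚ
  inner c []       = []
  inner c (r ∷ rs) = (c + ι r - 1ℚ) ∷ inner (c - 1ℚ) rs

  ξ : ℚ → Partition → ℕ → ℚ
  ξ c []       _       = c
  ξ c (r ∷ rs) zero    = c + ι r
  ξ c (r ∷ rs) (suc i) = ξ (c - 1ℚ) rs i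

  outer-ξ : ∀ {P : ℚ → Set} c ρ {i} → i ℕ.≤ length ρ → All P (outer c ρ) → P (ξ c ρ i)
  outer-ξ c []       _           (p ∷ [])  = p
  outer-ξ c (r ∷ rs) {zero}  _           (p ∷ _)   = p
  outer-ξ c (r ∷ rs) {suc i} (ℕ.s≤s i≤n) (_ ∷ ps)  = outer-ξ (c - 1ℚ) rs i≤n ps

  length-outer : ∀ c ρ → length (outer c ρ) ≡ suc (length (inner c ρ))
  length-outer c []       = refl
  length-outer c (r ∷ rs) = cong suc (length-outer (c - 1ℚ) rs)

  Decreasing-tail : ∀ {r rs} → Decreasing (r ∷ rs) → Decreasing rs
  Decreasing-tail [ _ ]    = []
  Decreasing-tail (_ ∷ dec) = dec

  -- A row of length `r` above `ρ` has offset c + 1, hence the point c + 1 + r. The slack `k` makes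
  -- the induction work: passing a row of length `s` increases it by r - s + 1, so the distance
  -- stays the image of a successor.
  outer-apart : ∀ {r} c ρ k → Decreasing (r ∷ ρ) → All ((c + ι (suc (k ℕ.+ r))) #_) (outer c ρ)
  outer-apart {r} c []      k _            = (λ eq → ι-suc≢0 (k ℕ.+ r) (trans (sym (cancel c _)) eq)) ∷ []
    where
    cancel : ∀ c n → c + n - c ≡ n
    cancel = solve-∀ ℚ-ring
  outer-apart {r} c (s ∷ ρ) k (s≤r ∷ dec) = (λ eq → ι-suc≢0 (k ℕ.+ d) (trans (sym apart) eq)) ∷
    subst (λ z → All (z #_) (outer (c - 1ℚ) ρ)) shift (outer-apart (c - 1ℚ) ρ (suc (k ℕ.+ d)) dec)
    where
    d = r ℕ.∸ s
    k+r : k ℕ.+ r ≡ k ℕ.+ d ℕ.+ s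
    k+r = trans (cong (k ℕ.+_) (sym (ℕ.m∸n+n≡m s≤r))) (sym (ℕ.+-assoc k d s))
    cancel : ∀ c m s → c + (m + s) - (c + s) ≡ m
    cancel = solve-∀ ℚ-ring
    apart : c + ι (suc (k ℕ.+ r)) - (c + ι s) ≡ ι (suc (k ℕ.+ d))
    apart = begin
      c + ι (suc (k ℕ.+ r)) - (c + ι s)
        ≡⟨ cong (λ n → c + n - (c + ι s)) (trans (cong (ι ∘ suc) k+r) (ι-+ (suc (k ℕ.+ d)) s)) ⟩
      c + (ι (suc (k ℕ.+ d)) + ι s) - (c + ι s)      ≡⟨ cancel c (ι (suc (k ℕ.+ d))) (ι s) ⟩
      ι (suc (k ℕ.+ d))                              ∎
    unshift : ∀ c m → c - 1ℚ + (1ℚ + m) ≡ c + m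
    unshift = solve-∀ ℚ-ring
    shift : c - 1ℚ + ι (suc (suc (k ℕ.+ d) ℕ.+ s)) ≡ c + ι (suc (k ℕ.+ r))
    shift = begin
      c - 1ℚ + ι (suc (suc (k ℕ.+ d) ℕ.+ s))         ≡⟨ cong (c - 1ℚ +_) (ι-suc (suc (k ℕ.+ d) ℕ.+ s)) ⟩
      c - 1ℚ + (1ℚ + ι (suc (k ℕ.+ d ℕ.+ s)))        ≡⟨ unshift c _ ⟩
      c + ι (suc (k ℕ.+ d ℕ.+ s))                    ≡⟨ cong (λ n → c + ι (suc n)) (sym k+r) ⟩
      c + ι (suc (k ℕ.+ r))                          ∎

  shift-row : ∀ c r → c - 1ℚ + ι (suc r) ≡ c + ι r
  shift-row c r = trans (cong (c - 1ℚ +_) (ι-suc r)) (unshift c (ι r))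
    where
    unshift : ∀ c m → c - 1ℚ + (1ℚ + m) ≡ c + m
    unshift = solve-∀ ℚ-ring

  grow-row : ∀ c r → c + ι (suc r) ≡ c + ι r + 1ℚ
  grow-row c r = trans (cong (c +_) (ι-suc r)) (comm c (ι r))
    where
    comm : ∀ c m → c + (1ℚ + m) ≡ c + m + 1ℚ
    comm = solve-∀ ℚ-ring

  row-apart : ∀ c r rs → Decreasing (r ∷ rs) → All ((c + ι r) #_) (outer (c - 1ℚ) rs)
  row-apart c r rs dec = subst (λ z → All (z #_) (outer (c - 1ℚ) rs)) (shift-row c r) (outer-apart (c - 1ℚ) rs 0 dec)

  Distinct-outer : ∀ c ρ → Decreasing ρ → Distinct (outer c ρ)
  Distinct-outer c []       _   = [] ∷ []
  Distinct-outer c (r ∷ rs) dec = row-apart c r rs dec ∷ Distinct-outer (c - 1ℚ) rs (Decreasing-tail dec)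

  ι-! : ∀ n → ι (suc n ℕ.!) ≡ ι (suc n) * ι (n ℕ.!)
  ι-! n = ι-* (suc n) (n ℕ.!)

  ι-!≢0 : ∀ n → ι (n ℕ.!) ≢ 0ℚ
  ι-!≢0 zero    eq = ι-suc≢0 0 eq
  ι-!≢0 (suc n) eq = ι-!≢0 n (*-cancelˡ (ι-suc≢0 n) (trans (sym (ι-! n)) (trans eq (sym (*-zeroʳ (ι (suc n)))))))

  ι-suc-inv-! : ∀ n → ι (suc n) * inv (ι (suc n ℕ.!)) ≡ inv (ι (n ℕ.!))
  ι-suc-inv-! n = *-cancelˡ (ι-!≢0 n) (begin
    ι (n ℕ.!) * (ι (suc n) * inv (ι (suc n ℕ.!)))     ≡⟨ shuffle (ι (n ℕ.!)) (ι (suc n)) _ ⟩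
    ι (suc n) * ι (n ℕ.!) * inv (ι (suc n ℕ.!))       ≡⟨ cong (_* inv (ι (suc n ℕ.!))) (sym (ι-! n)) ⟩
    ι (suc n ℕ.!) * inv (ι (suc n ℕ.!))               ≡⟨ inv-cancel (ι-!≢0 (suc n)) ⟩
    1ℚ                                                ≡⟨ sym (inv-cancel (ι-!≢0 n)) ⟩
    ι (n ℕ.!) * inv (ι (n ℕ.!))                       ∎)
    where
    shuffle : ∀ a b i → a * (b * i) ≡ b * a * i
    shuffle = solve-∀ ℚ-ring

  -- ∏_{x ∈ outer c ρ} (z - x) / (n + length ρ)!; with z = c + n it is the inverse product of the hook lengths
  -- in a row of length n - 1 placed on top of ρ.
  rowFactor : ℕ → ℚ → Partition → ℚ → ℚ
  rowFactor n c []       z = (z - c) * inv (ι (n ℕ.!))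
  rowFactor n c (r ∷ rs) z = (z - (c + ι r)) * rowFactor (suc n) (c - 1ℚ) rs z

  -- The Frobenius form of 1 / H; unlike 1 / H it vanishes at incrRow ρ i when row i is not addable.
  G : ℚ → Partition → ℚ
  G c []       = 1ℚ
  G c (r ∷ rs) = G (c - 1ℚ) rs * rowFactor (suc r) (c - 1ℚ) rs (c + ι r)

  next-offset : ∀ z c n → z - c ≡ ι n → z - (c - 1ℚ) ≡ ι (suc n)
  next-offset z c n eq = trans (shuffle z c) (trans (cong (1ℚ +_) eq) (sym (ι-suc n)))
    where
    shuffle : ∀ z c → z - (c - 1ℚ) ≡ 1ℚ + (z - c)
    shuffle = solve-∀ ℚ-ring

  -- The point of the row moves from ξ to ξ + 1; the ratio is cross-multiplied to avoid inverses.
  -- The hypothesis on `z` serves the case of a new row: its additional factor z - (c - 1) is n + 1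
  -- and offsets the growth of the factorial.
  rowFactor-incrRow : ∀ n c ρ z {i} → i ℕ.≤ length ρ → z - c ≡ ι n →
    rowFactor n c (incrRow ρ i) z * (z - ξ c ρ i) ≡ rowFactor n c ρ z * (z - ξ c ρ i - 1ℚ)
  rowFactor-incrRow n c []       z         _ eq = begin
    (z - (c + ι 1)) * ((z - (c - 1ℚ)) * inv (ι (suc n ℕ.!))) * (z - c)
      ≡⟨ cong₂ (λ s t → (z - (c + s)) * t * (z - c)) ι-1 (trans (cong (_* inv (ι (suc n ℕ.!))) (next-offset z c n eq)) (ι-suc-inv-! n)) ⟩
    (z - (c + 1ℚ)) * inv (ι (n ℕ.!)) * (z - c)                           ≡⟨ shuffle z c _ ⟩
    (z - c) * inv (ι (n ℕ.!)) * (z - c - 1ℚ)                             ∎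
    where
    shuffle : ∀ z c i → (z - (c + 1ℚ)) * i * (z - c) ≡ (z - c) * i * (z - c - 1ℚ)
    shuffle = solve-∀ ℚ-ring
  rowFactor-incrRow n c (r ∷ rs) z {zero}  _ eq =
    trans (cong (λ x → (z - x) * rowFactor (suc n) (c - 1ℚ) rs z * (z - (c + ι r))) (grow-row c r)) (shuffle z (c + ι r) _)
    where
    shuffle : ∀ z x f → (z - (x + 1ℚ)) * f * (z - x) ≡ (z - x) * f * (z - x - 1ℚ)
    shuffle = solve-∀ ℚ-ring
  rowFactor-incrRow n c (r ∷ rs) z {suc i} (ℕ.s≤s i≤n) eq = begin
    (z - (c + ι r)) * rowFactor (suc n) (c - 1ℚ) (incrRow rs i) z * (z - ξ (c - 1ℚ) rs i)     ≡⟨ *-assoc (z - (c + ι r)) _ _ ⟩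
    (z - (c + ι r)) * (rowFactor (suc n) (c - 1ℚ) (incrRow rs i) z * (z - ξ (c - 1ℚ) rs i))
      ≡⟨ cong ((z - (c + ι r)) *_) (rowFactor-incrRow (suc n) (c - 1ℚ) rs z i≤n (next-offset z c n eq)) ⟩
    (z - (c + ι r)) * (rowFactor (suc n) (c - 1ℚ) rs z * (z - ξ (c - 1ℚ) rs i - 1ℚ))
      ≡⟨ sym (*-assoc (z - (c + ι r)) _ _) ⟩
    (z - (c + ι r)) * rowFactor (suc n) (c - 1ℚ) rs z * (z - ξ (c - 1ℚ) rs i - 1ℚ)            ∎

  -- Lengthening the row on top moves its own point from z to z + 1, and z + 1 - x = z - (x - 1)
  -- turns each outer point into the inner point of the same row. The bottom point has no such
  -- partner; its factor n + 1 is absorbed by the factorial.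
  rowFactor-suc : ∀ n c ρ z → z - c ≡ ι n → All (z #_) (outer c ρ) →
    rowFactor (suc n) c ρ (z + 1ℚ) ≡ rowFactor n c ρ z * (∏-diff z (inner c ρ) * ∏-inv z (outer c ρ))
  rowFactor-suc n c [] z eq (z#c ∷ []) = begin
    (z + 1ℚ - c) * inv (ι (suc n ℕ.!))
      ≡⟨ cong (_* inv (ι (suc n ℕ.!))) (trans (shift z c) (next-offset z c n eq)) ⟩
    ι (suc n) * inv (ι (suc n ℕ.!))                             ≡⟨ ι-suc-inv-! n ⟩
    inv (ι (n ℕ.!))                                             ≡⟨ sym (*-identityˡ _) ⟩
    1ℚ * inv (ι (n ℕ.!))                                        ≡⟨ cong (_* inv (ι (n ℕ.!))) (sym (inv-cancel z#c)) ⟩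
    (z - c) * inv (z - c) * inv (ι (n ℕ.!))                     ≡⟨ shuffle (z - c) (inv (z - c)) (inv (ι (n ℕ.!))) ⟩
    (z - c) * inv (ι (n ℕ.!)) * (1ℚ * (inv (z - c) * 1ℚ))       ∎
    where
    shift : ∀ z c → z + 1ℚ - c ≡ z - (c - 1ℚ)
    shift = solve-∀ ℚ-ring
    shuffle : ∀ a i j → a * i * j ≡ a * j * (1ℚ * (i * 1ℚ))
    shuffle = solve-∀ ℚ-ring
  rowFactor-suc n c (r ∷ rs) z eq (z#x ∷ z#xs) = begin
    (z + 1ℚ - x) * rowFactor (suc (suc n)) (c - 1ℚ) rs (z + 1ℚ)
      ≡⟨ cong ((z + 1ℚ - x) *_) (rowFactor-suc (suc n) (c - 1ℚ) rs z (next-offset z c n eq) z#xs) ⟩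
    (z + 1ℚ - x) * (F * (π * κ))
      ≡⟨ pad (z + 1ℚ - x) (F * (π * κ)) ⟩
    1ℚ * ((z + 1ℚ - x) * (F * (π * κ)))
      ≡⟨ cong (_* ((z + 1ℚ - x) * (F * (π * κ)))) (sym (inv-cancel z#x)) ⟩
    (z - x) * inv (z - x) * ((z + 1ℚ - x) * (F * (π * κ)))
      ≡⟨ shuffle z x (inv (z - x)) F π κ ⟩
    (z - x) * F * ((z - (x - 1ℚ)) * π * (inv (z - x) * κ)) ∎
    where
    x = c + ι r
    F = rowFactor (suc n) (c - 1ℚ) rs z
    π = ∏-diff z (inner (c - 1ℚ) rs)
    κ = ∏-inv z (outer (c - 1ℚ) rs)
    pad : ∀ a b → a * b ≡ 1ℚ * (a * b)
    pad = solve-∀ ℚ-ring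
    shuffle : ∀ z x i F π κ → (z - x) * i * ((z + 1ℚ - x) * (F * (π * κ))) ≡ (z - x) * F * ((z - (x - 1ℚ)) * π * (i * κ))
    shuffle = solve-∀ ℚ-ring

  -- Σ_x g(x) G(ρ + x) / G(ρ) over the points x of outer c ρ.
  average : ℚ → Partition → (ℚ → ℚ) → ℚ
  average c ρ g = δ[ outer c ρ ] (λ z → g z * ∏-diff z (inner c ρ))

  row-offset : ∀ c r → c + ι r - (c - 1ℚ) ≡ ι (suc r)
  row-offset c r = trans (shuffle c (ι r)) (sym (ι-suc r))
    where
    shuffle : ∀ c m → c + m - (c - 1ℚ) ≡ 1ℚ + m
    shuffle = solve-∀ ℚ-ring

  -- The test function has to be arbitrary: a box at e below the top row also changes the factor of
  -- the top row, in the ratio (e - x + 1) / (e - x). The induction absorbs it into `g′`, and it is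
  -- precisely what the top row contributes to the divided difference through its inner point x - 1
  -- and its outer point x.
  ∑-G-incrRow : ∀ c ρ (g : ℚ → ℚ) → Decreasing ρ →
    ∑ (upTo (suc (length ρ))) (λ i → G c (incrRow ρ i) * g (ξ c ρ i)) ≡ G c ρ * average c ρ g
  ∑-G-incrRow c []       g _   = begin
    1ℚ * ((c + ι 1 - (c - 1ℚ)) * inv (ι 2)) * g c + 0ℚ
      ≡⟨ cong (λ s → 1ℚ * s * g c + 0ℚ) (trans (cong (_* inv (ι 2)) (row-offset c 1)) (inv-cancel (ι-suc≢0 1))) ⟩
    1ℚ * 1ℚ * g c + 0ℚ                                     ≡⟨ shuffle (g c) ⟩
    1ℚ * (g c * 1ℚ * 1ℚ + 0ℚ)                              ∎
    where
    shuffle : ∀ a → 1ℚ * 1ℚ * a + 0ℚ ≡ 1ℚ * (a * 1ℚ * 1ℚ + 0ℚ)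
    shuffle = solve-∀ ℚ-ring
  ∑-G-incrRow c (r ∷ rs) g dec = begin
    ∑ (upTo (suc (suc (length rs)))) (λ i → G c (incrRow (r ∷ rs) i) * g (ξ c (r ∷ rs) i))
      ≡⟨ ∑-upTo-suc (λ i → G c (incrRow (r ∷ rs) i) * g (ξ c (r ∷ rs) i)) (suc (length rs)) ⟩
    G c (suc r ∷ rs) * g x + ∑ (upTo (suc (length rs))) (λ i → G c (r ∷ incrRow rs i) * g (ξ (c - 1ℚ) rs i))
      ≡⟨ cong₂ _+_ first (trans (∑-upTo-cong (suc (length rs)) rest) (trans (∑-distribˡ-* F _ (upTo (suc (length rs)))) (cong (F *_) (∑-G-incrRow (c - 1ℚ) rs g′ (Decreasing-tail dec))))) ⟩
    Grs * (F * (π x * κ)) * g x + F * (Grs * average (c - 1ℚ) rs g′)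
      ≡⟨ cong (λ s → Grs * (F * (π x * κ)) * g x + F * (Grs * s)) (δ-ext (λ z → assoc (g z) (z - (x - 1ℚ)) (inv (z - x)) (π z)) (outer (c - 1ℚ) rs)) ⟩
    Grs * (F * (π x * κ)) * g x + F * (Grs * δ[ outer (c - 1ℚ) rs ] (λ z → g z * ((z - (x - 1ℚ)) * π z) * inv (z - x)))
      ≡⟨ shuffle x Grs F (π x) κ (g x) _ ⟩
    Grs * F * (g x * ((x - (x - 1ℚ)) * π x) * κ + δ[ outer (c - 1ℚ) rs ] (λ z → g z * ((z - (x - 1ℚ)) * π z) * inv (z - x))) ∎
    where
    x = c + ι r
    Grs = G (c - 1ℚ) rs
    F = rowFactor (suc r) (c - 1ℚ) rs x
    κ = ∏-inv x (outer (c - 1ℚ) rs)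
    π : ℚ → ℚ
    π z = ∏-diff z (inner (c - 1ℚ) rs)
    g′ : ℚ → ℚ
    g′ z = g z * ((z - (x - 1ℚ)) * inv (z - x))
    apart = row-apart c r rs dec
    assoc : ∀ a b i p → a * (b * i) * p ≡ a * (b * p) * i
    assoc = solve-∀ ℚ-ring
    shuffle : ∀ x G F p k g s → G * (F * (p * k)) * g + F * (G * s) ≡ G * F * (g * ((x - (x - 1ℚ)) * p) * k + s)
    shuffle = solve-∀ ℚ-ring
    first : G c (suc r ∷ rs) * g x ≡ Grs * (F * (π x * κ)) * g x
    first = cong (λ s → Grs * s * g x) (trans (cong (rowFactor (suc (suc r)) (c - 1ℚ) rs) (grow-row c r)) (rowFactor-suc (suc r) (c - 1ℚ) rs x (row-offset c r) apart))
    flip : ∀ e x f → f * (x - e) ≡ (- 1ℚ) * ((e - x) * f)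
    flip = solve-∀ ℚ-ring
    regroup : ∀ e x f G g i → (e - x) * (G * (f * ((e - (x - 1ℚ)) * i)) * g) ≡ (- 1ℚ) * (f * (x - e - 1ℚ)) * (G * g) * ((e - x) * i)
    regroup = solve-∀ ℚ-ring
    regroup′ : ∀ a G f g → a * (G * f * g) ≡ (- 1ℚ) * (f * (- a)) * (G * g) * 1ℚ
    regroup′ = solve-∀ ℚ-ring
    regroup″ : ∀ f G i e x g → G * (f * ((e - (x - 1ℚ)) * i)) * g ≡ f * (G * (g * ((e - (x - 1ℚ)) * i)))
    regroup″ = solve-∀ ℚ-ring
    neg-diff : ∀ e x → - (e - x) ≡ x - e
    neg-diff = solve-∀ ℚ-ring
    rest : ∀ i → i ℕ.< suc (length rs) →
      G (c - 1ℚ) (incrRow rs i) * rowFactor (suc r) (c - 1ℚ) (incrRow rs i) x * g (ξ (c - 1ℚ) rs i)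
        ≡ F * (G (c - 1ℚ) (incrRow rs i) * g′ (ξ (c - 1ℚ) rs i))
    -- Multiplication by e - x gives access to the cross-multiplied form of the ratio.
    rest i (ℕ.s≤s i≤n) = trans (*-cancelˡ {e - x} (#-sym x e x#e) (begin
      (e - x) * (Gi * Fi * g e)                                          ≡⟨ regroup′ (e - x) Gi Fi (g e) ⟩
      (- 1ℚ) * (Fi * (- (e - x))) * (Gi * g e) * 1ℚ
        ≡⟨ cong (λ s → (- 1ℚ) * (Fi * s) * (Gi * g e) * 1ℚ) (neg-diff e x) ⟩
      (- 1ℚ) * (Fi * (x - e)) * (Gi * g e) * 1ℚ
        ≡⟨ cong₂ (λ s t → (- 1ℚ) * s * (Gi * g e) * t) (rowFactor-incrRow (suc r) (c - 1ℚ) rs x i≤n (row-offset c r)) (sym (inv-cancel (#-sym x e x#e))) ⟩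
      (- 1ℚ) * (F * (x - e - 1ℚ)) * (Gi * g e) * ((e - x) * inv (e - x)) ≡⟨ sym (regroup e x F Gi (g e) (inv (e - x))) ⟩
      (e - x) * (Gi * (F * ((e - (x - 1ℚ)) * inv (e - x))) * g e)        ∎)) (regroup″ F Gi (inv (e - x)) e x (g e))
      where
      e = ξ (c - 1ℚ) rs i
      Gi = G (c - 1ℚ) (incrRow rs i)
      Fi = rowFactor (suc r) (c - 1ℚ) (incrRow rs i) x
      x#e : x # e
      x#e = outer-ξ (c - 1ℚ) rs i≤n apart

  -- Power sums and Newton's identity

  -- The sum of φ over the outer points minus the sum over the inner points; coinciding points
  -- cancel, so it depends on the corners alone.
  signedSum : ℚ → (ℚ → ℚ) → Partition → ℚ
  signedSum c φ []       = φ c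
  signedSum c φ (r ∷ rs) = φ (c + ι r) - φ (c + ι r - 1ℚ) + signedSum (c - 1ℚ) φ rs

  -- The outer point moves from ξ to ξ + 1 and its inner partner from ξ - 1 to ξ. A new row replaces
  -- the bottom point c by the outer points c + 1 and c - 1 and the inner point c, with the same
  -- effect.
  signedSum-incrRow : ∀ c φ ρ {i} → i ℕ.≤ length ρ →
    signedSum c φ (incrRow ρ i) ≡ signedSum c φ ρ + (φ (ξ c ρ i + 1ℚ) - (1ℚ + 1ℚ) * φ (ξ c ρ i) + φ (ξ c ρ i - 1ℚ))
  signedSum-incrRow c φ []       _ = begin
    φ (c + ι 1) - φ (c + ι 1 - 1ℚ) + φ (c - 1ℚ)
      ≡⟨ cong₂ (λ s t → φ s - φ t + φ (c - 1ℚ)) (cong (c +_) ι-1) (trans (cong (λ s → c + s - 1ℚ) ι-1) (cancel c)) ⟩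
    φ (c + 1ℚ) - φ c + φ (c - 1ℚ)                  ≡⟨ shuffle (φ (c + 1ℚ)) (φ c) (φ (c - 1ℚ)) ⟩
    φ c + (φ (c + 1ℚ) - (1ℚ + 1ℚ) * φ c + φ (c - 1ℚ)) ∎
    where
    cancel : ∀ c → c + 1ℚ - 1ℚ ≡ c
    cancel = solve-∀ ℚ-ring
    shuffle : ∀ p q r → p - q + r ≡ q + (p - (1ℚ + 1ℚ) * q + r)
    shuffle = solve-∀ ℚ-ring
  signedSum-incrRow c φ (r ∷ rs) {zero} _ = begin
    φ (c + ι (suc r)) - φ (c + ι (suc r) - 1ℚ) + S
      ≡⟨ cong₂ (λ s t → φ s - φ t + S) (grow-row c r) (trans (cong (_- 1ℚ) (grow-row c r)) (cancel x)) ⟩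
    φ (x + 1ℚ) - φ x + S                               ≡⟨ shuffle (φ (x + 1ℚ)) (φ x) (φ (x - 1ℚ)) S ⟩
    φ x - φ (x - 1ℚ) + S + (φ (x + 1ℚ) - (1ℚ + 1ℚ) * φ x + φ (x - 1ℚ)) ∎
    where
    x = c + ι r
    S = signedSum (c - 1ℚ) φ rs
    cancel : ∀ c → c + 1ℚ - 1ℚ ≡ c
    cancel = solve-∀ ℚ-ring
    shuffle : ∀ p q r s → p - q + s ≡ q - r + s + (p - (1ℚ + 1ℚ) * q + r)
    shuffle = solve-∀ ℚ-ring
  signedSum-incrRow c φ (r ∷ rs) {suc i} (ℕ.s≤s i≤n) =
    trans (cong (φ (c + ι r) - φ (c + ι r - 1ℚ) +_) (signedSum-incrRow (c - 1ℚ) φ rs i≤n))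
          (sym (+-assoc (φ (c + ι r) - φ (c + ι r - 1ℚ)) (signedSum (c - 1ℚ) φ rs) _))

  signedSum-ext : ∀ {φ χ : ℚ → ℚ} → (∀ z → φ z ≡ χ z) → ∀ c ρ → signedSum c φ ρ ≡ signedSum c χ ρ
  signedSum-ext eq c []       = eq c
  signedSum-ext eq c (r ∷ rs) = cong₂ _+_ (cong₂ _-_ (eq _) (eq _)) (signedSum-ext eq (c - 1ℚ) rs)

  signedSum-linear : ∀ a b φ χ c ρ →
    signedSum c (λ z → a * φ z + b * χ z) ρ ≡ a * signedSum c φ ρ + b * signedSum c χ ρ
  signedSum-linear a b φ χ c []       = refl
  signedSum-linear a b φ χ c (r ∷ rs) = trans (cong (a * φ (c + ι r) + b * χ (c + ι r) - (a * φ (c + ι r - 1ℚ) + b * χ (c + ι r - 1ℚ)) +_) (signedSum-linear a b φ χ (c - 1ℚ) rs))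
    (shuffle a b (φ (c + ι r)) (φ (c + ι r - 1ℚ)) (χ (c + ι r)) (χ (c + ι r - 1ℚ)) _ _)
    where
    shuffle : ∀ a b p p′ q q′ s t → a * p + b * q - (a * p′ + b * q′) + (a * s + b * t) ≡ a * (p - p′ + s) + b * (q - q′ + t)
    shuffle = solve-∀ ℚ-ring

  -- These are the complete homogeneous symmetric functions of the outer points minus the inner
  -- points, with generating function ∏ (1 - y u) / ∏ (1 - x u).
  moment : ℚ → Partition → ℕ → ℚ
  moment c ρ m = average c ρ (_^ m)

  moment-zero : ∀ c ρ → Decreasing ρ → moment c ρ 0 ≡ 1ℚ
  moment-zero c ρ dec = trans (δ-ext (λ z → *-identityˡ _) (outer c ρ))
    (δ-∏-leading (outer c ρ) (inner c ρ) (Distinct-outer c ρ dec) (length-outer c ρ))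

  -- Write one factor z as x + (z - x); the second part removes the point x and leaves a divided
  -- difference for the lower rows.
  moment-suc : ∀ c r rs m → Decreasing (r ∷ rs) →
    moment c (r ∷ rs) (suc m) ≡
      (c + ι r) * moment c (r ∷ rs) m + moment (c - 1ℚ) rs (suc m) - (c + ι r - 1ℚ) * moment (c - 1ℚ) rs m
  moment-suc c r rs m dec = begin
    δ[ x ∷ X ] (λ z → z * z ^ m * ((z - y) * π z))
      ≡⟨ δ-ext (λ z → split x y z (z ^ m) (π z)) (x ∷ X) ⟩
    δ[ x ∷ X ] (λ z → x * (z ^ m * ((z - y) * π z)) + 1ℚ * ((z - x) * (1ℚ * (z * z ^ m * π z) + (- y) * (z ^ m * π z))))
      ≡⟨ δ-linear x 1ℚ _ (λ z → (z - x) * (1ℚ * (z * z ^ m * π z) + (- y) * (z ^ m * π z))) (x ∷ X) ⟩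
    x * moment c (r ∷ rs) m + 1ℚ * δ[ x ∷ X ] (λ z → (z - x) * (1ℚ * (z * z ^ m * π z) + (- y) * (z ^ m * π z)))
      ≡⟨ cong (λ s → x * moment c (r ∷ rs) m + 1ℚ * s) (trans (δ-drop-head x _ (row-apart c r rs dec)) (δ-linear 1ℚ (- y) _ _ X)) ⟩
    x * moment c (r ∷ rs) m + 1ℚ * (1ℚ * moment (c - 1ℚ) rs (suc m) + (- y) * moment (c - 1ℚ) rs m)
      ≡⟨ collect x y _ _ _ ⟩
    x * moment c (r ∷ rs) m + moment (c - 1ℚ) rs (suc m) - y * moment (c - 1ℚ) rs m ∎
    where
    x = c + ι r
    y = x - 1ℚ
    X = outer (c - 1ℚ) rs
    π : ℚ → ℚ
    π z = ∏-diff z (inner (c - 1ℚ) rs)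
    split : ∀ x y z p π → z * p * ((z - y) * π) ≡ x * (p * ((z - y) * π)) + 1ℚ * ((z - x) * (1ℚ * (z * p * π) + (- y) * (p * π)))
    split = solve-∀ ℚ-ring
    collect : ∀ x y a b d → x * a + 1ℚ * (1ℚ * b + (- y) * d) ≡ x * a + b - y * d
    collect = solve-∀ ℚ-ring

  -- The sum of a_j h_(m-1-j) over j < m. The index is lowered by one because Newton's identity
  -- multiplies the power sum p_(j+1) by h_(m-1-j).
  conv : (ℕ → ℚ) → (ℕ → ℚ) → ℕ → ℚ
  conv a h zero    = 0ℚ
  conv a h (suc m) = a 0 * h m + conv (a ∘ suc) h m

  conv-cong : ∀ {a b : ℕ → ℚ} → (∀ j → a j ≡ b j) → ∀ h m → conv a h m ≡ conv b h m
  conv-cong eq h zero    = refl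
  conv-cong eq h (suc m) = cong₂ _+_ (cong (_* h m) (eq 0)) (conv-cong (eq ∘ suc) h m)

  conv-linear : ∀ s t a b h m → conv (λ j → s * a j + t * b j) h m ≡ s * conv a h m + t * conv b h m
  conv-linear s t a b h zero    = shuffle s t
    where
    shuffle : ∀ s t → 0ℚ ≡ s * 0ℚ + t * 0ℚ
    shuffle = solve-∀ ℚ-ring
  conv-linear s t a b h (suc m) = trans (cong ((s * a 0 + t * b 0) * h m +_) (conv-linear s t (a ∘ suc) (b ∘ suc) h m)) (shuffle s t (a 0) (b 0) (h m) _ _)
    where
    shuffle : ∀ s t a b h p q → (s * a + t * b) * h + (s * p + t * q) ≡ s * (a * h + p) + t * (b * h + q)
    shuffle = solve-∀ ℚ-ring

  conv-powers : ∀ z h m → conv (λ j → z ^ suc j) h (suc m) ≡ z * h m + z * conv (λ j → z ^ suc j) h m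
  conv-powers z h m = cong₂ _+_ (cong (_* h m) (*-identityʳ z)) (begin
    conv (λ j → z * z ^ suc j) h m                       ≡⟨ conv-cong (λ j → pad z (z ^ suc j)) h m ⟩
    conv (λ j → z * z ^ suc j + 0ℚ * z ^ suc j) h m      ≡⟨ conv-linear z 0ℚ _ _ h m ⟩
    z * conv (λ j → z ^ suc j) h m + 0ℚ * conv (λ j → z ^ suc j) h m ≡⟨ sym (pad z _) ⟩
    z * conv (λ j → z ^ suc j) h m ∎)
    where
    pad : ∀ a p → a * p ≡ a * p + 0ℚ * p
    pad = solve-∀ ℚ-ring

  -- In terms of generating functions, h′ = h (1 - y u) / (1 - x u).
  conv-quotient : ∀ {x y h h′} → h′ 0 ≡ h 0 → (∀ m → h′ (suc m) ≡ x * h′ m + h (suc m) - y * h m) →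
    ∀ a m → conv a h′ (suc m) ≡ x * conv a h′ m + conv a h (suc m) - y * conv a h m
  conv-quotient {x} {y} {h} {h′} h0 hs a zero    = trans (cong (λ s → a 0 * s + 0ℚ) h0) (shuffle x y (a 0) (h 0))
    where
    shuffle : ∀ x y a h → a * h + 0ℚ ≡ x * 0ℚ + (a * h + 0ℚ) - y * 0ℚ
    shuffle = solve-∀ ℚ-ring
  conv-quotient {x} {y} {h} {h′} h0 hs a (suc m) =
    trans (cong₂ (λ s t → a 0 * s + t) (hs m) (conv-quotient {x} {y} {h} {h′} h0 hs (a ∘ suc) m)) (shuffle x y (a 0) (h′ m) (h (suc m)) (h m) _ _ _)
    where
    shuffle : ∀ x y a p q r s t u → a * (x * p + q - y * r) + (x * s + t - y * u) ≡ x * (a * p + s) + (a * q + t) - y * (a * r + u)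
    shuffle = solve-∀ ℚ-ring

  powerSum : ℚ → Partition → ℕ → ℚ
  powerSum c ρ k = signedSum c (_^ k) ρ

  -- The logarithmic derivative, row by row: a row multiplies the generating function of the moments
  -- by (1 - y u) / (1 - x u) and adds x u / (1 - x u) - y u / (1 - y u) to that of the power sums.
  -- The comparison of coefficients also needs the same partition at the previous `m`.
  newton : ∀ c ρ m → Decreasing ρ → ι m * moment c ρ m ≡ conv (powerSum c ρ ∘ suc) (moment c ρ) m
  newton c []       zero    _   = trans (cong (_* moment c [] 0) ι-0) (*-zeroˡ (moment c [] 0))
  newton c []       (suc m) dec = begin
    ι (suc m) * (c * c ^ m * 1ℚ * 1ℚ + 0ℚ)       ≡⟨ cong (_* (c * c ^ m * 1ℚ * 1ℚ + 0ℚ)) (ι-suc m) ⟩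
    (1ℚ + ι m) * (c * c ^ m * 1ℚ * 1ℚ + 0ℚ)      ≡⟨ shuffle c (ι m) (c ^ m) ⟩
    c * (moment c [] m) + c * (ι m * moment c [] m)      ≡⟨ cong (λ s → c * moment c [] m + c * s) (newton c [] m dec) ⟩
    c * (moment c [] m) + c * conv (powerSum c [] ∘ suc) (moment c []) m    ≡⟨ sym (conv-powers c (moment c []) m) ⟩
    conv (powerSum c [] ∘ suc) (moment c []) (suc m) ∎
    where
    shuffle : ∀ c n p → (1ℚ + n) * (c * p * 1ℚ * 1ℚ + 0ℚ) ≡ c * (p * 1ℚ * 1ℚ + 0ℚ) + c * (n * (p * 1ℚ * 1ℚ + 0ℚ))
    shuffle = solve-∀ ℚ-ring
  newton c (r ∷ rs) zero    _   = trans (cong (_* moment c (r ∷ rs) 0) ι-0) (*-zeroˡ (moment c (r ∷ rs) 0))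
  newton c (r ∷ rs) (suc m) dec = sym (begin
    conv p′ h′ (suc m)
      ≡⟨ split (suc m) ⟩
    conv (λ j → x ^ suc j) h′ (suc m) - conv (λ j → y ^ suc j) h′ (suc m) + conv p h′ (suc m)
      -- The geometric series in x stays with `h′` and obeys its own recursion. The one in y is
      -- carried over to `h`, where its two convolutions cancel down to `y * h m`.
      ≡⟨ cong₂ (λ s t → s + t) (cong₂ _-_ (conv-powers x h′ m) (quotient (λ j → y ^ suc j) m)) (quotient p m) ⟩
    x * h′ m + x * Vx - (x * Vy + conv (λ j → y ^ suc j) h (suc m) - y * conv (λ j → y ^ suc j) h m)
      + (x * conv p h′ m + conv p h (suc m) - y * conv p h m)
      ≡⟨ cong₂ (λ s t → x * h′ m + x * Vx - (x * Vy + s - y * conv (λ j → y ^ suc j) h m) + (x * conv p h′ m + t - y * conv p h m))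
          (conv-powers y h m) (sym (newton (c - 1ℚ) rs (suc m) dec′)) ⟩
    x * h′ m + x * Vx - (x * Vy + (y * h m + y * conv (λ j → y ^ suc j) h m) - y * conv (λ j → y ^ suc j) h m)
      + (x * conv p h′ m + ι (suc m) * h (suc m) - y * conv p h m)
      ≡⟨ cong (λ s → x * h′ m + x * Vx - (x * Vy + (y * h m + y * conv (λ j → y ^ suc j) h m) - y * conv (λ j → y ^ suc j) h m) + (x * conv p h′ m + ι (suc m) * h (suc m) - y * s)) (sym (newton (c - 1ℚ) rs m dec′)) ⟩
    x * h′ m + x * Vx - (x * Vy + (y * h m + y * conv (λ j → y ^ suc j) h m) - y * conv (λ j → y ^ suc j) h m)
      + (x * conv p h′ m + ι (suc m) * h (suc m) - y * (ι m * h m))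
      ≡⟨ collect x y (h′ m) Vx Vy (h m) (conv (λ j → y ^ suc j) h m) (conv p h′ m) (ι (suc m) * h (suc m)) (ι m * h m) ⟩
    x * (Vx - Vy + conv p h′ m) + x * h′ m - y * h m + ι (suc m) * h (suc m) - y * (ι m * h m)
      ≡⟨ cong₂ (λ s t → x * s + x * h′ m - y * h m + t * h (suc m) - y * (ι m * h m)) (trans (sym (split m)) (sym (newton c (r ∷ rs) m dec))) (ι-suc m) ⟩
    x * (ι m * h′ m) + x * h′ m - y * h m + (1ℚ + ι m) * h (suc m) - y * (ι m * h m)
      ≡⟨ factor x y (ι m) (h′ m) (h (suc m)) (h m) ⟩
    (1ℚ + ι m) * (x * h′ m + h (suc m) - y * h m)
      ≡⟨ cong₂ _*_ (sym (ι-suc m)) (sym (moment-suc c r rs m dec)) ⟩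
    ι (suc m) * h′ (suc m) ∎)
    where
    x = c + ι r
    y = x - 1ℚ
    h = moment (c - 1ℚ) rs
    h′ = moment c (r ∷ rs)
    p p′ : ℕ → ℚ
    p = powerSum (c - 1ℚ) rs ∘ suc
    p′ = powerSum c (r ∷ rs) ∘ suc
    dec′ = Decreasing-tail dec
    Vx = conv (λ j → x ^ suc j) h′ m
    Vy = conv (λ j → y ^ suc j) h′ m
    quotient = conv-quotient {x} {y} {h} {h′} (trans (moment-zero c (r ∷ rs) dec) (sym (moment-zero (c - 1ℚ) rs dec′))) (λ k → moment-suc c r rs k dec)
    pad : ∀ a b d → a - b + d ≡ 1ℚ * (1ℚ * a + (- 1ℚ) * b) + 1ℚ * d
    pad = solve-∀ ℚ-ring
    split : ∀ m → conv p′ h′ m ≡ conv (λ j → x ^ suc j) h′ m - conv (λ j → y ^ suc j) h′ m + conv p h′ m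
    split m = begin
      conv p′ h′ m     ≡⟨ conv-cong (λ j → pad (x ^ suc j) (y ^ suc j) (p j)) h′ m ⟩
      conv (λ j → 1ℚ * (1ℚ * x ^ suc j + (- 1ℚ) * y ^ suc j) + 1ℚ * p j) h′ m
        ≡⟨ conv-linear 1ℚ 1ℚ (λ j → 1ℚ * x ^ suc j + (- 1ℚ) * y ^ suc j) p h′ m ⟩
      1ℚ * conv (λ j → 1ℚ * x ^ suc j + (- 1ℚ) * y ^ suc j) h′ m + 1ℚ * conv p h′ m
        ≡⟨ cong (λ s → 1ℚ * s + 1ℚ * conv p h′ m) (conv-linear 1ℚ (- 1ℚ) (λ j → x ^ suc j) (λ j → y ^ suc j) h′ m) ⟩
      1ℚ * (1ℚ * conv (λ j → x ^ suc j) h′ m + (- 1ℚ) * conv (λ j → y ^ suc j) h′ m) + 1ℚ * conv p h′ m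
        ≡⟨ sym (pad (conv (λ j → x ^ suc j) h′ m) (conv (λ j → y ^ suc j) h′ m) (conv p h′ m)) ⟩
      conv (λ j → x ^ suc j) h′ m - conv (λ j → y ^ suc j) h′ m + conv p h′ m ∎
    collect : ∀ x y h′ vx vy h my t n n′ →
      x * h′ + x * vx - (x * vy + (y * h + y * my) - y * my) + (x * t + n - y * n′) ≡ x * (vx - vy + t) + x * h′ - y * h + n - y * n′
    collect = solve-∀ ℚ-ring
    factor : ∀ x y n h′ k h → x * (n * h′) + x * h′ - y * h + (1ℚ + n) * k - y * (n * h) ≡ (1ℚ + n) * (x * h′ + k - y * h)
    factor = solve-∀ ℚ-ring

  -- The weight filtration

  p : ℕ → Partition → ℚ
  p k ρ = powerSum 0ℚ ρ k

  infixl 6 _⊞_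
  infixl 7 _⊠_
  -- Derivations instead of polynomials: no relations among the power sums are ever needed. `raise`
  -- makes the index an upper bound, so this is a filtration and not a grading.
  data Weight : ℕ → (Partition → ℚ) → Set where
    const : ∀ a → Weight 0 (λ _ → a)
    power : ∀ k → Weight k (p k)
    _⊞_   : ∀ {d a b} → Weight d a → Weight d b → Weight d (λ ρ → a ρ + b ρ)
    _⊠_   : ∀ {d e a b} → Weight d a → Weight e b → Weight (d ℕ.+ e) (λ ρ → a ρ * b ρ)
    raise : ∀ {d e a} → d ℕ.≤ e → Weight d a → Weight e a

  -- Polynomials in z over the algebra of Weight, of total weight at most d - 2 (and zero if d < 2).
  data Lower : ℕ → (Partition → ℚ → ℚ) → Set where
    zero  : ∀ {d} → Lower d (λ _ _ → 0ℚ)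
    term  : ∀ {d e a} m → 2 ℕ.+ (e ℕ.+ m) ℕ.≤ d → Weight e a → Lower d (λ ρ z → a ρ * z ^ m)
    _⊞_   : ∀ {d P Q} → Lower d P → Lower d Q → Lower d (λ ρ z → P ρ z + Q ρ z)
    ext   : ∀ {d P Q} → (∀ ρ z → P ρ z ≡ Q ρ z) → Lower d P → Lower d Q

  Lower-raise : ∀ {d e P} → d ℕ.≤ e → Lower d P → Lower e P
  Lower-raise d≤e zero          = zero
  Lower-raise d≤e (term m le a) = term m (ℕ.≤-trans le d≤e) a
  Lower-raise d≤e (P ⊞ Q)       = Lower-raise d≤e P ⊞ Lower-raise d≤e Q
  Lower-raise d≤e (ext eq P)    = ext eq (Lower-raise d≤e P)

  Lower-*-Weight : ∀ {d e P a} → Lower d P → Weight e a → Lower (d ℕ.+ e) (λ ρ z → P ρ z * a ρ)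
  Lower-*-Weight {a = a} zero _ = ext (λ ρ z → sym (*-zeroˡ (a ρ))) zero
  Lower-*-Weight {d} {e} {a = a} (term {e = e′} {a = b} m le wb) wa =
    ext (λ ρ z → shuffle (b ρ) (a ρ) (z ^ m)) (term m (subst (ℕ._≤ d ℕ.+ e) rearrange (ℕ.+-monoˡ-≤ e le)) (wb ⊠ wa))
    where
    shuffle : ∀ b a z → b * a * z ≡ b * z * a
    shuffle = solve-∀ ℚ-ring
    rearrange : 2 ℕ.+ (e′ ℕ.+ m) ℕ.+ e ≡ 2 ℕ.+ (e′ ℕ.+ e ℕ.+ m)
    rearrange = cong (2 ℕ.+_) (trans (ℕ.+-assoc e′ m e) (trans (cong (e′ ℕ.+_) (ℕ.+-comm m e)) (sym (ℕ.+-assoc e′ e m))))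
  Lower-*-Weight {a = a} (_⊞_ {P = P} {Q = Q} l l′) wa =
    ext (λ ρ z → sym (*-distribʳ-+ (a ρ) (P ρ z) (Q ρ z))) (Lower-*-Weight l wa ⊞ Lower-*-Weight l′ wa)
  Lower-*-Weight {a = a} (ext eq l) wa = ext (λ ρ z → cong (_* a ρ) (eq ρ z)) (Lower-*-Weight l wa)

  Lower-*-power : ∀ {d P} k → Lower d P → Lower (d ℕ.+ k) (λ ρ z → P ρ z * z ^ k)
  Lower-*-power k zero = ext (λ ρ z → sym (*-zeroˡ (z ^ k))) zero
  Lower-*-power {d} k (term {e = e} {a = a} m le wa) =
    ext (λ ρ z → trans (cong (a ρ *_) (^-homo-* z m k)) (sym (*-assoc (a ρ) (z ^ m) (z ^ k))))
        (term (m ℕ.+ k) (subst (ℕ._≤ d ℕ.+ k) rearrange (ℕ.+-monoˡ-≤ k le)) wa)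
    where
    rearrange : 2 ℕ.+ (e ℕ.+ m) ℕ.+ k ≡ 2 ℕ.+ (e ℕ.+ (m ℕ.+ k))
    rearrange = cong (2 ℕ.+_) (ℕ.+-assoc e m k)
  Lower-*-power k (_⊞_ {P = P} {Q = Q} l l′) =
    ext (λ ρ z → sym (*-distribʳ-+ (z ^ k) (P ρ z) (Q ρ z))) (Lower-*-power k l ⊞ Lower-*-power k l′)
  Lower-*-power k (ext eq l) = ext (λ ρ z → cong (_* z ^ k) (eq ρ z)) (Lower-*-power k l)

  -- A product of two increments lies 4 below the total weight; a deficit of 2 is all that is
  -- recorded.
  Lower-*-Lower : ∀ {d e P Q} → Lower d P → Lower e Q → Lower (d ℕ.+ e) (λ ρ z → P ρ z * Q ρ z)
  Lower-*-Lower {P = P} l zero = ext (λ ρ z → sym (*-zeroʳ (P ρ z))) zero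
  Lower-*-Lower {d} {P = P} l (term {d = e} {e = e′} {a = a} m le wa) =
    ext (λ ρ z → *-assoc (P ρ z) (a ρ) (z ^ m))
        (Lower-raise (subst (ℕ._≤ d ℕ.+ e) (sym (ℕ.+-assoc d e′ m)) (ℕ.+-monoʳ-≤ d (ℕ.≤-trans (ℕ.m≤n+m (e′ ℕ.+ m) 2) le)))
          (Lower-*-power m (Lower-*-Weight l wa)))
  Lower-*-Lower {P = P} l (_⊞_ {P = Q} {Q = Q′} l′ l″) =
    ext (λ ρ z → sym (*-distribˡ-+ (P ρ z) (Q ρ z) (Q′ ρ z))) (Lower-*-Lower l l′ ⊞ Lower-*-Lower l l″)
  Lower-*-Lower {P = P} l (ext eq l′) = ext (λ ρ z → cong (P ρ z *_) (eq ρ z)) (Lower-*-Lower l l′)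

  Lower-*-z : ∀ {d P} → Lower d P → Lower (suc d) (λ ρ z → z * P ρ z)
  Lower-*-z {d} {P} l = ext (λ ρ z → trans (cong (P ρ z *_) (*-identityʳ z)) (*-comm (P ρ z) z))
    (subst (λ e → Lower e (λ ρ z → P ρ z * z ^ 1)) (ℕ.+-comm d 1) (Lower-*-power 1 l))

  -- Raising the exponent mixes the two differences: the second difference of z^(k+1) involves the
  -- central difference of z^k, and the central difference of z^(k+1) involves the second difference
  -- of z^k together with 2 z^k.
  Lower-second-difference : ∀ k → Lower k (λ ρ z → (z + 1ℚ) ^ k - (1ℚ + 1ℚ) * z ^ k + (z - 1ℚ) ^ k)
  Lower-central-difference : ∀ k → Lower (suc k) (λ ρ z → (z + 1ℚ) ^ k - (z - 1ℚ) ^ k)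

  Lower-second-difference zero    = ext (λ _ _ → refl) zero
  Lower-second-difference (suc k) =
    ext (λ ρ z → expand z ((z + 1ℚ) ^ k) (z ^ k) ((z - 1ℚ) ^ k)) (Lower-*-z (Lower-second-difference k) ⊞ Lower-central-difference k)
    where
    expand : ∀ z u v w → z * (u - (1ℚ + 1ℚ) * v + w) + (u - w) ≡ (z + 1ℚ) * u - (1ℚ + 1ℚ) * (z * v) + (z - 1ℚ) * w
    expand = solve-∀ ℚ-ring
  Lower-central-difference zero    = ext (λ _ _ → refl) zero
  Lower-central-difference (suc k) =
    ext (λ ρ z → expand z ((z + 1ℚ) ^ k) (z ^ k) ((z - 1ℚ) ^ k))
      (Lower-*-z (Lower-central-difference k) ⊞ Lower-raise (ℕ.m≤n+m k 2) (Lower-second-difference k) ⊞ term k ℕ.≤-refl (const (1ℚ + 1ℚ)))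
    where
    expand : ∀ z u v w → z * (u - w) + (u - (1ℚ + 1ℚ) * v + w) + (1ℚ + 1ℚ) * v ≡ (z + 1ℚ) * u - (z - 1ℚ) * w
    expand = solve-∀ ℚ-ring

  -- A Leibniz rule: the increment of a product has, besides the two expected terms, the product of
  -- the increments, which is lower still. The increment depends on the new box only through its
  -- content, and polynomially.
  Weight-increment : ∀ {d a} → Weight d a →
    ∃[ P ] Lower d P × (∀ ρ i → i ℕ.≤ length ρ → a (incrRow ρ i) ≡ a ρ + P ρ (ξ 0ℚ ρ i))
  Weight-increment (const a) = _ , zero , λ ρ i _ → sym (+-identityʳ a)
  Weight-increment (power k) = _ , Lower-second-difference k , λ ρ i i≤n → signedSum-incrRow 0ℚ (_^ k) ρ i≤n
  Weight-increment (_⊞_ {a = a} {b = b} wa wb) with Weight-increment wa | Weight-increment wb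
  ... | P , lP , incrP | Q , lQ , incrQ = _ , lP ⊞ lQ , λ ρ i i≤n →
    trans (cong₂ _+_ (incrP ρ i i≤n) (incrQ ρ i i≤n)) (shuffle (a ρ) (P ρ (ξ 0ℚ ρ i)) (b ρ) (Q ρ (ξ 0ℚ ρ i)))
    where
    shuffle : ∀ a p b q → a + p + (b + q) ≡ a + b + (p + q)
    shuffle = solve-∀ ℚ-ring
  Weight-increment (_⊠_ {d} {e} {a = a} {b = b} wa wb) with Weight-increment wa | Weight-increment wb
  ... | P , lP , incrP | Q , lQ , incrQ = _ ,
    Lower-*-Weight lP wb ⊞ subst (λ n → Lower n (λ ρ z → Q ρ z * a ρ)) (ℕ.+-comm e d) (Lower-*-Weight lQ wa) ⊞ Lower-*-Lower lP lQ ,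
    λ ρ i i≤n → trans (cong₂ _*_ (incrP ρ i i≤n) (incrQ ρ i i≤n)) (shuffle (a ρ) (P ρ (ξ 0ℚ ρ i)) (b ρ) (Q ρ (ξ 0ℚ ρ i)))
    where
    shuffle : ∀ a p b q → (a + p) * (b + q) ≡ a * b + (p * b + q * a + p * q)
    shuffle = solve-∀ ℚ-ring
  Weight-increment (raise d≤e wa) with Weight-increment wa
  ... | P , lP , incrP = P , Lower-raise d≤e lP , incrP

  -- `Weight` is indexed by one particular function, whereas the formulas for the moments hold
  -- pointwise and only for decreasing rows; hence a representative that agrees there.
  OnDecreasing : ℕ → (Partition → ℚ) → Set
  OnDecreasing d F = ∃[ a ] Weight d a × (∀ ρ → Decreasing ρ → F ρ ≡ a ρ)

  OnDecreasing-* : ∀ {d e F a} → Weight e a → OnDecreasing d F → OnDecreasing (e ℕ.+ d) (λ ρ → a ρ * F ρ)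
  OnDecreasing-* {a = a} wa (b , wb , eq) = _ , wa ⊠ wb , λ ρ dec → cong (a ρ *_) (eq ρ dec)

  OnDecreasing-+ : ∀ {d F F′} → OnDecreasing d F → OnDecreasing d F′ → OnDecreasing d (λ ρ → F ρ + F′ ρ)
  OnDecreasing-+ (a , wa , eq) (b , wb , eq′) = _ , wa ⊞ wb , λ ρ dec → cong₂ _+_ (eq ρ dec) (eq′ ρ dec)

  OnDecreasing-raise : ∀ {d e F} → d ℕ.≤ e → OnDecreasing d F → OnDecreasing e F
  OnDecreasing-raise d≤e (a , wa , eq) = a , raise d≤e wa , eq

  OnDecreasing-ext : ∀ {d F F′} → (∀ ρ → Decreasing ρ → F′ ρ ≡ F ρ) → OnDecreasing d F → OnDecreasing d F′
  OnDecreasing-ext eq (a , wa , eq′) = a , wa , λ ρ dec → trans (eq ρ dec) (eq′ ρ dec)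

  -- Each summand p_(s+j+1) h_(m-1-j) has weight m + s. The shift `s` follows the recursion of
  -- `conv`, which shifts its first argument.
  conv-weight : ∀ s m (h : Partition → ℕ → ℚ) → (∀ j → j ℕ.< m → OnDecreasing j (λ ρ → h ρ j)) →
    OnDecreasing (m ℕ.+ s) (λ ρ → conv (λ j → p (suc (s ℕ.+ j)) ρ) (h ρ) m)
  conv-weight s zero    h w = _ , raise ℕ.z≤n (const 0ℚ) , λ _ _ → refl
  conv-weight s (suc m) h w = OnDecreasing-+
    (OnDecreasing-ext (λ ρ _ → cong (λ k → p (suc k) ρ * h ρ m) (ℕ.+-identityʳ s))
      (subst (λ d → OnDecreasing d (λ ρ → p (suc s) ρ * h ρ m)) (cong suc (ℕ.+-comm s m)) (OnDecreasing-* (power (suc s)) (w m ℕ.≤-refl))))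
    (OnDecreasing-ext (λ ρ _ → conv-cong (λ j → cong (λ k → p (suc k) ρ) (ℕ.+-suc s j)) (h ρ) m)
      (subst (λ d → OnDecreasing d (λ ρ → conv (λ j → p (suc (suc s ℕ.+ j)) ρ) (h ρ) m)) (ℕ.+-suc m s)
        (conv-weight (suc s) m h (λ j j<m → w j (ℕ.m<n⇒m<1+n j<m)))))

  -- Newton's identity divided by the index expresses a moment through the earlier ones; the bound
  -- `m` serves the course-of-values induction.
  moment-weight : ∀ m j → j ℕ.< m → OnDecreasing j (λ ρ → moment 0ℚ ρ j)
  moment-weight (suc m) zero    _ = _ , const 1ℚ , moment-zero 0ℚ
  moment-weight (suc m) (suc j) (ℕ.s≤s j<m) =
    OnDecreasing-ext (λ ρ dec → solve-for ρ dec)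
      (OnDecreasing-* (const (inv (ι (suc j))))
        (subst (λ d → OnDecreasing d (λ ρ → conv (λ i → p (suc i) ρ) (moment 0ℚ ρ) (suc j))) (ℕ.+-identityʳ (suc j))
          (conv-weight 0 (suc j) (moment 0ℚ) (λ i i≤j → moment-weight m i (ℕ.≤-trans i≤j j<m)))))
    where
    swap : ∀ i n h → i * (n * h) ≡ n * i * h
    swap = solve-∀ ℚ-ring
    solve-for : ∀ ρ → Decreasing ρ → moment 0ℚ ρ (suc j) ≡ inv (ι (suc j)) * conv (λ i → p (suc i) ρ) (moment 0ℚ ρ) (suc j)
    solve-for ρ dec = begin
      moment 0ℚ ρ (suc j)                                              ≡⟨ sym (*-identityˡ _) ⟩
      1ℚ * moment 0ℚ ρ (suc j)
        ≡⟨ cong (_* moment 0ℚ ρ (suc j)) (sym (inv-cancel (ι-suc≢0 j))) ⟩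
      ι (suc j) * inv (ι (suc j)) * moment 0ℚ ρ (suc j)                ≡⟨ sym (swap (inv (ι (suc j))) (ι (suc j)) _) ⟩
      inv (ι (suc j)) * (ι (suc j) * moment 0ℚ ρ (suc j))              ≡⟨ cong (inv (ι (suc j)) *_) (newton 0ℚ ρ (suc j) dec) ⟩
      inv (ι (suc j)) * conv (λ i → p (suc i) ρ) (moment 0ℚ ρ) (suc j) ∎

  average-linear : ∀ a b c ρ g g′ → average c ρ (λ z → a * g z + b * g′ z) ≡ a * average c ρ g + b * average c ρ g′
  average-linear a b c ρ g g′ = trans (δ-ext (λ z → distrib a b (g z) (g′ z) _) (outer c ρ)) (δ-linear a b _ _ (outer c ρ))
    where
    distrib : ∀ a b p q i → (a * p + b * q) * i ≡ a * (p * i) + b * (q * i)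
    distrib = solve-∀ ℚ-ring

  average-ext : ∀ {g g′ : ℚ → ℚ} c ρ → (∀ z → g z ≡ g′ z) → average c ρ g ≡ average c ρ g′
  average-ext c ρ eq = δ-ext (λ z → cong (_* ∏-diff z (inner c ρ)) (eq z)) (outer c ρ)

  average-+ : ∀ c ρ g g′ → average c ρ (λ z → g z + g′ z) ≡ average c ρ g + average c ρ g′
  average-+ c ρ g g′ = begin
    average c ρ (λ z → g z + g′ z)                   ≡⟨ average-ext c ρ (λ z → pad (g z) (g′ z)) ⟩
    average c ρ (λ z → 1ℚ * g z + 1ℚ * g′ z)         ≡⟨ average-linear 1ℚ 1ℚ c ρ g g′ ⟩
    1ℚ * average c ρ g + 1ℚ * average c ρ g′         ≡⟨ sym (pad (average c ρ g) (average c ρ g′)) ⟩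
    average c ρ g + average c ρ g′                   ∎
    where
    pad : ∀ a b → a + b ≡ 1ℚ * a + 1ℚ * b
    pad = solve-∀ ℚ-ring

  average-scale : ∀ a c ρ g → average c ρ (λ z → a * g z) ≡ a * average c ρ g
  average-scale a c ρ g = trans (δ-ext (λ z → *-assoc a (g z) _) (outer c ρ)) (δ-scale a _ (outer c ρ))

  -- Averaging replaces z^m by the m-th moment, of weight m, so the total weight of every term, and
  -- with it the deficit of 2, is preserved.
  average-weight : ∀ {d P} → Lower (2 ℕ.+ d) P → OnDecreasing d (λ ρ → average 0ℚ ρ (P ρ))
  average-weight zero = _ , raise ℕ.z≤n (const 0ℚ) , λ ρ dec → trans (average-ext 0ℚ ρ (λ z → sym (*-zeroˡ 0ℚ))) (trans (average-scale 0ℚ 0ℚ ρ (λ _ → 0ℚ)) (*-zeroˡ (average 0ℚ ρ (λ _ → 0ℚ))))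
  average-weight (term {a = a} m (ℕ.s≤s (ℕ.s≤s le)) wa) =
    OnDecreasing-ext (λ ρ _ → average-scale (a ρ) 0ℚ ρ (_^ m))
      (OnDecreasing-raise le (OnDecreasing-* wa (moment-weight (suc m) m ℕ.≤-refl)))
  average-weight (_⊞_ {P = P} {Q = Q} l l′) =
    OnDecreasing-ext (λ ρ _ → average-+ 0ℚ ρ (P ρ) (Q ρ)) (OnDecreasing-+ (average-weight l) (average-weight l′))
  average-weight (ext eq l) = OnDecreasing-ext (λ ρ _ → average-ext 0ℚ ρ (λ z → sym (eq ρ z))) (average-weight l)

  -- A `term` would require 2 ≤ 0, so only sums of zeros remain.
  Lower-0 : ∀ {P} → Lower 0 P → ∀ ρ z → P ρ z ≡ 0ℚ
  Lower-0 zero        ρ z = refl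
  Lower-0 (l ⊞ l′)    ρ z = cong₂ _+_ (Lower-0 l ρ z) (Lower-0 l′ ρ z)
  Lower-0 (ext eq l)  ρ z = trans (sym (eq ρ z)) (Lower-0 l ρ z)

  -- The difference operator lowers the weight

  ∑-addBox : ∀ ρ (F : Partition → ℚ) →
    ∑ (addBox ρ) F ≡ ∑ (upTo (suc (length ρ))) (λ i → indicator (T? (addableᵇ ρ i)) * F (incrRow ρ i))
  ∑-addBox ρ F = trans (∑-map F (incrRow ρ) (filter (λ i → T? (addableᵇ ρ i)) (upTo (suc (length ρ)))))
    (∑-filter (λ i → T? (addableᵇ ρ i)) (F ∘ incrRow ρ) (upTo (suc (length ρ))))

  All-addBox : ∀ {Q : Partition → Set} ρ → (∀ i → T (addableᵇ ρ i) → Q (incrRow ρ i)) → All Q (addBox ρ)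
  All-addBox ρ q = All.map⁺ (All.map (λ {i} → q i) (All.all-filter (λ i → T? (addableᵇ ρ i)) (upTo (suc (length ρ)))))

  incrRow-Decreasing : ∀ ρ i → Decreasing ρ → T (addableᵇ ρ i) → Decreasing (incrRow ρ i)
  incrRow-Decreasing []           i             _           _   = [ 1 ]
  incrRow-Decreasing (r ∷ .[])    zero          [ .r ]      _   = [ suc r ]
  incrRow-Decreasing (r ∷ s ∷ rs) zero          (s≤r ∷ dec) _   = ℕ.m≤n⇒m≤1+n s≤r ∷ dec
  incrRow-Decreasing (r ∷ [])     (suc zero)    _           add = ℕ.<ᵇ⇒< 0 r add ∷ [ 1 ]
  incrRow-Decreasing (r ∷ s ∷ rs) (suc zero)    (_ ∷ dec)   add = ℕ.<ᵇ⇒< s r add ∷ incrRow-Decreasing (s ∷ rs) zero dec _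
  incrRow-Decreasing (r ∷ s ∷ rs) (suc (suc i)) (s≤r ∷ dec) add = s≤r ∷ incrRow-Decreasing (s ∷ rs) (suc i) dec add

  incrRow-AllPositive : ∀ ρ i → AllPositive ρ → AllPositive (incrRow ρ i)
  incrRow-AllPositive []       i       _           = ℕ.s≤s ℕ.z≤n ∷ []
  incrRow-AllPositive (r ∷ rs) zero    (_ ∷ pos)   = ℕ.s≤s ℕ.z≤n ∷ pos
  incrRow-AllPositive (r ∷ rs) (suc i) (0<r ∷ pos) = 0<r ∷ incrRow-AllPositive rs i pos

  size-incrRow : ∀ ρ i → size (incrRow ρ i) ≡ suc (size ρ)
  size-incrRow []       i       = refl
  size-incrRow (r ∷ rs) zero    = refl
  size-incrRow (r ∷ rs) (suc i) = trans (cong (r ℕ.+_) (size-incrRow rs i)) (ℕ.+-suc r (size rs))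

  rowLen-incrRow : ∀ ρ i j → rowLen ρ j ℕ.≤ rowLen (incrRow ρ i) j
  rowLen-incrRow []       i       j       = ℕ.z≤n
  rowLen-incrRow (r ∷ rs) zero    zero    = ℕ.n≤1+n r
  rowLen-incrRow (r ∷ rs) zero    (suc j) = ℕ.≤-refl
  rowLen-incrRow (r ∷ rs) (suc i) zero    = ℕ.≤-refl
  rowLen-incrRow (r ∷ rs) (suc i) (suc j) = rowLen-incrRow rs i j

  addBox-IsPartition : ∀ ρ → IsPartition ρ → All IsPartition (addBox ρ)
  addBox-IsPartition ρ (dec , pos) = All-addBox ρ (λ i add → incrRow-Decreasing ρ i dec add , incrRow-AllPositive ρ i pos)

  -- A row that comes to exceed the row above by one has its point on the point of that row, and the
  -- factor of the two is zero.
  G-not-addable : ∀ c ρ i → i ℕ.≤ length ρ → Decreasing ρ → ¬ T (addableᵇ ρ i) → G c (incrRow ρ i) ≡ 0ℚ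
  G-not-addable c ρ zero _ _ ¬add = contradiction _ ¬add
  G-not-addable c (r ∷ rs) (suc (suc i)) (ℕ.s≤s i≤n) dec ¬add =
    trans (cong (_* rowFactor (suc r) (c - 1ℚ) (incrRow rs (suc i)) (c + ι r)) (G-not-addable (c - 1ℚ) rs (suc i) i≤n (Decreasing-tail dec) ¬add)) (*-zeroˡ (rowFactor (suc r) (c - 1ℚ) (incrRow rs (suc i)) (c + ι r)))
  G-not-addable c (r ∷ rs) (suc zero) _ dec ¬add = trans (cong (G (c - 1ℚ) (incrRow rs 0) *_) (vanish rs dec ¬add)) (*-zeroʳ (G (c - 1ℚ) (incrRow rs 0)))
    where
    kill : ∀ x f → (x - x) * f ≡ 0ℚ
    kill = solve-∀ ℚ-ring
    collide : ∀ s f → s ≡ r → (c + ι r - (c - 1ℚ + ι (suc s))) * f ≡ 0ℚ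
    collide s f refl = trans (cong (λ y → (c + ι r - y) * f) (shift-row c r)) (kill (c + ι r) f)
    vanish : ∀ rs → Decreasing (r ∷ rs) → ¬ T (addableᵇ (r ∷ rs) 1) → rowFactor (suc r) (c - 1ℚ) (incrRow rs 0) (c + ι r) ≡ 0ℚ
    vanish []       _           ¬add = collide 0 _ (sym (ℕ.n≤0⇒n≡0 (ℕ.≮⇒≥ (¬add ∘ ℕ.<⇒<ᵇ))))
    vanish (s ∷ rs) (s≤r ∷ _) ¬add = collide s _ (ℕ.≤-antisym s≤r (ℕ.≮⇒≥ (¬add ∘ ℕ.<⇒<ᵇ)))

  HookDegree : ℕ → (Partition → ℚ) → Set
  HookDegree d F = ∃[ a ] Weight d a × (∀ ρ → IsPartition ρ → F ρ ≡ a ρ * G 0ℚ ρ)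

  -- Stated with the increment `P` itself, since it is used in two ways: for weight 2 + d its
  -- average is bounded, for weight 0 it vanishes.
  D-HookDegree : ∀ {d F} → HookDegree d F →
    ∃[ P ] Lower d P × (∀ ρ → IsPartition ρ → D F ρ ≡ average 0ℚ ρ (P ρ) * G 0ℚ ρ)
  D-HookDegree {d} {F} (a , wa , F≡aG) with Weight-increment wa
  ... | P , lP , incrP = P , lP , λ ρ isP → begin
    ∑ (addBox ρ) F - F ρ                            ≡⟨ cong₂ _-_ (up ρ isP) (F≡aG ρ isP) ⟩
    g ρ * (a ρ * 1ℚ + average 0ℚ ρ (P ρ)) - a ρ * g ρ    ≡⟨ collect (g ρ) (a ρ) _ ⟩
    average 0ℚ ρ (P ρ) * g ρ ∎
    where
    g = G 0ℚ
    collect : ∀ g a s → g * (a * 1ℚ + s) - a * g ≡ s * g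
    collect = solve-∀ ℚ-ring
    -- At rows that are not addable `G` vanishes in place of the indicator. The zeroth power turns
    -- the first summand into a moment.
    drop-indicator : ∀ ρ → IsPartition ρ → ∀ i → i ℕ.< suc (length ρ) →
      indicator (T? (addableᵇ ρ i)) * F (incrRow ρ i) ≡ g (incrRow ρ i) * (a ρ * ξ 0ℚ ρ i ^ 0 + P ρ (ξ 0ℚ ρ i))
    drop-indicator ρ (dec , pos) i (ℕ.s≤s i≤n) with T? (addableᵇ ρ i)
    ... | yes add = trans (trans (cong (_* F (incrRow ρ i)) (indicator-yes (T? (addableᵇ ρ i)) add)) (*-identityˡ _)) (trans (F≡aG _ (incrRow-Decreasing ρ i dec add , incrRow-AllPositive ρ i pos))
      (trans (cong (_* g (incrRow ρ i)) (incrP ρ i i≤n)) (swap (a ρ) (P ρ (ξ 0ℚ ρ i)) (g (incrRow ρ i)))))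
      where
      swap : ∀ a p g → (a + p) * g ≡ g * (a * 1ℚ + p)
      swap = solve-∀ ℚ-ring
    ... | no ¬add = trans (trans (cong (_* F (incrRow ρ i)) (indicator-no (T? (addableᵇ ρ i)) ¬add)) (*-zeroˡ (F (incrRow ρ i)))) (sym (trans (cong (_* (a ρ * 1ℚ + P ρ (ξ 0ℚ ρ i))) (G-not-addable 0ℚ ρ i i≤n dec ¬add)) (*-zeroˡ (a ρ * 1ℚ + P ρ (ξ 0ℚ ρ i)))))
    up : ∀ ρ → IsPartition ρ → ∑ (addBox ρ) F ≡ g ρ * (a ρ * 1ℚ + average 0ℚ ρ (P ρ))
    up ρ isP@(dec , _) = begin
      ∑ (addBox ρ) F                                                                                            ≡⟨ ∑-addBox ρ F ⟩
      ∑ (upTo (suc (length ρ))) (λ i → indicator (T? (addableᵇ ρ i)) * F (incrRow ρ i))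
        ≡⟨ ∑-upTo-cong (suc (length ρ)) (drop-indicator ρ isP) ⟩
      ∑ (upTo (suc (length ρ))) (λ i → g (incrRow ρ i) * (a ρ * ξ 0ℚ ρ i ^ 0 + P ρ (ξ 0ℚ ρ i)))
        ≡⟨ ∑-G-incrRow 0ℚ ρ (λ z → a ρ * z ^ 0 + P ρ z) dec ⟩
      g ρ * average 0ℚ ρ (λ z → a ρ * z ^ 0 + P ρ z)
        ≡⟨ cong (g ρ *_) (average-+ 0ℚ ρ (λ z → a ρ * z ^ 0) (P ρ)) ⟩
      g ρ * (average 0ℚ ρ (λ z → a ρ * z ^ 0) + average 0ℚ ρ (P ρ))
        ≡⟨ cong (λ s → g ρ * (s + average 0ℚ ρ (P ρ))) (trans (average-scale (a ρ) 0ℚ ρ (_^ 0)) (cong (a ρ *_) (moment-zero 0ℚ ρ dec))) ⟩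
      g ρ * (a ρ * 1ℚ + average 0ℚ ρ (P ρ))                                                                     ∎

  D-lowers : ∀ {d F} → HookDegree (2 ℕ.+ d) F → HookDegree d (D F)
  D-lowers {d} {F} hF =
    let P , lP , D≡ = D-HookDegree {2 ℕ.+ d} {F} hF
        b , wb , average≡ = average-weight lP
    in b , wb , λ ρ isP → trans (D≡ ρ isP) (cong (_* G 0ℚ ρ) (average≡ ρ (proj₁ isP)))

  D-HookDegree-0 : ∀ {F} → HookDegree 0 F → ∀ ρ → IsPartition ρ → D F ρ ≡ 0ℚ
  D-HookDegree-0 {F} hF ρ isP =
    let P , lP , D≡ = D-HookDegree {0} {F} hF in
    trans (D≡ ρ isP) (trans (cong (_* G 0ℚ ρ) (average-zero (Lower-0 lP ρ))) (*-zeroˡ (G 0ℚ ρ)))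
    where
    average-zero : ∀ {g} → (∀ z → g z ≡ 0ℚ) → average 0ℚ ρ g ≡ 0ℚ
    average-zero {g} g≡0 = begin
      average 0ℚ ρ g                     ≡⟨ average-ext 0ℚ ρ (λ z → trans (g≡0 z) (sym (*-zeroˡ 0ℚ))) ⟩
      average 0ℚ ρ (λ _ → 0ℚ * 0ℚ)       ≡⟨ average-scale 0ℚ 0ℚ ρ (λ _ → 0ℚ) ⟩
      0ℚ * average 0ℚ ρ (λ _ → 0ℚ)       ≡⟨ *-zeroˡ (average 0ℚ ρ (λ _ → 0ℚ)) ⟩
      0ℚ                                 ∎

  -- Weights are written n * 2, because `suc n * 2` reduces to `2 + n * 2`, the index that
  -- `D-lowers` expects.
  Dpow-HookDegree : ∀ {F} d k → HookDegree ((k ℕ.+ d) ℕ.* 2) F → HookDegree (d ℕ.* 2) (Dpow k F)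
  Dpow-HookDegree d zero    hF = hF
  Dpow-HookDegree {F} d (suc k) hF = D-lowers (Dpow-HookDegree {F} (suc d) k (subst (λ e → HookDegree (e ℕ.* 2) F) (sym (ℕ.+-suc k d)) hF))

  Dpow-+ : ∀ i k F ρ → Dpow i (Dpow k F) ρ ≡ Dpow (i ℕ.+ k) F ρ
  Dpow-+ i k F ρ = cong (λ h → h ρ) (go i)
    where
    go : ∀ i → Dpow i (Dpow k F) ≡ Dpow (i ℕ.+ k) F
    go zero    = refl
    go (suc i) = cong D (go i)

  -- After `s` applications the weight is 0, so the next one gives zero at every partition; zero
  -- persists because adding a box leads from partitions to partitions.
  Dpow-zero : ∀ {F} s → HookDegree (s ℕ.* 2) F → ∀ k ρ → IsPartition ρ → s ℕ.< k → Dpow k F ρ ≡ 0ℚ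
  Dpow-zero {F} s hF (suc k) ρ isP (ℕ.s≤s s≤k) with ℕ.m≤n⇒m<n∨m≡n s≤k
  ... | inj₂ refl = D-HookDegree-0 (Dpow-HookDegree {F} 0 s (subst (λ e → HookDegree (e ℕ.* 2) F) (sym (ℕ.+-identityʳ s)) hF)) ρ isP
  ... | inj₁ s<k  = begin
    ∑ (addBox ρ) (Dpow k F) - Dpow k F ρ
      ≡⟨ cong₂ _-_ (trans (∑-cong-All (All.map (λ {σ} isP′ → Dpow-zero s hF k σ isP′ s<k) (addBox-IsPartition ρ isP))) (∑-zero (addBox ρ))) (Dpow-zero s hF k ρ isP s<k) ⟩
    0ℚ - 0ℚ                                 ∎

  -- Sums over chains as powers of 1 + D

  nC0≡1 : ∀ n → n C 0 ≡ 1
  nC0≡1 n = trans (nCk≡nC[n∸k] {0} {n} ℕ.z≤n) (nCn≡1 n)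

  -- The chain is split at its first box: the sum of D^i F over the one-box extensions of μ is
  -- D^(i+1) F + D^i F at μ, and Pascal's rule recombines the binomial coefficients.
  chain-sum : ∀ n F μ → ∑ (chainEnds n μ) F ≡ ∑ (upTo (suc n)) (λ i → Dpow i F μ * ι (n C i))
  chain-sum zero    F μ = cong (_+ 0ℚ) (trans (sym (*-identityʳ (F μ))) (cong (F μ *_) (sym ι-1)))
  chain-sum (suc n) F μ = begin
    ∑ (chainEnds (suc n) μ) F
      ≡⟨ ∑-concat-map F (chainEnds n) (addBox μ) ⟩
    ∑ (addBox μ) (λ ρ → ∑ (chainEnds n ρ) F)
      ≡⟨ ∑-cong (chain-sum n F) (addBox μ) ⟩
    ∑ (addBox μ) (λ ρ → ∑ (upTo (suc n)) (λ i → Dpow i F ρ * ι (n C i)))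
      ≡⟨ ∑-swap (λ ρ i → Dpow i F ρ * ι (n C i)) (addBox μ) (upTo (suc n)) ⟩
    ∑ (upTo (suc n)) (λ i → ∑ (addBox μ) (λ ρ → Dpow i F ρ * ι (n C i)))
      ≡⟨ ∑-cong step is ⟩
    ∑ is (λ i → up i + stay i)
      ≡⟨ ∑-distrib-+ up stay is ⟩
    ∑ is up + ∑ is stay
      ≡⟨ cong (∑ is up +_) (trans (sym lengthen) (∑-upTo-suc stay (suc n))) ⟩
    ∑ is up + (F μ * ι (n C 0) + ∑ is (stay ∘ suc))
      ≡⟨ rotate (∑ is up) (F μ * ι (n C 0)) (∑ is (stay ∘ suc)) ⟩
    F μ * ι (n C 0) + (∑ is up + ∑ is (stay ∘ suc))
      ≡⟨ cong₂ _+_ (cong (λ k → F μ * ι k) (trans (nC0≡1 n) (sym (nC0≡1 (suc n))))) (trans (sym (∑-distrib-+ up (stay ∘ suc) is)) (∑-cong pascal is)) ⟩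
    F μ * ι (suc n C 0) + ∑ is (λ i → Dpow (suc i) F μ * ι (suc n C suc i))
      ≡⟨ sym (∑-upTo-suc (λ i → Dpow i F μ * ι (suc n C i)) (suc n)) ⟩
    ∑ (upTo (suc (suc n))) (λ i → Dpow i F μ * ι (suc n C i)) ∎
    where
    is = upTo (suc n)
    up stay : ℕ → ℚ
    up i = Dpow (suc i) F μ * ι (n C i)
    stay i = Dpow i F μ * ι (n C i)
    rotate : ∀ a b d → a + (b + d) ≡ b + (a + d)
    rotate = solve-∀ ℚ-ring
    split : ∀ u f k → u * k ≡ (u - f) * k + f * k
    split = solve-∀ ℚ-ring
    step : ∀ i → ∑ (addBox μ) (λ ρ → Dpow i F ρ * ι (n C i)) ≡ up i + stay i
    step i = begin
      ∑ (addBox μ) (λ ρ → Dpow i F ρ * ι (n C i))     ≡⟨ ∑-cong (λ ρ → *-comm (Dpow i F ρ) (ι (n C i))) (addBox μ) ⟩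
      ∑ (addBox μ) (λ ρ → ι (n C i) * Dpow i F ρ)     ≡⟨ ∑-distribˡ-* (ι (n C i)) (Dpow i F) (addBox μ) ⟩
      ι (n C i) * ∑ (addBox μ) (Dpow i F)             ≡⟨ *-comm (ι (n C i)) (∑ (addBox μ) (Dpow i F)) ⟩
      ∑ (addBox μ) (Dpow i F) * ι (n C i)             ≡⟨ split (∑ (addBox μ) (Dpow i F)) (Dpow i F μ) (ι (n C i)) ⟩
      up i + stay i ∎
    pascal : ∀ i → up i + stay (suc i) ≡ Dpow (suc i) F μ * ι (suc n C suc i)
    pascal i = trans (sym (*-distribˡ-+ (Dpow (suc i) F μ) (ι (n C i)) (ι (n C suc i))))
      (cong (Dpow (suc i) F μ *_) (trans (sym (ι-+ (n C i) (n C suc i))) (cong ι (nCk+nC[k+1]≡[n+1]C[k+1] n i))))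
    -- The extra term carries the binomial coefficient n over n + 1, which is 0; with it, splitting
    -- off i = 0 leaves a range that matches that of `up`.
    lengthen : ∑ (upTo (suc (suc n))) stay ≡ ∑ is stay
    lengthen = begin
      ∑ (upTo (suc (suc n))) stay      ≡⟨ ∑-upTo-last stay (suc n) ⟩
      ∑ is stay + stay (suc n)
        ≡⟨ cong (λ k → ∑ is stay + Dpow (suc n) F μ * k) (trans (cong ι (k>n⇒nCk≡0 {n} ℕ.≤-refl)) ι-0) ⟩
      ∑ is stay + Dpow (suc n) F μ * 0ℚ ≡⟨ cong (∑ is stay +_) (*-zeroʳ (Dpow (suc n) F μ)) ⟩
      ∑ is stay + 0ℚ                   ≡⟨ +-identityʳ (∑ is stay) ⟩
      ∑ is stay                        ∎

  -- Hook lengths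

  upTo-+ : ∀ m n → upTo (m ℕ.+ n) ≡ upTo m ++ map (m ℕ.+_) (upTo n)
  upTo-+ zero    n = sym (map-id (upTo n))
  upTo-+ (suc m) n = cong (0 ∷_) (begin
    applyUpTo suc (m ℕ.+ n)                                    ≡⟨ sym (map-upTo suc (m ℕ.+ n)) ⟩
    map suc (upTo (m ℕ.+ n))                                   ≡⟨ cong (map suc) (upTo-+ m n) ⟩
    map suc (upTo m ++ map (m ℕ.+_) (upTo n))                  ≡⟨ map-++ suc (upTo m) _ ⟩
    map suc (upTo m) ++ map suc (map (m ℕ.+_) (upTo n))        ≡⟨ cong₂ _++_ (map-upTo suc m) (sym (map-∘ (upTo n))) ⟩
    applyUpTo suc m ++ map (suc m ℕ.+_) (upTo n)               ∎)

  map-upTo-cong : ∀ {g h : ℕ → ℕ} n → (∀ j → j ℕ.< n → g j ≡ h j) → map g (upTo n) ≡ map h (upTo n)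
  map-upTo-cong n eq = map-cong-local (All.map (λ {j} → eq j) (All.all-upTo n))

  applyUpTo-∸ : ∀ n → applyUpTo (λ j → n ℕ.∸ suc j) n ≡ downFrom n
  applyUpTo-∸ zero    = refl
  applyUpTo-∸ (suc n) = cong (n ∷_) (applyUpTo-∸ n)

  downFrom-↭ : ∀ n → downFrom n ↭ upTo n
  downFrom-↭ n = subst (_↭ upTo n) (reverse-upTo n) (↭-reverse (upTo n))

  map-∸-↭ : ∀ (g : ℕ → ℕ) n → map (λ j → g (n ℕ.∸ suc j)) (upTo n) ↭ map g (upTo n)
  map-∸-↭ g n = ↭-trans
    (↭-reflexive (trans (map-∘ (upTo n)) (cong (map g) (trans (map-upTo (λ j → n ℕ.∸ suc j) n) (applyUpTo-∸ n)))))
    (↭-map⁺ g (downFrom-↭ n))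

  colLen-< : ∀ {r j} rs → j ℕ.< r → colLen (r ∷ rs) j ≡ suc (colLen rs j)
  colLen-< {r} {j} rs j<r = cong length (filter-accept (j ℕ.<?_) j<r)

  colLen-≥ : ∀ {r j} ρ → Decreasing (r ∷ ρ) → r ℕ.≤ j → colLen ρ j ≡ 0
  colLen-≥ {r} {j} []      _           r≤j = refl
  colLen-≥ {r} {j} (s ∷ ρ) (s≤r ∷ dec) r≤j =
    trans (cong length (filter-reject (j ℕ.<?_) (ℕ.≤⇒≯ s≤j))) (colLen-≥ ρ dec s≤j)
    where s≤j = ℕ.≤-trans s≤r r≤j

  rowHooks : ℕ → Partition → List ℕ
  rowHooks r ρ = map (λ j → suc ((r ℕ.∸ suc j) ℕ.+ colLen ρ j)) (upTo r)

  -- The differences x - x′ between the point of a row of length k placed on top of ρ and the points of the rows of ρ.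
  rowGaps : ℕ → Partition → List ℕ
  rowGaps k []      = []
  rowGaps k (s ∷ ρ) = suc (k ℕ.∸ s) ∷ rowGaps (suc k) ρ

  -- Let the next row have length s = a - d. The columns beyond s have no leg and give t + 1, ..., t
  -- + d; the gap to this row is t + d + 1; in the remaining columns the row adds one to the leg, so
  -- they form the same problem with `t` raised by d + 1. Together these fill an interval without
  -- repetition.
  hooks-gaps-shifted : ∀ t a ρ → Decreasing (a ∷ ρ) →
    map (λ j → suc (t ℕ.+ (a ℕ.∸ suc j) ℕ.+ colLen ρ j)) (upTo a) ++ rowGaps (t ℕ.+ a) ρ ↭ map (λ m → suc (t ℕ.+ m)) (upTo (a ℕ.+ length ρ))
  hooks-gaps-shifted t a [] _ = ↭-trans (↭-reflexive (++-identityʳ _))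
    (↭-trans (↭-reflexive (map-cong (λ j → cong suc (ℕ.+-identityʳ _)) (upTo a)))
    (↭-trans (map-∸-↭ (λ m → suc (t ℕ.+ m)) a) (↭-reflexive (cong (map _ ∘ upTo) (sym (ℕ.+-identityʳ a))))))
  hooks-gaps-shifted t a (s ∷ ρ) (s≤a ∷ dec) with ℕ.m≤n⇒∃[o]m+o≡n s≤a
  ... | d , refl = begin′
    map g (upTo (s ℕ.+ d)) ++ rowGaps (t ℕ.+ (s ℕ.+ d)) (s ∷ ρ)
      ↭⟨ ↭-reflexive (cong₂ _++_ (trans (cong (map g) (upTo-+ s d)) (map-++ g (upTo s) _)) (cong₂ _∷_ gap (cong (λ k → rowGaps k ρ) offset))) ⟩
    (map g (upTo s) ++ map g (map (s ℕ.+_) (upTo d))) ++ suc (t ℕ.+ d) ∷ R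
      ↭⟨ ++⁺ʳ _ (++-comm (map g (upTo s)) _) ⟩
    (map g (map (s ℕ.+_) (upTo d)) ++ map g (upTo s)) ++ suc (t ℕ.+ d) ∷ R
      ↭⟨ ↭-reflexive (++-assoc (map g (map (s ℕ.+_) (upTo d))) (map g (upTo s)) _) ⟩
    map g (map (s ℕ.+_) (upTo d)) ++ (map g (upTo s) ++ suc (t ℕ.+ d) ∷ R)
      ↭⟨ ++⁺ (↭-trans (↭-reflexive arms) (map-∸-↭ u d)) (↭-shift (suc (t ℕ.+ d)) (map g (upTo s)) R) ⟩
    map u (upTo d) ++ suc (t ℕ.+ d) ∷ (map g (upTo s) ++ R)
      ↭⟨ ++⁺ˡ (map u (upTo d)) (prep _ (↭-trans (↭-reflexive (cong (_++ R) inner-hooks)) (hooks-gaps-shifted (t ℕ.+ suc d) s ρ dec))) ⟩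
    map u (upTo d) ++ suc (t ℕ.+ d) ∷ map (λ m → suc (t ℕ.+ suc d ℕ.+ m)) (upTo (s ℕ.+ length ρ))
      ↭⟨ ↭-reflexive (sym target) ⟩
    map u (upTo (s ℕ.+ d ℕ.+ suc (length ρ))) ∎′
    where
    open PermutationReasoning using (step-↭-⟩) renaming (begin_ to begin′_; _∎ to _∎′)
    g u : ℕ → ℕ
    g j = suc (t ℕ.+ (s ℕ.+ d ℕ.∸ suc j) ℕ.+ colLen (s ∷ ρ) j)
    u m = suc (t ℕ.+ m)
    R = rowGaps (t ℕ.+ suc d ℕ.+ s) ρ
    gap : suc (t ℕ.+ (s ℕ.+ d) ℕ.∸ s) ≡ suc (t ℕ.+ d)
    gap = cong suc (trans (cong (ℕ._∸ s) (trans (cong (t ℕ.+_) (ℕ.+-comm s d)) (sym (ℕ.+-assoc t d s)))) (ℕ.m+n∸n≡m (t ℕ.+ d) s))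
    offset : suc (t ℕ.+ (s ℕ.+ d)) ≡ t ℕ.+ suc d ℕ.+ s
    offset = trans (cong suc (trans (cong (t ℕ.+_) (ℕ.+-comm s d)) (sym (ℕ.+-assoc t d s)))) (cong (ℕ._+ s) (sym (ℕ.+-suc t d)))
    arms : map g (map (s ℕ.+_) (upTo d)) ≡ map (λ j → u (d ℕ.∸ suc j)) (upTo d)
    arms = trans (sym (map-∘ (upTo d))) (map-cong (λ j → cong suc (trans
      (cong₂ ℕ._+_ (cong (t ℕ.+_) (trans (cong (s ℕ.+ d ℕ.∸_) (sym (ℕ.+-suc s j))) (ℕ.[m+n]∸[m+o]≡n∸o s d (suc j))))
                    (colLen-≥ (s ∷ ρ) (ℕ.≤-refl ∷ dec) (ℕ.m≤m+n s j)))
      (ℕ.+-identityʳ _))) (upTo d))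
    inner-hooks : map g (upTo s) ≡ map (λ j → suc (t ℕ.+ suc d ℕ.+ (s ℕ.∸ suc j) ℕ.+ colLen ρ j)) (upTo s)
    inner-hooks = map-upTo-cong s (λ j j<s → cong suc (trans
      (cong₂ ℕ._+_ (cong (t ℕ.+_) (trans (ℕ.+-∸-comm d j<s) (ℕ.+-comm (s ℕ.∸ suc j) d))) (colLen-< ρ j<s))
      (rearrange t d (s ℕ.∸ suc j) (colLen ρ j))))
      where
      rearrange : ∀ t d e k → t ℕ.+ (d ℕ.+ e) ℕ.+ suc k ≡ t ℕ.+ suc d ℕ.+ e ℕ.+ k
      rearrange = ℕ-solve-∀
    target : map u (upTo (s ℕ.+ d ℕ.+ suc (length ρ))) ≡
             map u (upTo d) ++ suc (t ℕ.+ d) ∷ map (λ m → suc (t ℕ.+ suc d ℕ.+ m)) (upTo (s ℕ.+ length ρ))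
    target = begin
      map u (upTo (s ℕ.+ d ℕ.+ suc (length ρ)))                                ≡⟨ cong (map u ∘ upTo) (regroup s d (length ρ)) ⟩
      map u (upTo (d ℕ.+ suc (s ℕ.+ length ρ)))                                ≡⟨ cong (map u) (upTo-+ d (suc (s ℕ.+ length ρ))) ⟩
      map u (upTo d ++ map (d ℕ.+_) (upTo (suc (s ℕ.+ length ρ))))             ≡⟨ map-++ u (upTo d) _ ⟩
      map u (upTo d) ++ map u (map (d ℕ.+_) (upTo (suc (s ℕ.+ length ρ))))
        ≡⟨ cong (map u (upTo d) ++_) (sym (map-∘ (upTo (suc (s ℕ.+ length ρ))))) ⟩
      map u (upTo d) ++ u (d ℕ.+ 0) ∷ map (u ∘ (d ℕ.+_)) (applyUpTo suc (s ℕ.+ length ρ))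
        ≡⟨ cong₂ (λ h l → map u (upTo d) ++ u h ∷ l) (ℕ.+-identityʳ d) (trans (cong (map (u ∘ (d ℕ.+_))) (sym (map-upTo suc (s ℕ.+ length ρ)))) (trans (sym (map-∘ (upTo (s ℕ.+ length ρ)))) (map-cong (λ m → cong suc (assoc t d m)) (upTo (s ℕ.+ length ρ))))) ⟩
      map u (upTo d) ++ suc (t ℕ.+ d) ∷ map (λ m → suc (t ℕ.+ suc d ℕ.+ m)) (upTo (s ℕ.+ length ρ)) ∎
      where
      regroup : ∀ s d n → s ℕ.+ d ℕ.+ suc n ≡ d ℕ.+ suc (s ℕ.+ n)
      regroup = ℕ-solve-∀
      assoc : ∀ t d m → t ℕ.+ (d ℕ.+ suc m) ≡ t ℕ.+ suc d ℕ.+ m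
      assoc = ℕ-solve-∀

  hooks-gaps : ∀ r ρ → Decreasing (r ∷ ρ) → rowHooks r ρ ++ rowGaps r ρ ↭ map suc (upTo (r ℕ.+ length ρ))
  hooks-gaps = hooks-gaps-shifted 0

  hooks : Partition → List ℕ
  hooks []       = []
  hooks (r ∷ rs) = rowHooks r rs ++ hooks rs

  rowLen-bound : ∀ r rs i → Decreasing (r ∷ rs) → rowLen rs i ℕ.≤ r
  rowLen-bound r []       i       _           = ℕ.z≤n
  rowLen-bound r (s ∷ rs) zero    (s≤r ∷ _)   = s≤r
  rowLen-bound r (s ∷ rs) (suc i) (s≤r ∷ dec) = ℕ.≤-trans (rowLen-bound s rs i dec) s≤r

  -- A row above reaches every column of the rows below, so it adds one to the column length as well
  -- as to the row index, and the legs below are unchanged. `Λ` and `g` keep the ambient partition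
  -- and its numbering of rows during the induction.
  map-hook-cells-at : ∀ Λ (g : ℕ → ℕ) ρ → Decreasing ρ →
    (∀ i j → j ℕ.< rowLen ρ i → hook Λ (g i , j) ≡ hook ρ (i , j)) →
    map (hook Λ) (concat (map (λ (i , r) → map (i ,_) (upTo r)) (zip (applyUpTo g (length ρ)) ρ))) ≡ hooks ρ
  map-hook-cells-at Λ g []       _   _  = refl
  map-hook-cells-at Λ g (r ∷ rs) dec eq = trans
    (map-++ (hook Λ) (map (g 0 ,_) (upTo r)) _)
    (cong₂ _++_
      (trans (sym (map-∘ (upTo r))) (map-upTo-cong r (λ j j<r → trans (eq 0 j j<r) (cong (λ l → suc ((r ℕ.∸ suc j) ℕ.+ (l ℕ.∸ 1))) (colLen-< rs j<r)))))
      (map-hook-cells-at Λ (g ∘ suc) rs (Decreasing-tail dec) (λ i j j<l →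
        trans (eq (suc i) j j<l) (cong (λ l → suc ((rowLen rs i ℕ.∸ suc j) ℕ.+ (l ℕ.∸ suc (suc i)))) (colLen-< rs (ℕ.<-≤-trans j<l (rowLen-bound r rs i dec)))))))

  map-hook-cells : ∀ ρ → Decreasing ρ → map (hook ρ) (cells ρ) ≡ hooks ρ
  map-hook-cells ρ dec = map-hook-cells-at ρ id ρ dec (λ _ _ _ → refl)

  row-gap : ∀ z c k s → s ℕ.≤ k → z - c ≡ ι (suc k) → z - (c + ι s) ≡ ι (suc (k ℕ.∸ s))
  row-gap z c k s s≤k eq = begin
    z - (c + ι s)                        ≡⟨ regroup z c (ι s) ⟩
    (z - c) - ι s
      ≡⟨ cong (_- ι s) (trans eq (trans (cong (ι ∘ suc) (sym (ℕ.m∸n+n≡m s≤k))) (ι-+ (suc (k ℕ.∸ s)) s))) ⟩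
    ι (suc (k ℕ.∸ s)) + ι s - ι s        ≡⟨ cancel (ι (suc (k ℕ.∸ s))) (ι s) ⟩
    ι (suc (k ℕ.∸ s))                    ∎
    where
    regroup : ∀ z c s → z - (c + s) ≡ z - c - s
    regroup = solve-∀ ℚ-ring
    cancel : ∀ a s → a + s - s ≡ a
    cancel = solve-∀ ℚ-ring

  -- At the point of the row on top, each difference z - x is a gap, and the bottom factor k + 1 is
  -- consumed by the factorial. The bound `b` guarantees that the truncated subtraction in `rowGaps`
  -- is exact.
  rowFactor-gaps : ∀ k c ρ z b → Decreasing (b ∷ ρ) → b ℕ.≤ k → z - c ≡ ι (suc k) →
    rowFactor (suc k) c ρ z * ι ((k ℕ.+ length ρ) ℕ.!) ≡ ι (product (rowGaps k ρ))
  rowFactor-gaps k c [] z b _ _ eq = begin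
    (z - c) * inv (ι (suc k ℕ.!)) * ι ((k ℕ.+ 0) ℕ.!)
      ≡⟨ cong₂ (λ s t → s * inv (ι (suc k ℕ.!)) * ι (t ℕ.!)) eq (ℕ.+-identityʳ k) ⟩
    ι (suc k) * inv (ι (suc k ℕ.!)) * ι (k ℕ.!)
      ≡⟨ trans (cong (_* ι (k ℕ.!)) (ι-suc-inv-! k)) (*-comm (inv (ι (k ℕ.!))) (ι (k ℕ.!))) ⟩
    ι (k ℕ.!) * inv (ι (k ℕ.!))                             ≡⟨ inv-cancel (ι-!≢0 k) ⟩
    1ℚ                                                      ≡⟨ sym ι-1 ⟩
    ι 1                                                     ∎
  rowFactor-gaps k c (s ∷ ρ) z b (s≤b ∷ dec) b≤k eq = begin
    (z - (c + ι s)) * rowFactor (suc (suc k)) (c - 1ℚ) ρ z * ι ((k ℕ.+ suc (length ρ)) ℕ.!)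
      ≡⟨ *-assoc (z - (c + ι s)) _ _ ⟩
    (z - (c + ι s)) * (rowFactor (suc (suc k)) (c - 1ℚ) ρ z * ι ((k ℕ.+ suc (length ρ)) ℕ.!))
      ≡⟨ cong₂ _*_ gap (trans (cong (λ n → rowFactor (suc (suc k)) (c - 1ℚ) ρ z * ι (n ℕ.!)) (ℕ.+-suc k (length ρ)))
          (rowFactor-gaps (suc k) (c - 1ℚ) ρ z s dec (ℕ.m≤n⇒m≤1+n (ℕ.≤-trans s≤b b≤k)) (next-offset z c (suc k) eq))) ⟩
    ι (suc (k ℕ.∸ s)) * ι (product (rowGaps (suc k) ρ))
      ≡⟨ sym (ι-* (suc (k ℕ.∸ s)) (product (rowGaps (suc k) ρ))) ⟩
    ι (product (rowGaps k (s ∷ ρ))) ∎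
    where
    gap : z - (c + ι s) ≡ ι (suc (k ℕ.∸ s))
    gap = row-gap z c k s (ℕ.≤-trans s≤b b≤k) eq

  product-map-suc-upTo : ∀ n → product (map suc (upTo n)) ≡ n ℕ.!
  product-map-suc-upTo n = trans (product-↭ (↭-map⁺ suc (↭-sym (downFrom-↭ n)))) (go n)
    where
    go : ∀ n → product (map suc (downFrom n)) ≡ n ℕ.!
    go zero    = refl
    go (suc n) = cong (suc n ℕ.*_) (go n)

  -- For each row the hooks times the gaps give n!, while the factor of the row in `G` is the
  -- product of the gaps over n!.
  hooks-G : ∀ c ρ → Decreasing ρ → ι (product (hooks ρ)) * G c ρ ≡ 1ℚ
  hooks-G c []       _   = trans (cong (_* 1ℚ) ι-1) (*-identityˡ 1ℚ)
  hooks-G c (r ∷ rs) dec = begin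
    ι (product (rowHooks r rs ++ hooks rs)) * (Grs * F)
      ≡⟨ cong (λ n → ι n * (Grs * F)) (product-++ (rowHooks r rs) (hooks rs)) ⟩
    ι (product (rowHooks r rs) ℕ.* product (hooks rs)) * (Grs * F)
      ≡⟨ cong (_* (Grs * F)) (ι-* (product (rowHooks r rs)) (product (hooks rs))) ⟩
    h * ι (product (hooks rs)) * (Grs * F)                              ≡⟨ shuffle h (ι (product (hooks rs))) Grs F ⟩
    ι (product (hooks rs)) * Grs * (h * F)
      ≡⟨ cong₂ _*_ (hooks-G (c - 1ℚ) rs (Decreasing-tail dec)) hF ⟩
    1ℚ * 1ℚ                                                             ∎
    where
    Grs = G (c - 1ℚ) rs
    F = rowFactor (suc r) (c - 1ℚ) rs (c + ι r)
    h = ι (product (rowHooks r rs))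
    n = r ℕ.+ length rs
    shuffle : ∀ a b g f → a * b * (g * f) ≡ b * g * (a * f)
    shuffle = solve-∀ ℚ-ring
    pull : ∀ n h f → n * (h * f) ≡ h * (f * n)
    pull = solve-∀ ℚ-ring
    hF : h * F ≡ 1ℚ
    hF = *-cancelˡ (ι-!≢0 n) (begin
      ι (n ℕ.!) * (h * F)                       ≡⟨ pull (ι (n ℕ.!)) h F ⟩
      h * (F * ι (n ℕ.!))
        ≡⟨ cong (h *_) (rowFactor-gaps r (c - 1ℚ) rs (c + ι r) r dec ℕ.≤-refl (row-offset c r)) ⟩
      h * ι (product (rowGaps r rs))            ≡⟨ sym (ι-* (product (rowHooks r rs)) (product (rowGaps r rs))) ⟩
      ι (product (rowHooks r rs) ℕ.* product (rowGaps r rs))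
        ≡⟨ cong ι (trans (sym (product-++ (rowHooks r rs) (rowGaps r rs))) (trans (product-↭ (hooks-gaps r rs dec)) (product-map-suc-upTo n))) ⟩
      ι (n ℕ.!)                                 ≡⟨ sym (*-identityʳ (ι (n ℕ.!))) ⟩
      ι (n ℕ.!) * 1ℚ                            ∎)

  -- Hook power sums as polynomials in the power sums

  falling : ℕ → ℚ → ℚ
  falling zero    x = 1ℚ
  falling (suc k) x = falling k x * (x - ι k)

  falling-suc : ∀ k x → falling (suc k) (x + 1ℚ) ≡ (x + 1ℚ) * falling k x
  falling-suc zero    x = trans (cong (λ s → 1ℚ * (x + 1ℚ - s)) ι-0) (simplify x)
    where
    simplify : ∀ x → 1ℚ * (x + 1ℚ - 0ℚ) ≡ (x + 1ℚ) * 1ℚ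
    simplify = solve-∀ ℚ-ring
  falling-suc (suc k) x = trans (cong₂ (λ s t → s * (x + 1ℚ - t)) (falling-suc k x) (ι-suc k)) (simplify x (falling k x) (ι k))
    where
    simplify : ∀ x f k → (x + 1ℚ) * f * (x + 1ℚ - (1ℚ + k)) ≡ (x + 1ℚ) * (f * (x - k))
    simplify = solve-∀ ℚ-ring

  second-difference : (ℚ → ℚ) → ℚ → ℚ
  second-difference ψ x = ψ (x + 1ℚ) - (1ℚ + 1ℚ) * ψ x + ψ (x - 1ℚ)

  -- All three values are multiples of `falling k (x - 1ℚ)`, which leaves a polynomial identity. The
  -- shift in the argument is due to the difference being centred at x.
  falling-second-difference : ∀ k x →
    second-difference (falling (suc (suc k))) x ≡ ι (suc k) * ι (suc (suc k)) * falling k (x - 1ℚ)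
  falling-second-difference k x = begin
    falling (suc (suc k)) (x + 1ℚ) - (1ℚ + 1ℚ) * falling (suc (suc k)) x + falling (suc (suc k)) u
      ≡⟨ cong₂ (λ s t → s - (1ℚ + 1ℚ) * t + falling (suc (suc k)) u)
          (trans (falling-suc (suc k) x) (cong ((x + 1ℚ) *_) (lower k))) (lower (suc k)) ⟩
    (x + 1ℚ) * ((u + 1ℚ) * falling k u) - (1ℚ + 1ℚ) * ((u + 1ℚ) * (falling k u * (u - ι k))) + falling k u * (u - ι k) * (u - ι (suc k))
      ≡⟨ cong (λ s → (x + 1ℚ) * ((u + 1ℚ) * falling k u) - (1ℚ + 1ℚ) * ((u + 1ℚ) * (falling k u * (u - ι k))) + falling k u * (u - ι k) * (u - s)) (ι-suc k) ⟩
    (x + 1ℚ) * ((u + 1ℚ) * falling k u) - (1ℚ + 1ℚ) * ((u + 1ℚ) * (falling k u * (u - ι k))) + falling k u * (u - ι k) * (u - (1ℚ + ι k))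
      ≡⟨ simplify x (falling k u) (ι k) ⟩
    (1ℚ + ι k) * (1ℚ + (1ℚ + ι k)) * falling k u
      ≡⟨ cong₂ (λ s t → s * t * falling k u) (sym (ι-suc k)) (sym (trans (ι-suc (suc k)) (cong (1ℚ +_) (ι-suc k)))) ⟩
    ι (suc k) * ι (suc (suc k)) * falling k u ∎
    where
    u = x - 1ℚ
    restore : ∀ x → x ≡ x - 1ℚ + 1ℚ
    restore = solve-∀ ℚ-ring
    lower : ∀ k → falling (suc k) x ≡ (u + 1ℚ) * falling k u
    lower k = trans (cong (falling (suc k)) (restore x)) (falling-suc k u)
    simplify : ∀ x f k → (x + 1ℚ) * ((x - 1ℚ + 1ℚ) * f) - (1ℚ + 1ℚ) * ((x - 1ℚ + 1ℚ) * (f * (x - 1ℚ - k))) + f * (x - 1ℚ - k) * (x - 1ℚ - (1ℚ + k))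
      ≡ (1ℚ + k) * (1ℚ + (1ℚ + k)) * f
    simplify = solve-∀ ℚ-ring

  data Poly₂ : ℕ → (ℚ → ℚ → ℚ) → Set where
    term  : ∀ {d} s i j → i ℕ.+ j ℕ.≤ d → Poly₂ d (λ a b → s * (a ^ i * b ^ j))
    _⊞_   : ∀ {d F F′} → Poly₂ d F → Poly₂ d F′ → Poly₂ d (λ a b → F a b + F′ a b)
    ext   : ∀ {d F F′} → (∀ a b → F a b ≡ F′ a b) → Poly₂ d F → Poly₂ d F′

  Poly₂-raise : ∀ {d e F} → d ℕ.≤ e → Poly₂ d F → Poly₂ e F
  Poly₂-raise d≤e (term s i j le) = term s i j (ℕ.≤-trans le d≤e)
  Poly₂-raise d≤e (P ⊞ Q)         = Poly₂-raise d≤e P ⊞ Poly₂-raise d≤e Q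
  Poly₂-raise d≤e (ext eq P)      = ext eq (Poly₂-raise d≤e P)

  Poly₂-*-linear : ∀ {d F} k → Poly₂ d F → Poly₂ (suc d) (λ a b → F a b * (a - b - k))
  Poly₂-*-linear {d} k (term s i j le) = ext (λ a b → expand s a b k (a ^ i) (b ^ j))
    (term s (suc i) j (ℕ.s≤s le) ⊞ term (- s) i (suc j) (subst (ℕ._≤ suc d) (sym (ℕ.+-suc i j)) (ℕ.s≤s le)) ⊞ term (- (s * k)) i j (ℕ.m≤n⇒m≤1+n le))
    where
    expand : ∀ s a b k u v → s * (a * u * v) + (- s) * (u * (b * v)) + (- (s * k)) * (u * v) ≡ s * (u * v) * (a - b - k)
    expand = solve-∀ ℚ-ring
  Poly₂-*-linear k (_⊞_ {F = F} {F′ = F′} P Q) = ext (λ a b → sym (*-distribʳ-+ (a - b - k) (F a b) (F′ a b))) (Poly₂-*-linear k P ⊞ Poly₂-*-linear k Q)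
  Poly₂-*-linear k (ext eq P) = ext (λ a b → cong (_* (a - b - k)) (eq a b)) (Poly₂-*-linear k P)

  Poly₂-scale : ∀ {d F} s → Poly₂ d F → Poly₂ d (λ a b → s * F a b)
  Poly₂-scale s (term t i j le) = ext (λ a b → *-assoc s t (a ^ i * b ^ j)) (term (s * t) i j le)
  Poly₂-scale s (_⊞_ {F = F} {F′ = F′} P Q) = ext (λ a b → sym (*-distribˡ-+ s (F a b) (F′ a b))) (Poly₂-scale s P ⊞ Poly₂-scale s Q)
  Poly₂-scale s (ext eq P)      = ext (λ a b → cong (s *_) (eq a b)) (Poly₂-scale s P)

  Poly₂-falling : ∀ k → Poly₂ k (λ a b → falling k (a - b))
  Poly₂-falling zero    = ext (λ a b → refl) (term 1ℚ 0 0 ℕ.z≤n)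
  Poly₂-falling (suc k) = Poly₂-*-linear (ι k) (Poly₂-falling k)

  -- The identity x ff_j(x - 1) = ff_{j+1}(x - 1) + (j + 1) ff_j(x - 1) reduces powers of x to falling factorials.
  second-antidifference : ∀ d j → ∃[ ψ ] Poly₂ (d ℕ.+ (2 ℕ.+ j)) (λ a b → ψ (a - b)) ×
    (∀ x → second-difference ψ x ≡ x ^ d * falling j (x - 1ℚ))
  second-antidifference zero j =
    (λ x → s * falling (suc (suc j)) x) , Poly₂-scale s (Poly₂-falling (suc (suc j))) , λ x → begin
      s * falling (suc (suc j)) (x + 1ℚ) - (1ℚ + 1ℚ) * (s * falling (suc (suc j)) x) + s * falling (suc (suc j)) (x - 1ℚ)
        ≡⟨ factor s _ _ _ ⟩
      s * second-difference (falling (suc (suc j))) x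
        ≡⟨ cong (s *_) (falling-second-difference j x) ⟩
      s * (ι (suc j) * ι (suc (suc j)) * falling j (x - 1ℚ))
        ≡⟨ regroup (ι (suc j)) (ι (suc (suc j))) (inv (ι (suc j))) (inv (ι (suc (suc j)))) (falling j (x - 1ℚ)) ⟩
      ι (suc j) * inv (ι (suc j)) * (ι (suc (suc j)) * inv (ι (suc (suc j)))) * falling j (x - 1ℚ)
        ≡⟨ cong₂ (λ a b → a * b * falling j (x - 1ℚ)) (inv-cancel (ι-suc≢0 j)) (inv-cancel (ι-suc≢0 (suc j))) ⟩
      1ℚ * falling j (x - 1ℚ) ∎
    where
    -- This divides out the factor (j + 1) (j + 2) produced by the second difference.
    s = inv (ι (suc j)) * inv (ι (suc (suc j)))
    factor : ∀ s a b c → s * a - (1ℚ + 1ℚ) * (s * b) + s * c ≡ s * (a - (1ℚ + 1ℚ) * b + c)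
    factor = solve-∀ ℚ-ring
    regroup : ∀ a b i k f → i * k * (a * b * f) ≡ a * i * (b * k) * f
    regroup = solve-∀ ℚ-ring
  second-antidifference (suc d) j with second-antidifference d (suc j) | second-antidifference d j
  ... | ψ , P , ψ″ | χ , Q , χ″ = (λ x → ψ x + ι (suc j) * χ x) ,
    subst (λ e → Poly₂ e (λ a b → ψ (a - b))) (ℕ.+-suc d (2 ℕ.+ j)) P ⊞ Poly₂-raise (ℕ.n≤1+n _) (Poly₂-scale (ι (suc j)) Q) ,
    λ x → begin
      ψ (x + 1ℚ) + ι (suc j) * χ (x + 1ℚ) - (1ℚ + 1ℚ) * (ψ x + ι (suc j) * χ x) + (ψ (x - 1ℚ) + ι (suc j) * χ (x - 1ℚ))
        ≡⟨ split (ι (suc j)) (ψ (x + 1ℚ)) (ψ x) (ψ (x - 1ℚ)) (χ (x + 1ℚ)) (χ x) (χ (x - 1ℚ)) ⟩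
      second-difference ψ x + ι (suc j) * second-difference χ x
        ≡⟨ cong₂ (λ s t → s + ι (suc j) * t) (ψ″ x) (χ″ x) ⟩
      x ^ d * (falling j (x - 1ℚ) * (x - 1ℚ - ι j)) + ι (suc j) * (x ^ d * falling j (x - 1ℚ))
        ≡⟨ cong (λ s → x ^ d * (falling j (x - 1ℚ) * (x - 1ℚ - ι j)) + s * (x ^ d * falling j (x - 1ℚ))) (ι-suc j) ⟩
      x ^ d * (falling j (x - 1ℚ) * (x - 1ℚ - ι j)) + (1ℚ + ι j) * (x ^ d * falling j (x - 1ℚ))
        ≡⟨ collect x (x ^ d) (falling j (x - 1ℚ)) (ι j) ⟩
      x * x ^ d * falling j (x - 1ℚ) ∎
    where
    split : ∀ s a b c a′ b′ c′ → a + s * a′ - (1ℚ + 1ℚ) * (b + s * b′) + (c + s * c′) ≡ a - (1ℚ + 1ℚ) * b + c + s * (a′ - (1ℚ + 1ℚ) * b′ + c′)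
    split = solve-∀ ℚ-ring
    collect : ∀ x p f j → p * (f * (x - 1ℚ - j)) + (1ℚ + j) * (p * f) ≡ x * p * f
    collect = solve-∀ ℚ-ring

  -- Sums over pairs of contents

  pairSum : ℚ → (ℚ → ℚ → ℚ) → Partition → ℚ
  pairSum c F ρ = signedSum c (λ a → signedSum c (F a) ρ) ρ

  signedSum-scale : ∀ s φ c ρ → signedSum c (λ z → s * φ z) ρ ≡ s * signedSum c φ ρ
  signedSum-scale s φ c ρ = trans (signedSum-ext (λ z → pad s (φ z)) c ρ) (trans (signedSum-linear s 0ℚ φ φ c ρ) (sym (pad s (signedSum c φ ρ))))
    where
    pad : ∀ a p → a * p ≡ a * p + 0ℚ * p
    pad = solve-∀ ℚ-ring

  signedSum-+ : ∀ φ χ c ρ → signedSum c (λ z → φ z + χ z) ρ ≡ signedSum c φ ρ + signedSum c χ ρ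
  signedSum-+ φ χ c ρ = trans (signedSum-ext (λ z → pad (φ z) (χ z)) c ρ) (trans (signedSum-linear 1ℚ 1ℚ φ χ c ρ) (sym (pad (signedSum c φ ρ) (signedSum c χ ρ))))
    where
    pad : ∀ a b → a + b ≡ 1ℚ * a + 1ℚ * b
    pad = solve-∀ ℚ-ring

  -- The double sum of a monomial a^i b^j factors as p_i p_j.
  pairSum-weight : ∀ {d F} → Poly₂ d F → OnDecreasing d (pairSum 0ℚ F)
  pairSum-weight (term s i j le) = OnDecreasing-ext (λ ρ _ → factor ρ)
    (OnDecreasing-raise le (OnDecreasing-* (const s) (_ , power i ⊠ power j , λ _ _ → refl)))
    where
    regroup : ∀ s u q → s * (u * q) ≡ s * q * u
    regroup = solve-∀ ℚ-ring
    factor : ∀ ρ → pairSum 0ℚ (λ a b → s * (a ^ i * b ^ j)) ρ ≡ s * (p i ρ * p j ρ)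
    factor ρ = begin
      signedSum 0ℚ (λ a → signedSum 0ℚ (λ b → s * (a ^ i * b ^ j)) ρ) ρ
        ≡⟨ signedSum-ext (λ a → trans (signedSum-scale s (λ b → a ^ i * b ^ j) 0ℚ ρ) (trans (cong (s *_) (signedSum-scale (a ^ i) (_^ j) 0ℚ ρ)) (regroup s (a ^ i) (p j ρ)))) 0ℚ ρ ⟩
      signedSum 0ℚ (λ a → s * p j ρ * a ^ i) ρ    ≡⟨ signedSum-scale (s * p j ρ) (_^ i) 0ℚ ρ ⟩
      s * p j ρ * p i ρ                           ≡⟨ sym (regroup s (p i ρ) (p j ρ)) ⟩
      s * (p i ρ * p j ρ)                         ∎
  pairSum-weight (_⊞_ {F = F} {F′ = F′} P Q) = OnDecreasing-ext
    (λ ρ _ → trans (signedSum-ext (λ a → signedSum-+ (F a) (F′ a) 0ℚ ρ) 0ℚ ρ) (signedSum-+ (λ a → signedSum 0ℚ (F a) ρ) (λ a → signedSum 0ℚ (F′ a) ρ) 0ℚ ρ))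
    (OnDecreasing-+ (pairSum-weight P) (pairSum-weight Q))
  pairSum-weight (ext {F = F} {F′ = F′} eq P) = OnDecreasing-ext
    (λ ρ _ → signedSum-ext (λ a → signedSum-ext (λ b → sym (eq a b)) 0ℚ ρ) 0ℚ ρ)
    (pairSum-weight P)

  -- Each pair of rows contributes minus a second difference of ψ to pairSum; the pairs of a row with the bottom
  -- end point contribute sums of such, so that hooks-gaps leaves exactly the hook lengths.
  module HookSum {ψ φ : ℚ → ℚ} (ψ″ : ∀ x → second-difference ψ x ≡ φ x) (φ-even : ∀ x → φ (- x) ≡ φ x) (φ-0 : φ 0ℚ ≡ 0ℚ) where

    -- With m = x - b, the contribution of `b` paired in both orders with the outer point x and the
    -- inner point x - 1 of a row.
    χ : ℚ → ℚ
    χ m = ψ m - ψ (m - 1ℚ) + ψ (- m) - ψ (1ℚ - m)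

    χ-suc : ∀ m → χ (m + 1ℚ) ≡ χ m + (φ m + φ m)
    χ-suc m = begin
      ψ (m + 1ℚ) - ψ (m + 1ℚ - 1ℚ) + ψ (- (m + 1ℚ)) - ψ (1ℚ - (m + 1ℚ))
        ≡⟨ cong₂ (λ s t → ψ (m + 1ℚ) - ψ s + ψ t - ψ (1ℚ - (m + 1ℚ))) (i₁ m) (i₂ m) ⟩
      ψ (m + 1ℚ) - ψ m + ψ (- m - 1ℚ) - ψ (1ℚ - (m + 1ℚ))
        ≡⟨ cong (λ s → ψ (m + 1ℚ) - ψ m + ψ (- m - 1ℚ) - ψ s) (i₃ m) ⟩
      ψ (m + 1ℚ) - ψ m + ψ (- m - 1ℚ) - ψ (- m)
        ≡⟨ collect (ψ (m + 1ℚ)) (ψ m) (ψ (m - 1ℚ)) (ψ (- m + 1ℚ)) (ψ (- m)) (ψ (- m - 1ℚ)) ⟩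
      ψ m - ψ (m - 1ℚ) + ψ (- m) - ψ (- m + 1ℚ) + (second-difference ψ m + second-difference ψ (- m))
        ≡⟨ cong₂ (λ s t → ψ m - ψ (m - 1ℚ) + ψ (- m) - ψ s + t) (+-comm (- m) 1ℚ) (cong₂ _+_ (ψ″ m) (trans (ψ″ (- m)) (φ-even m))) ⟩
      χ m + (φ m + φ m) ∎
      where
      i₁ : ∀ m → m + 1ℚ - 1ℚ ≡ m
      i₁ = solve-∀ ℚ-ring
      i₂ : ∀ m → - (m + 1ℚ) ≡ - m - 1ℚ
      i₂ = solve-∀ ℚ-ring
      i₃ : ∀ m → 1ℚ - (m + 1ℚ) ≡ - m
      i₃ = solve-∀ ℚ-ring
      collect : ∀ a b c a′ b′ c′ → a - b + c′ - b′ ≡ b - c + b′ - a′ + (a - (1ℚ + 1ℚ) * b + c + (a′ - (1ℚ + 1ℚ) * b′ + c′))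
      collect = solve-∀ ℚ-ring

    χ-1 : χ 1ℚ ≡ 0ℚ
    χ-1 = trans (regroup (ψ 1ℚ) (ψ 0ℚ) (ψ (- 1ℚ))) (trans (ψ″ 0ℚ) φ-0)
      where
      regroup : ∀ a b c → a - b + c - b ≡ a - (1ℚ + 1ℚ) * b + c
      regroup = solve-∀ ℚ-ring

    ∑φ : List ℕ → ℚ
    ∑φ xs = ∑ xs (φ ∘ ι)

    -- Telescoping, since χ grows by φ(m) + φ(-m) = 2 φ(m) and starts from χ 1 = φ 0 = 0.
    χ-ι : ∀ n → χ (ι (suc n)) ≡ ∑φ (map suc (upTo n)) + ∑φ (map suc (upTo n))
    χ-ι zero    = trans (cong χ ι-1) χ-1
    χ-ι (suc n) = begin
      χ (ι (suc (suc n)))                              ≡⟨ cong χ (trans (ι-suc (suc n)) (+-comm 1ℚ (ι (suc n)))) ⟩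
      χ (ι (suc n) + 1ℚ)                               ≡⟨ χ-suc (ι (suc n)) ⟩
      χ (ι (suc n)) + (φ (ι (suc n)) + φ (ι (suc n)))  ≡⟨ cong (_+ (φ (ι (suc n)) + φ (ι (suc n)))) (χ-ι n) ⟩
      S + S + (φ (ι (suc n)) + φ (ι (suc n)))          ≡⟨ regroup S (φ (ι (suc n))) ⟩
      S + φ (ι (suc n)) + (S + φ (ι (suc n)))          ≡⟨ cong (λ s → s + s) (sym last) ⟩
      ∑φ (map suc (upTo (suc n))) + ∑φ (map suc (upTo (suc n))) ∎
      where
      S = ∑φ (map suc (upTo n))
      regroup : ∀ s f → s + s + (f + f) ≡ s + f + (s + f)
      regroup = solve-∀ ℚ-ring
      last : ∑φ (map suc (upTo (suc n))) ≡ S + φ (ι (suc n))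
      last = trans (∑-map (φ ∘ ι) suc (upTo (suc n))) (trans (∑-upTo-last (φ ∘ ι ∘ suc) n) (cong (_+ φ (ι (suc n))) (sym (∑-map (φ ∘ ι) suc (upTo n)))))

    -- The outer and the inner point of a lower row give χ(l) - χ(l + 1) = -2 φ(l) with l the gap,
    -- which cancels against `rowGaps`. Only the bottom point is left, at a distance one more than k
    -- plus the number of rows.
    signedSum-χ : ∀ k c ρ z b → Decreasing (b ∷ ρ) → b ℕ.≤ k → z - c ≡ ι (suc k) →
      signedSum c (λ y → χ (z - y)) ρ + (∑φ (rowGaps k ρ) + ∑φ (rowGaps k ρ))
        ≡ ∑φ (map suc (upTo (k ℕ.+ length ρ))) + ∑φ (map suc (upTo (k ℕ.+ length ρ)))
    signedSum-χ k c [] z b _ _ eq = begin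
      χ (z - c) + (0ℚ + 0ℚ)      ≡⟨ +-identityʳ (χ (z - c)) ⟩
      χ (z - c)                  ≡⟨ cong χ eq ⟩
      χ (ι (suc k))              ≡⟨ χ-ι k ⟩
      ∑φ (map suc (upTo k)) + ∑φ (map suc (upTo k))
        ≡⟨ cong (λ n → ∑φ (map suc (upTo n)) + ∑φ (map suc (upTo n))) (sym (ℕ.+-identityʳ k)) ⟩
      ∑φ (map suc (upTo (k ℕ.+ 0))) + ∑φ (map suc (upTo (k ℕ.+ 0))) ∎
    signedSum-χ k c (s ∷ ρ) z b (s≤b ∷ dec) b≤k eq = begin
      χ (z - x) - χ (z - (x - 1ℚ)) + S + (φ (ι l) + Γ + (φ (ι l) + Γ))
        ≡⟨ cong₂ (λ m n → m - n + S + (φ (ι l) + Γ + (φ (ι l) + Γ))) (cong χ gap) (trans (cong χ (trans (step z x) (cong (_+ 1ℚ) gap))) (χ-suc (ι l))) ⟩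
      χ (ι l) - (χ (ι l) + (φ (ι l) + φ (ι l))) + S + (φ (ι l) + Γ + (φ (ι l) + Γ))
        ≡⟨ cancel (χ (ι l)) (φ (ι l)) S Γ ⟩
      S + (Γ + Γ)
        ≡⟨ signedSum-χ (suc k) (c - 1ℚ) ρ z s dec (ℕ.m≤n⇒m≤1+n (ℕ.≤-trans s≤b b≤k)) (next-offset z c (suc k) eq) ⟩
      ∑φ (map suc (upTo (suc k ℕ.+ length ρ))) + ∑φ (map suc (upTo (suc k ℕ.+ length ρ)))
        ≡⟨ cong (λ n → ∑φ (map suc (upTo n)) + ∑φ (map suc (upTo n))) (sym (ℕ.+-suc k (length ρ))) ⟩
      ∑φ (map suc (upTo (k ℕ.+ suc (length ρ)))) + ∑φ (map suc (upTo (k ℕ.+ suc (length ρ)))) ∎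
      where
      x = c + ι s
      l = suc (k ℕ.∸ s)
      S = signedSum (c - 1ℚ) (λ y → χ (z - y)) ρ
      Γ = ∑φ (rowGaps (suc k) ρ)
      gap : z - x ≡ ι l
      gap = row-gap z c k s (ℕ.≤-trans s≤b b≤k) eq
      step : ∀ z x → z - (x - 1ℚ) ≡ z - x + 1ℚ
      step = solve-∀ ℚ-ring
      cancel : ∀ h f s g → h - (h + (f + f)) + s + (f + g + (f + g)) ≡ s + (g + g)
      cancel = solve-∀ ℚ-ring

    -- The top row paired with itself gives -φ(0) = 0, and the mixed pairs give twice the sum over
    -- its hooks. The bottom point paired with itself leaves the constant ψ(0).
    pairSum-hooks : ∀ c ρ → Decreasing ρ → pairSum c (λ a b → ψ (a - b)) ρ ≡ ψ 0ℚ + (∑φ (hooks ρ) + ∑φ (hooks ρ))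
    pairSum-hooks c []       _   = trans (cong ψ (+-inverseʳ c)) (sym (+-identityʳ (ψ 0ℚ)))
    pairSum-hooks c (r ∷ rs) dec = begin
      ψ (x - x) - ψ (x - y) + S (λ b → ψ (x - b)) - (ψ (y - x) - ψ (y - y) + S (λ b → ψ (y - b)))
        + S (λ a → ψ (a - x) - ψ (a - y) + S (λ b → ψ (a - b)))
        ≡⟨ cong₂ (λ s t → s + S (λ b → ψ (x - b)) - (t + S (λ b → ψ (y - b))) + S (λ a → ψ (a - x) - ψ (a - y) + S (λ b → ψ (a - b))))
            (cong₂ (λ s t → ψ s - ψ t) (d₁ x) (d₂ x)) (cong₂ (λ s t → ψ s - ψ t) (d₃ x) (d₁ y)) ⟩
      ψ 0ℚ - ψ 1ℚ + S (λ b → ψ (x - b)) - (ψ (- 1ℚ) - ψ 0ℚ + S (λ b → ψ (y - b)))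
        + S (λ a → ψ (a - x) - ψ (a - y) + S (λ b → ψ (a - b)))
        ≡⟨ cong (λ s → ψ 0ℚ - ψ 1ℚ + S (λ b → ψ (x - b)) - (ψ (- 1ℚ) - ψ 0ℚ + S (λ b → ψ (y - b))) + s)
            (trans (signedSum-+ (λ a → ψ (a - x) - ψ (a - y)) (λ a → S (λ b → ψ (a - b))) (c - 1ℚ) rs) (cong₂ _+_ (S-diff (λ a → ψ (a - x)) (λ a → ψ (a - y))) (pairSum-hooks (c - 1ℚ) rs (Decreasing-tail dec)))) ⟩
      ψ 0ℚ - ψ 1ℚ + S (λ b → ψ (x - b)) - (ψ (- 1ℚ) - ψ 0ℚ + S (λ b → ψ (y - b)))
        + (S (λ a → ψ (a - x)) - S (λ a → ψ (a - y)) + (ψ 0ℚ + (Θ + Θ)))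
        ≡⟨ collect (ψ 0ℚ) (ψ 1ℚ) (ψ (- 1ℚ)) _ _ _ _ Θ ⟩
      (S (λ b → ψ (x - b)) - S (λ b → ψ (y - b)) + S (λ a → ψ (a - x)) - S (λ a → ψ (a - y))) - (ψ 1ℚ - (1ℚ + 1ℚ) * ψ 0ℚ + ψ (- 1ℚ)) + (ψ 0ℚ + (Θ + Θ))
        ≡⟨ cong₂ (λ s t → s - t + (ψ 0ℚ + (Θ + Θ))) (sym S-χ) (trans (ψ″ 0ℚ) φ-0) ⟩
      S (λ b → χ (x - b)) - 0ℚ + (ψ 0ℚ + (Θ + Θ))
        ≡⟨ cong (λ s → s - 0ℚ + (ψ 0ℚ + (Θ + Θ))) row ⟩
      ρ′ + ρ′ - 0ℚ + (ψ 0ℚ + (Θ + Θ))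
        ≡⟨ regroup ρ′ (ψ 0ℚ) Θ ⟩
      ψ 0ℚ + (ρ′ + Θ + (ρ′ + Θ))
        ≡⟨ cong (λ s → ψ 0ℚ + (s + s)) (sym (∑-++ (φ ∘ ι) (rowHooks r rs) (hooks rs))) ⟩
      ψ 0ℚ + (∑φ (hooks (r ∷ rs)) + ∑φ (hooks (r ∷ rs))) ∎
      where
      x = c + ι r
      y = x - 1ℚ
      S : (ℚ → ℚ) → ℚ
      S h = signedSum (c - 1ℚ) h rs
      Θ = ∑φ (hooks rs)
      ρ′ = ∑φ (rowHooks r rs)
      Γ = ∑φ (rowGaps r rs)
      d₁ : ∀ x → x - x ≡ 0ℚ
      d₁ = solve-∀ ℚ-ring
      d₂ : ∀ x → x - (x - 1ℚ) ≡ 1ℚ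
      d₂ = solve-∀ ℚ-ring
      d₃ : ∀ x → x - 1ℚ - x ≡ - 1ℚ
      d₃ = solve-∀ ℚ-ring
      d₄ : ∀ x b → x - 1ℚ - b ≡ x - b - 1ℚ
      d₄ = solve-∀ ℚ-ring
      d₅ : ∀ x a → a - x ≡ - (x - a)
      d₅ = solve-∀ ℚ-ring
      d₆ : ∀ x a → a - (x - 1ℚ) ≡ 1ℚ - (x - a)
      d₆ = solve-∀ ℚ-ring
      pad : ∀ a b → a - b ≡ 1ℚ * a + (- 1ℚ) * b
      pad = solve-∀ ℚ-ring
      S-diff : ∀ h k → S (λ a → h a - k a) ≡ S h - S k
      S-diff h k = trans (signedSum-ext (λ a → pad (h a) (k a)) (c - 1ℚ) rs) (trans (signedSum-linear 1ℚ (- 1ℚ) h k (c - 1ℚ) rs) (sym (pad (S h) (S k))))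
      S-χ : S (λ b → χ (x - b)) ≡ S (λ b → ψ (x - b)) - S (λ b → ψ (y - b)) + S (λ a → ψ (a - x)) - S (λ a → ψ (a - y))
      S-χ = begin
        S (λ b → ψ (x - b) - ψ (x - b - 1ℚ) + ψ (- (x - b)) - ψ (1ℚ - (x - b)))
          ≡⟨ signedSum-ext (λ b → cong₂ (λ s t → s - t) (cong₂ (λ s t → ψ (x - b) - ψ s + ψ t) (sym (d₄ x b)) (sym (d₅ x b))) (cong ψ (sym (d₆ x b)))) (c - 1ℚ) rs ⟩
        S (λ b → ψ (x - b) - ψ (y - b) + ψ (b - x) - ψ (b - y))
          ≡⟨ S-diff (λ b → ψ (x - b) - ψ (y - b) + ψ (b - x)) (λ b → ψ (b - y)) ⟩
        S (λ b → ψ (x - b) - ψ (y - b) + ψ (b - x)) - S (λ b → ψ (b - y))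
          ≡⟨ cong (_- S (λ b → ψ (b - y))) (trans (signedSum-+ (λ b → ψ (x - b) - ψ (y - b)) (λ b → ψ (b - x)) (c - 1ℚ) rs) (cong (_+ S (λ b → ψ (b - x))) (S-diff (λ b → ψ (x - b)) (λ b → ψ (y - b))))) ⟩
        S (λ b → ψ (x - b)) - S (λ b → ψ (y - b)) + S (λ a → ψ (a - x)) - S (λ a → ψ (a - y)) ∎
      collect : ∀ z o m a b d e θ → z - o + a - (m - z + b) + (d - e + (z + (θ + θ))) ≡ a - b + d - e - (o - (1ℚ + 1ℚ) * z + m) + (z + (θ + θ))
      collect = solve-∀ ℚ-ring
      regroup : ∀ r z t → r + r - 0ℚ + (z + (t + t)) ≡ z + (r + t + (r + t))
      regroup = solve-∀ ℚ-ring
      isolate : ∀ s g r → s + (g + g) ≡ r + g + (r + g) → s ≡ r + r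
      isolate s g r eq = trans (undo s g) (trans (cong (_- (g + g)) eq) (redo r g))
        where
        undo : ∀ s g → s ≡ s + (g + g) - (g + g)
        undo = solve-∀ ℚ-ring
        redo : ∀ r g → r + g + (r + g) - (g + g) ≡ r + r
        redo = solve-∀ ℚ-ring
      row : S (λ b → χ (x - b)) ≡ ρ′ + ρ′
      -- The interval found in `signedSum-χ` consists of the hooks of the row and its gaps; the gaps
      -- occur on both sides and are subtracted.
      row = isolate (S (λ b → χ (x - b))) Γ ρ′ (trans (signedSum-χ r (c - 1ℚ) rs x r dec ℕ.≤-refl (row-offset c r))
        (cong (λ s → s + s) (sym (trans (sym (∑-++ (φ ∘ ι) (rowHooks r rs) (rowGaps r rs))) (∑-↭ (φ ∘ ι) (hooks-gaps r rs dec))))))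

  -- The weight of hook power sums and of their quotients by H

  OnDecreasing-⊠ : ∀ {d e F F′} → OnDecreasing d F → OnDecreasing e F′ → OnDecreasing (d ℕ.+ e) (λ ρ → F ρ * F′ ρ)
  OnDecreasing-⊠ (a , wa , eq) (b , wb , eq′) = _ , wa ⊠ wb , λ ρ dec → cong₂ _*_ (eq ρ dec) (eq′ ρ dec)

  ι-^ : ∀ m k → ι (m ℕ.^ k) ≡ ι m ^ k
  ι-^ m zero    = ι-1
  ι-^ m (suc k) = trans (ι-* m (m ℕ.^ k)) (cong (ι m *_) (ι-^ m k))

  ι-sum-map : ∀ {A : Set} (g : A → ℕ) xs → ι (sum (map g xs)) ≡ ∑ xs (ι ∘ g)
  ι-sum-map g []       = ι-0
  ι-sum-map g (x ∷ xs) = trans (ι-+ (g x) (sum (map g xs))) (cong (ι (g x) +_) (ι-sum-map g xs))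

  ^-even : ∀ x a → (- x) ^ (2 ℕ.* a) ≡ x ^ (2 ℕ.* a)
  ^-even x a = trans (sym (^-assocʳ (- x) 2 a)) (trans (cong (_^ a) (square x)) (^-assocʳ x 2 a))
    where
    square : ∀ x → - x * (- x * 1ℚ) ≡ x * (x * 1ℚ)
    square = solve-∀ ℚ-ring

  hookPower : ℕ → Partition → ℕ
  hookPower a ρ = sum (map (λ c → hook ρ c ℕ.^ (2 ℕ.* a)) (cells ρ))

  hookPower-∑ : ∀ a ρ → Decreasing ρ → ι (hookPower a ρ) ≡ ∑ (hooks ρ) (λ h → ι h ^ (2 ℕ.* a))
  hookPower-∑ a ρ dec = begin
    ι (hookPower a ρ)                                       ≡⟨ ι-sum-map (λ c → hook ρ c ℕ.^ (2 ℕ.* a)) (cells ρ) ⟩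
    ∑ (cells ρ) (λ c → ι (hook ρ c ℕ.^ (2 ℕ.* a)))          ≡⟨ ∑-cong (λ c → ι-^ (hook ρ c) (2 ℕ.* a)) (cells ρ) ⟩
    ∑ (cells ρ) (λ c → ι (hook ρ c) ^ (2 ℕ.* a))            ≡⟨ sym (∑-map (λ h → ι h ^ (2 ℕ.* a)) (hook ρ) (cells ρ)) ⟩
    ∑ (map (hook ρ) (cells ρ)) (λ h → ι h ^ (2 ℕ.* a))      ≡⟨ cong (λ hs → ∑ hs (λ h → ι h ^ (2 ℕ.* a))) (map-hook-cells ρ dec) ⟩
    ∑ (hooks ρ) (λ h → ι h ^ (2 ℕ.* a))                     ∎

  -- The exponent 2 (a + 1) is even and positive, as `HookSum` requires of φ: φ(0) = 0 holds because
  -- the power has a factor 0. The antidifference raises the degree by 2, and ψ(0) only changes a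
  -- constant.
  hookPower-weight : ∀ a → OnDecreasing (2 ℕ.* suc a ℕ.+ 2) (λ ρ → ι (hookPower (suc a) ρ))
  hookPower-weight a =
    let ψ , P , ψ″ = second-antidifference (2 ℕ.* suc a) 0
        hook-sum = HookSum.pairSum-hooks {ψ} {_^ (2 ℕ.* suc a)} (λ x → trans (ψ″ x) (*-identityʳ (x ^ (2 ℕ.* suc a))))
          (λ x → ^-even x (suc a)) (*-zeroˡ (0ℚ ^ (a ℕ.+ suc (a ℕ.+ 0))))
    in OnDecreasing-ext (λ ρ dec → trans (hookPower-∑ (suc a) ρ dec) (halve (ψ 0ℚ) _ _ (hook-sum 0ℚ ρ dec)))
         (OnDecreasing-* (const (inv (1ℚ + 1ℚ))) (OnDecreasing-+ (pairSum-weight P) (_ , raise ℕ.z≤n (const (- ψ 0ℚ)) , λ _ _ → refl)))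
    where
    halve : ∀ z s t → t ≡ z + (s + s) → s ≡ inv (1ℚ + 1ℚ) * (t + - z)
    halve z s t eq = trans (expand z s) (cong (λ t → inv (1ℚ + 1ℚ) * (t + - z)) (sym eq))
      where
      -- `inv (1ℚ + 1ℚ)` is a closed term with value one half, so it acts as a coefficient in this
      -- identity.
      expand : ∀ z s → s ≡ inv (1ℚ + 1ℚ) * (z + (s + s) + - z)
      expand = solve-∀ ℚ-ring

  pHook-weight : ∀ {ν} → AllPositive ν → OnDecreasing ((sum ν ℕ.+ length ν) ℕ.* 2) (λ ρ → ι (pHook ν ρ))
  pHook-weight []                            = _ , const (ι 1) , λ _ _ → refl
  pHook-weight (_∷_ {suc a} {ν} _ pos) =
    subst (λ d → OnDecreasing d (λ ρ → ι (pHook (suc a ∷ ν) ρ))) (degree (suc a) (sum ν) (length ν))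
      (OnDecreasing-ext (λ ρ _ → ι-* (hookPower (suc a) ρ) (pHook ν ρ)) (OnDecreasing-⊠ (hookPower-weight a) (pHook-weight pos)))
    where
    degree : ∀ a s l → 2 ℕ.* a ℕ.+ 2 ℕ.+ (s ℕ.+ l) ℕ.* 2 ≡ (a ℕ.+ s ℕ.+ suc l) ℕ.* 2
    degree = ℕ-solve-∀

  H-G : ∀ ρ → Decreasing ρ → ι (H ρ) * G 0ℚ ρ ≡ 1ℚ
  H-G ρ dec = trans (cong (λ hs → ι (product hs) * G 0ℚ ρ) (map-hook-cells ρ dec)) (hooks-G 0ℚ ρ dec)

  -- An inverse of h excludes h = 0, so the default value of `_÷_` never appears.
  ÷-unique : ∀ a h g → ι h * g ≡ 1ℚ → a ÷ h ≡ ι a * g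
  ÷-unique a zero    g eq with trans (sym eq) (trans (cong (_* g) ι-0) (*-zeroˡ g))
  ... | ()
  ÷-unique a (suc h) g eq = *-cancelˡ (ι-suc≢0 h) (begin
    ι (suc h) * (a ÷ suc h)      ≡⟨ ÷-cancel a (suc h) ⟩
    ι a                          ≡⟨ sym (*-identityʳ (ι a)) ⟩
    ι a * 1ℚ                     ≡⟨ cong (ι a *_) (sym eq) ⟩
    ι a * (ι (suc h) * g)        ≡⟨ swap (ι a) (ι (suc h)) g ⟩
    ι (suc h) * (ι a * g)        ∎)
    where
    swap : ∀ a b c → a * (b * c) ≡ b * (a * c)
    swap = solve-∀ ℚ-ring

  gOverH-G : ∀ ν ρ → Decreasing ρ → gOverH ν ρ ≡ ι (pHook ν ρ) * G 0ℚ ρ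
  gOverH-G ν ρ dec = ÷-unique (pHook ν ρ) (H ρ) (G 0ℚ ρ) (H-G ρ dec)

  gOverH-HookDegree : ∀ ν → AllPositive ν → HookDegree ((sum ν ℕ.+ length ν) ℕ.* 2) (gOverH ν)
  gOverH-HookDegree ν pos =
    let a , wa , eq = pHook-weight pos in
    a , wa , λ ρ isP → trans (gOverH-G ν ρ (proj₁ isP)) (cong (_* G 0ℚ ρ) (eq ρ (proj₁ isP)))

  -- Skew sums as sums over chains

  ∑-vanish : ∀ {A : Set} (F : A → ℚ) xs → (∀ x → F x ≡ 0ℚ) → ∑ xs F ≡ 0ℚ
  ∑-vanish F xs eq = trans (∑-cong eq xs) (∑-zero xs)

  -- partsB lists every partition of m with parts at most b exactly once.
  ∑-partsB : ∀ fu m b x (Q : Partition → ℚ) → m ℕ.≤ fu → IsPartition x → size x ≡ m → rowLen x 0 ℕ.≤ b →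
    (∀ y → y ≢ x → Q y ≡ 0ℚ) → ∑ (partsB fu m b) Q ≡ Q x
  ∑-partsB fu zero b []       Q _ _ _ _ _ = +-identityʳ (Q [])
  ∑-partsB fu zero b (suc k ∷ xs) Q _ _ () _ _
  ∑-partsB fu zero b (zero ∷ xs) Q _ (_ , () ∷ _) _ _ _
  ∑-partsB (suc fu) (suc m) b []            Q _ _ () _ _
  ∑-partsB (suc fu) (suc m) b (zero ∷ xs)   Q _ (_ , () ∷ _) _ _ _
  ∑-partsB (suc fu) (suc m) b (suc k ∷ xs)  Q (ℕ.s≤s m≤fu) (dec , _ ∷ pos) sz k<b supp = begin
    ∑ (partsB (suc fu) (suc m) b) Q
      ≡⟨ ∑-concat-map Q rows (filter fits (upTo (suc m))) ⟩
    ∑ (filter fits (upTo (suc m))) (λ j → ∑ (rows j) Q)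
      ≡⟨ ∑-filter fits (λ j → ∑ (rows j) Q) (upTo (suc m)) ⟩
    ∑ (upTo (suc m)) (λ j → indicator (fits j) * ∑ (rows j) Q)
      ≡⟨ ∑-upTo-single (λ j → indicator (fits j) * ∑ (rows j) Q) k<1+m other ⟩
    indicator (fits k) * ∑ (rows k) Q
      ≡⟨ cong₂ _*_ (indicator-yes (fits k) (ℕ.⊓-glb k<1+m k<b)) (trans (∑-map Q (suc k ∷_) (partsB fu (m ℕ.∸ k) (suc k))) recurse) ⟩
    1ℚ * Q (suc k ∷ xs)
      ≡⟨ *-identityˡ (Q (suc k ∷ xs)) ⟩
    Q (suc k ∷ xs) ∎
    where
    fits : ∀ j → Dec (suc j ℕ.≤ suc m ℕ.⊓ b)
    fits j = suc j ℕ.≤? suc m ℕ.⊓ b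
    rows : ℕ → List Partition
    rows j = map (suc j ∷_) (partsB fu (suc m ℕ.∸ suc j) (suc j))
    k+xs : k ℕ.+ size xs ≡ m
    k+xs = ℕ.suc-injective sz
    k<1+m : k ℕ.< suc m
    k<1+m = ℕ.s≤s (subst (k ℕ.≤_) k+xs (ℕ.m≤m+n k (size xs)))
    other : ∀ j → j ≢ k → indicator (fits j) * ∑ (rows j) Q ≡ 0ℚ
    other j j≢k = trans (cong (indicator (fits j) *_) (trans (∑-map Q (suc j ∷_) (partsB fu (m ℕ.∸ j) (suc j)))
      (∑-vanish (Q ∘ (suc j ∷_)) (partsB fu (m ℕ.∸ j) (suc j)) (λ ys → supp (suc j ∷ ys) (λ eq → j≢k (ℕ.suc-injective (∷-injectiveˡ eq)))))))
      (*-zeroʳ (indicator (fits j)))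
    recurse : ∑ (partsB fu (m ℕ.∸ k) (suc k)) (Q ∘ (suc k ∷_)) ≡ Q (suc k ∷ xs)
    recurse = ∑-partsB fu (m ℕ.∸ k) (suc k) xs (Q ∘ (suc k ∷_)) (ℕ.≤-trans (ℕ.m∸n≤m m k) m≤fu) (Decreasing-tail dec , pos)
      (trans (sym (ℕ.m+n∸m≡n k (size xs))) (cong (ℕ._∸ k) k+xs)) (rowLen-bound (suc k) xs 0 dec)
      (λ y y≢xs → supp (suc k ∷ y) (λ eq → y≢xs (∷-injectiveʳ eq)))

  size-partsB : ∀ fu m b → All (λ y → size y ≡ m) (partsB fu m b)
  size-partsB fu       zero    b = refl ∷ []
  size-partsB zero     (suc m) b = []
  size-partsB (suc fu) (suc m) b = All.concat⁺ (All.map⁺ (All.filter⁺ (λ k → suc k ℕ.≤? suc m ℕ.⊓ b)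
    (All.map (λ { {k} (ℕ.s≤s k≤m) → All.map⁺ (All.map (λ {y} eq → cong suc (trans (cong (k ℕ.+_) eq) (ℕ.m+[n∸m]≡n k≤m))) (size-partsB fu (m ℕ.∸ k) (suc k))) }) (All.all-upTo (suc m)))))

  EndsAbove : ℕ → Partition → Partition → Set
  EndsAbove n μ ρ = IsPartition ρ × size ρ ≡ size μ ℕ.+ n × (∀ i → rowLen μ i ℕ.≤ rowLen ρ i)

  chainEnds-above : ∀ n μ → IsPartition μ → All (EndsAbove n μ) (chainEnds n μ)
  chainEnds-above zero    μ isP = (isP , sym (ℕ.+-identityʳ (size μ)) , λ i → ℕ.≤-refl) ∷ []
  chainEnds-above (suc n) μ isP@(dec , pos) = All.concat⁺ (All.map⁺ (All-addBox μ (λ i add →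
    All.map (λ { (isP′ , sz , le) → isP′ , trans sz (trans (cong (ℕ._+ n) (size-incrRow μ i)) (sym (ℕ.+-suc (size μ) n))) , λ j → ℕ.≤-trans (rowLen-incrRow μ i j) (le j) })
      (chainEnds-above n (incrRow μ i) (incrRow-Decreasing μ i dec add , incrRow-AllPositive μ i pos)))))

  containsᵇ-complete : ∀ μ ρ → (∀ i → rowLen μ i ℕ.≤ rowLen ρ i) → T (containsᵇ μ ρ)
  containsᵇ-complete μ ρ le = go (upTo (length μ))
    where
    go : ∀ is → T (and (map (λ i → rowLen μ i ℕ.≤ᵇ rowLen ρ i) is))
    go []       = _
    go (i ∷ is) with rowLen μ i ℕ.≤ᵇ rowLen ρ i | ℕ.≤⇒≤ᵇ (le i)
    ... | true | _ = go is

  -- `f` counts the chains with a given end. After the two sums are exchanged, each chain end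
  -- selects exactly one listed shape, and that shape contains μ.
  skewSum-chains : ∀ μ n (F : Partition → ℚ) → IsPartition μ → skewSum μ n F ≡ ∑ (chainEnds n μ) F
  skewSum-chains μ n F isP = begin
    ∑ (filter above parts) (λ σ → fromℕ (f σ μ) * F σ)
      ≡⟨ ∑-filter above (λ σ → fromℕ (f σ μ) * F σ) parts ⟩
    ∑ parts (λ σ → indicator (above σ) * (fromℕ (f σ μ) * F σ))
      ≡⟨ ∑-cong-All (All.map (λ {σ} → expand σ) (size-partsB N N N)) ⟩
    ∑ parts (λ σ → ∑ (chainEnds n μ) (λ ρ → hit ρ σ))
      ≡⟨ ∑-swap (λ σ ρ → hit ρ σ) parts (chainEnds n μ) ⟩
    ∑ (chainEnds n μ) (λ ρ → ∑ parts (hit ρ))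
      ≡⟨ ∑-cong-All (All.map (λ {ρ} → select ρ) (chainEnds-above n μ isP)) ⟩
    ∑ (chainEnds n μ) F ∎
    where
    N = size μ ℕ.+ n
    parts = partitionsOf N
    above : ∀ σ → Dec (T (containsᵇ μ σ))
    above σ = T? (containsᵇ μ σ)
    hit : Partition → Partition → ℚ
    hit ρ σ = indicator (above σ) * F σ * indicator (ρ ≟P σ)
    regroup : ∀ a b c → a * (b * c) ≡ a * c * b
    regroup = solve-∀ ℚ-ring
    -- `f` takes its chain length from the sizes; for the shapes listed it equals `n`.
    expand : ∀ σ → size σ ≡ N → indicator (above σ) * (fromℕ (f σ μ) * F σ) ≡ ∑ (chainEnds n μ) (λ ρ → hit ρ σ)
    expand σ sz = begin
      indicator (above σ) * (fromℕ (f σ μ) * F σ)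
        ≡⟨ cong (λ k → indicator (above σ) * (k * F σ)) (trans (ι-fromℕ (f σ μ)) (cong (λ k → ι (length (filter (λ ρ → ρ ≟P σ) (chainEnds k μ)))) (trans (cong (ℕ._∸ size μ) sz) (ℕ.m+n∸m≡n (size μ) n)))) ⟩
      indicator (above σ) * (ι (length (filter (λ ρ → ρ ≟P σ) (chainEnds n μ))) * F σ)
        ≡⟨ cong (λ k → indicator (above σ) * (k * F σ)) (ι-length-filter (λ ρ → ρ ≟P σ) (chainEnds n μ)) ⟩
      indicator (above σ) * (∑ (chainEnds n μ) (λ ρ → indicator (ρ ≟P σ)) * F σ)
        ≡⟨ regroup (indicator (above σ)) (∑ (chainEnds n μ) (λ ρ → indicator (ρ ≟P σ))) (F σ) ⟩
      indicator (above σ) * F σ * ∑ (chainEnds n μ) (λ ρ → indicator (ρ ≟P σ))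
        ≡⟨ sym (∑-distribˡ-* (indicator (above σ) * F σ) (λ ρ → indicator (ρ ≟P σ)) (chainEnds n μ)) ⟩
      ∑ (chainEnds n μ) (λ ρ → hit ρ σ) ∎
    select : ∀ ρ → EndsAbove n μ ρ → ∑ parts (hit ρ) ≡ F ρ
    select ρ (isPρ , sz , le) = begin
      ∑ parts (hit ρ)
        ≡⟨ ∑-partsB N N N ρ (hit ρ) ℕ.≤-refl isPρ sz (subst (rowLen ρ 0 ℕ.≤_) sz (rowLen≤size ρ))
            (λ σ σ≢ρ → trans (cong (indicator (above σ) * F σ *_) (indicator-no (ρ ≟P σ) (σ≢ρ ∘ sym))) (*-zeroʳ (indicator (above σ) * F σ))) ⟩
      indicator (above ρ) * F ρ * indicator (ρ ≟P ρ)
        ≡⟨ cong₂ (λ a b → a * F ρ * b) (indicator-yes (above ρ) (containsᵇ-complete μ ρ le)) (indicator-yes (ρ ≟P ρ) refl) ⟩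
      1ℚ * F ρ * 1ℚ
        ≡⟨ simplify (F ρ) ⟩
      F ρ ∎
      where
      simplify : ∀ a → 1ℚ * a * 1ℚ ≡ a
      simplify = solve-∀ ℚ-ring
      rowLen≤size : ∀ ρ → rowLen ρ 0 ℕ.≤ size ρ
      rowLen≤size []       = ℕ.z≤n
      rowLen≤size (r ∷ rs) = ℕ.m≤m+n r (size rs)

  -- The hook length formula

  decrRow : Partition → ℕ → Partition
  decrRow []                 _       = []
  decrRow (r ∷ rs)           (suc i) = r ∷ decrRow rs i
  decrRow (zero ∷ rs)        zero    = zero ∷ rs
  decrRow (suc zero ∷ rs)    zero    = rs
  decrRow (suc (suc r) ∷ rs) zero    = suc r ∷ rs

  Removable : Partition → ℕ → Set
  Removable ρ i = rowLen ρ (suc i) ℕ.< rowLen ρ i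

  removable? : ∀ ρ i → Dec (Removable ρ i)
  removable? ρ i = rowLen ρ (suc i) ℕ.<? rowLen ρ i

  addable-tail : ∀ r rs i → T (addableᵇ (r ∷ rs) (suc i)) → T (addableᵇ rs i)
  addable-tail r rs zero    _   = _
  addable-tail r rs (suc i) add = add

  -- A row that loses its only box must be the last: removability leaves length 0 for the next row,
  -- which positivity excludes.
  no-rows : ∀ {r rs} → AllPositive (r ∷ rs) → rowLen rs 0 ℕ.≤ 0 → rs ≡ []
  no-rows {rs = []}    _             _  = refl
  no-rows {rs = s ∷ _} (_ ∷ 0<s ∷ _) le = contradiction 0<s (ℕ.≤⇒≯ le)

  decrRow-incrRow : ∀ ρ i → AllPositive ρ → T (addableᵇ ρ i) → decrRow (incrRow ρ i) i ≡ ρ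
  decrRow-incrRow []           zero    _         _   = refl
  decrRow-incrRow (suc r ∷ rs) zero    _         _   = refl
  decrRow-incrRow (zero ∷ rs)  zero    (() ∷ _)  _
  decrRow-incrRow (r ∷ rs)     (suc i) (_ ∷ pos) add = cong (r ∷_) (decrRow-incrRow rs i pos (addable-tail r rs i add))

  removable-incrRow : ∀ ρ i → Decreasing ρ → T (addableᵇ ρ i) → Removable (incrRow ρ i) i
  removable-incrRow []       zero    _   _   = ℕ.s≤s ℕ.z≤n
  removable-incrRow (r ∷ rs) zero    dec _   = ℕ.s≤s (rowLen-bound r rs 0 dec)
  removable-incrRow (r ∷ rs) (suc i) dec add = removable-incrRow rs i (Decreasing-tail dec) (addable-tail r rs i add)

  incrRow-decrRow : ∀ ρ i → AllPositive ρ → Removable ρ i → incrRow (decrRow ρ i) i ≡ ρ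
  incrRow-decrRow (suc zero ∷ rs)    zero    pos       (ℕ.s≤s le) with no-rows pos le
  ... | refl = refl
  incrRow-decrRow (suc (suc r) ∷ rs) zero    pos       rem = refl
  incrRow-decrRow (r ∷ rs)           (suc i) (_ ∷ pos) rem = cong (r ∷_) (incrRow-decrRow rs i pos rem)

  addable-decrRow : ∀ ρ i → IsPartition ρ → Removable ρ i → T (addableᵇ (decrRow ρ i) i)
  addable-decrRow ρ zero _ _ = _
  addable-decrRow (r ∷ rs) (suc zero) (dec , _ ∷ pos) rem = ℕ.<⇒<ᵇ (first-row r rs dec pos rem)
    where
    first-row : ∀ r rs → Decreasing (r ∷ rs) → AllPositive rs → Removable rs 0 → rowLen (decrRow rs 0) 0 ℕ.< r
    first-row r (suc zero ∷ rs)    (s≤r ∷ _) pos (ℕ.s≤s le) with no-rows pos le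
    ... | refl = s≤r
    first-row r (suc (suc s) ∷ rs) (s≤r ∷ _) _   _          = s≤r
  addable-decrRow (r ∷ rs) (suc (suc i)) (dec , _ ∷ pos) rem = addable-decrRow rs (suc i) (Decreasing-tail dec , pos) rem

  Decreasing-cons : ∀ {r rs} → rowLen rs 0 ℕ.≤ r → Decreasing rs → Decreasing (r ∷ rs)
  Decreasing-cons {r} {[]}     _  _   = [ r ]
  Decreasing-cons {r} {s ∷ rs} le dec = le ∷ dec

  decrRow-IsPartition : ∀ ρ i → IsPartition ρ → Removable ρ i → IsPartition (decrRow ρ i)
  decrRow-IsPartition (suc zero ∷ rs)    zero    (dec , _ ∷ pos) rem        = Decreasing-tail dec , pos
  decrRow-IsPartition (suc (suc r) ∷ rs) zero    (dec , _ ∷ pos) (ℕ.s≤s le) = Decreasing-cons le (Decreasing-tail dec) , ℕ.s≤s ℕ.z≤n ∷ pos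
  decrRow-IsPartition (r ∷ rs)           (suc i) (dec , 0<r ∷ pos) rem with decrRow-IsPartition rs i (Decreasing-tail dec , pos) rem
  ... | dec′ , pos′ =
    -- Putting the box back recovers `rs`, so the lowered first row is at most the first row of
    -- `rs`, hence at most r.
    (Decreasing-cons (ℕ.≤-trans (subst (λ σ → rowLen (decrRow rs i) 0 ℕ.≤ rowLen σ 0) (incrRow-decrRow rs i pos rem) (rowLen-incrRow (decrRow rs i) i 0)) (rowLen-bound r rs 0 dec)) dec′ , 0<r ∷ pos′)

  -- decrRow deletes an exhausted row; lowerRow keeps it, so that the number of points stays fixed.
  lowerRow : Partition → ℕ → Partition
  lowerRow []       _       = []
  lowerRow (r ∷ rs) zero    = ℕ.pred r ∷ rs
  lowerRow (r ∷ rs) (suc i) = r ∷ lowerRow rs i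

  -- An empty last row replaces the bottom point c by c and c - 1; the additional factor n + 1
  -- cancels against the larger factorial. This is why `decrRow` and `lowerRow` are interchangeable
  -- in `G`.
  rowFactor-zero-row : ∀ n c z → z - c ≡ ι n → rowFactor n c (0 ∷ []) z ≡ rowFactor n c [] z
  rowFactor-zero-row n c z eq = begin
    (z - (c + ι 0)) * ((z - (c - 1ℚ)) * inv (ι (suc n ℕ.!)))
      ≡⟨ cong₂ (λ s t → (z - s) * t) (trans (cong (c +_) ι-0) (+-identityʳ c)) (trans (cong (_* inv (ι (suc n ℕ.!))) (next-offset z c n eq)) (ι-suc-inv-! n)) ⟩
    (z - c) * inv (ι (n ℕ.!))                                  ∎

  rowFactor-decrRow : ∀ n c ρ z i → AllPositive ρ → Removable ρ i → z - c ≡ ι n → rowFactor n c (decrRow ρ i) z ≡ rowFactor n c (lowerRow ρ i) z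
  rowFactor-decrRow n c (suc zero ∷ rs)    z zero    pos (ℕ.s≤s le) eq with no-rows pos le
  ... | refl = sym (rowFactor-zero-row n c z eq)
  rowFactor-decrRow n c (suc (suc r) ∷ rs) z zero    pos rem eq = refl
  rowFactor-decrRow n c (r ∷ rs)           z (suc i) (_ ∷ pos) rem eq =
    cong ((z - (c + ι r)) *_) (rowFactor-decrRow (suc n) (c - 1ℚ) rs z i pos rem (next-offset z c n eq))

  G-decrRow : ∀ c ρ i → AllPositive ρ → Removable ρ i → G c (decrRow ρ i) ≡ G c (lowerRow ρ i)
  G-decrRow c (suc zero ∷ rs)    zero    pos (ℕ.s≤s le) with no-rows pos le
  ... | refl = sym (trans (*-identityˡ _) (trans (cong (_* inv (ι 1)) (row-offset c 0)) (inv-cancel (ι-suc≢0 0))))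
  G-decrRow c (suc (suc r) ∷ rs) zero    pos rem = refl
  G-decrRow c (r ∷ rs)           (suc i) (_ ∷ pos) rem =
    (cong₂ _*_ (G-decrRow (c - 1ℚ) rs i pos rem) (rowFactor-decrRow (suc r) (c - 1ℚ) rs (c + ι r) i pos rem (row-offset c r)))

  -- Shortening a row that is as long as the next one puts its point on the point of the next row.
  -- The last row of a partition is always removable.
  G-not-removable : ∀ c ρ i → i ℕ.< length ρ → IsPartition ρ → ¬ Removable ρ i → G c (lowerRow ρ i) ≡ 0ℚ
  G-not-removable c (r ∷ rs) (suc i) (ℕ.s≤s i<n) (dec , _ ∷ pos) ¬rem =
    trans (cong (_* rowFactor (suc r) (c - 1ℚ) (lowerRow rs i) (c + ι r)) (G-not-removable (c - 1ℚ) rs i i<n (Decreasing-tail dec , pos) ¬rem)) (*-zeroˡ (rowFactor (suc r) (c - 1ℚ) (lowerRow rs i) (c + ι r)))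
  G-not-removable c (r ∷ [])     zero _ (_ , 0<r ∷ _) ¬rem = contradiction 0<r ¬rem
  G-not-removable c (suc r ∷ s ∷ rs) zero _ (s≤r ∷ _ , _) ¬rem with ℕ.≤-antisym s≤r (ℕ.≮⇒≥ ¬rem)
  ... | refl = trans (cong (G (c - 1ℚ) (suc r ∷ rs) *_) (trans (cong (λ y → (c + ι r - y) * F) (shift-row c r)) (kill (c + ι r) F))) (*-zeroʳ (G (c - 1ℚ) (suc r ∷ rs)))
    where
    F = rowFactor (suc (suc r)) (c - 1ℚ - 1ℚ) rs (c + ι r)
    kill : ∀ x f → (x - x) * f ≡ 0ℚ
    kill = solve-∀ ℚ-ring
  G-not-removable c (zero ∷ s ∷ rs) zero _ (_ , () ∷ _) ¬rem

  -- These play the part of the inner points when a box is removed: as the point of a row moves from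
  -- z to z - 1, a factor z - x becomes z - (x + 1).
  raised : ℚ → Partition → List ℚ
  raised c ρ = map (_+ 1ℚ) (outer c ρ)

  rowFactor-lowerRow : ∀ n c ρ z {i} → i ℕ.< length ρ → AllPositive ρ →
    rowFactor n c (lowerRow ρ i) z * (z - ξ c ρ i) ≡ rowFactor n c ρ z * (z - ξ c ρ i + 1ℚ)
  rowFactor-lowerRow n c (suc r ∷ rs) z {zero} _ _ =
    trans (cong (λ y → (z - (c + ι r)) * F * (z - y)) (grow-row c r)) (trans (shuffle z (c + ι r) F) (cong (λ y → (z - y) * F * (z - y + 1ℚ)) (sym (grow-row c r))))
    where
    F = rowFactor (suc n) (c - 1ℚ) rs z
    shuffle : ∀ z x f → (z - x) * f * (z - (x + 1ℚ)) ≡ (z - (x + 1ℚ)) * f * (z - (x + 1ℚ) + 1ℚ)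
    shuffle = solve-∀ ℚ-ring
  rowFactor-lowerRow n c (zero ∷ rs) z {zero} _ (() ∷ _)
  rowFactor-lowerRow n c (r ∷ rs) z {suc i} (ℕ.s≤s i<n) (_ ∷ pos) = begin
    (z - (c + ι r)) * rowFactor (suc n) (c - 1ℚ) (lowerRow rs i) z * (z - ξ (c - 1ℚ) rs i)     ≡⟨ *-assoc (z - (c + ι r)) _ _ ⟩
    (z - (c + ι r)) * (rowFactor (suc n) (c - 1ℚ) (lowerRow rs i) z * (z - ξ (c - 1ℚ) rs i))
      ≡⟨ cong ((z - (c + ι r)) *_) (rowFactor-lowerRow (suc n) (c - 1ℚ) rs z i<n pos) ⟩
    (z - (c + ι r)) * (rowFactor (suc n) (c - 1ℚ) rs z * (z - ξ (c - 1ℚ) rs i + 1ℚ))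
      ≡⟨ sym (*-assoc (z - (c + ι r)) _ _) ⟩
    (z - (c + ι r)) * rowFactor (suc n) (c - 1ℚ) rs z * (z - ξ (c - 1ℚ) rs i + 1ℚ)             ∎

  row-end : ∀ c l → c - 1ℚ - ι l ≡ c - ι (suc l)
  row-end c l = trans (regroup c (ι l)) (cong (λ s → c - s) (sym (ι-suc l)))
    where
    regroup : ∀ c l → c - 1ℚ - l ≡ c - (1ℚ + l)
    regroup = solve-∀ ℚ-ring

  -- The factor z + 1 - (c - length) equals n + 1 + length and turns the larger factorial into the
  -- smaller one; the other two products exchange the differences at z + 1 for those at z.
  rowFactor-pred : ∀ n c ρ z → z - c ≡ ι n → All ((z + 1ℚ) #_) (outer c ρ) →
    rowFactor n c ρ z ≡ rowFactor (suc n) c ρ (z + 1ℚ) * ((z + 1ℚ - (c - ι (length ρ))) * ∏-diff (z + 1ℚ) (raised c ρ) * ∏-inv (z + 1ℚ) (outer c ρ))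
  rowFactor-pred n c [] z eq (z#c ∷ []) = begin
    (z - c) * inv (ι (n ℕ.!))                                   ≡⟨ cong ((z - c) *_) (sym (ι-suc-inv-! n)) ⟩
    (z - c) * (ι (suc n) * i)
      ≡⟨ cong (λ s → (z - c) * (s * i)) (sym (trans (shift-z z c) (next-offset z c n eq))) ⟩
    (z - c) * (w * i)                                           ≡⟨ pad (z - c) w i ⟩
    (z - c) * (w * i) * 1ℚ                                      ≡⟨ cong ((z - c) * (w * i) *_) (sym (inv-cancel z#c)) ⟩
    (z - c) * (w * i) * (w * inv w)                             ≡⟨ shuffle z c i (inv w) ⟩
    w * i * ((z + 1ℚ - (c - 0ℚ)) * ((z + 1ℚ - (c + 1ℚ)) * 1ℚ) * (inv w * 1ℚ))
      ≡⟨ cong (λ s → w * i * ((z + 1ℚ - (c - s)) * ((z + 1ℚ - (c + 1ℚ)) * 1ℚ) * (inv w * 1ℚ))) (sym ι-0) ⟩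
    w * i * ((z + 1ℚ - (c - ι 0)) * ((z + 1ℚ - (c + 1ℚ)) * 1ℚ) * (inv w * 1ℚ)) ∎
    where
    w = z + 1ℚ - c
    i = inv (ι (suc n ℕ.!))
    shift-z : ∀ z c → z + 1ℚ - c ≡ z - (c - 1ℚ)
    shift-z = solve-∀ ℚ-ring
    pad : ∀ a b d → a * (b * d) ≡ a * (b * d) * 1ℚ
    pad = solve-∀ ℚ-ring
    shuffle : ∀ z c i k → (z - c) * ((z + 1ℚ - c) * i) * ((z + 1ℚ - c) * k)
      ≡ (z + 1ℚ - c) * i * ((z + 1ℚ - (c - 0ℚ)) * ((z + 1ℚ - (c + 1ℚ)) * 1ℚ) * (k * 1ℚ))
    shuffle = solve-∀ ℚ-ring
  rowFactor-pred n c (r ∷ rs) z eq (z#x ∷ z#xs) = begin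
    (z - x) * rowFactor (suc n) (c - 1ℚ) rs z
      ≡⟨ cong ((z - x) *_) (rowFactor-pred (suc n) (c - 1ℚ) rs z (next-offset z c n eq) z#xs) ⟩
    (z - x) * (F * ((z + 1ℚ - (c - 1ℚ - ι (length rs))) * π * κ))
      ≡⟨ cong (λ e → (z - x) * (F * ((z + 1ℚ - e) * π * κ))) (row-end c (length rs)) ⟩
    (z - x) * (F * ((z + 1ℚ - e) * π * κ))
      ≡⟨ pad (z - x) (F * ((z + 1ℚ - e) * π * κ)) ⟩
    1ℚ * ((z - x) * (F * ((z + 1ℚ - e) * π * κ)))
      ≡⟨ cong (_* ((z - x) * (F * ((z + 1ℚ - e) * π * κ)))) (sym (inv-cancel z#x)) ⟩
    w * inv w * ((z - x) * (F * ((z + 1ℚ - e) * π * κ)))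
      ≡⟨ shuffle z x (inv w) F (z + 1ℚ - e) π κ ⟩
    w * F * ((z + 1ℚ - e) * ((z + 1ℚ - (x + 1ℚ)) * π) * (inv w * κ)) ∎
    where
    x = c + ι r
    w = z + 1ℚ - x
    e = c - ι (suc (length rs))
    F = rowFactor (suc (suc n)) (c - 1ℚ) rs (z + 1ℚ)
    π = ∏-diff (z + 1ℚ) (raised (c - 1ℚ) rs)
    κ = ∏-inv (z + 1ℚ) (outer (c - 1ℚ) rs)
    pad : ∀ a b → a * b ≡ 1ℚ * (a * b)
    pad = solve-∀ ℚ-ring
    shuffle : ∀ z x i F e π κ → (z + 1ℚ - x) * i * ((z - x) * (F * (e * π * κ))) ≡ (z + 1ℚ - x) * F * (e * ((z + 1ℚ - (x + 1ℚ)) * π) * (i * κ))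
    shuffle = solve-∀ ℚ-ring

  -- As for added boxes, the effect of a lower row on the factor of the top row is absorbed into the
  -- test function. The divided difference has one point more than there are rows, the bottom point
  -- c - length, and the linear factor vanishes there. The sign comes from x - (x + 1) = -1.
  ∑-G-lowerRow : ∀ c ρ (g : ℚ → ℚ) → IsPartition ρ →
    ∑ (upTo (length ρ)) (λ i → G c (lowerRow ρ i) * g (ξ c ρ i))
      ≡ - (G c ρ * δ[ outer c ρ ] (λ z → g z * ((z - (c - ι (length ρ))) * ∏-diff z (raised c ρ))))
  ∑-G-lowerRow c []       g _   = trans (kill c (g c)) (cong (λ s → - (1ℚ * (g c * ((c - (c - s)) * ((c - (c + 1ℚ)) * 1ℚ)) * 1ℚ + 0ℚ))) (sym ι-0))
    where
    kill : ∀ c g → 0ℚ ≡ - (1ℚ * (g * ((c - (c - 0ℚ)) * ((c - (c + 1ℚ)) * 1ℚ)) * 1ℚ + 0ℚ))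
    kill = solve-∀ ℚ-ring
  ∑-G-lowerRow c (zero ∷ rs) g (_ , () ∷ _)
  ∑-G-lowerRow c (suc r ∷ rs) g (dec , _ ∷ pos) = begin
    ∑ (upTo (suc (length rs))) (λ i → G c (lowerRow (suc r ∷ rs) i) * g (ξ c (suc r ∷ rs) i))
      ≡⟨ ∑-upTo-suc (λ i → G c (lowerRow (suc r ∷ rs) i) * g (ξ c (suc r ∷ rs) i)) (length rs) ⟩
    G c (r ∷ rs) * g x + ∑ (upTo (length rs)) (λ i → G c (suc r ∷ lowerRow rs i) * g (ξ (c - 1ℚ) rs i))
      ≡⟨ cong₂ _+_ first (trans (∑-upTo-cong (length rs) rest) (trans (∑-distribˡ-* F _ (upTo (length rs))) (cong (F *_) (∑-G-lowerRow (c - 1ℚ) rs g′ (Decreasing-tail dec , pos))))) ⟩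
    Grs * (F * ((x - e) * π x * κ)) * g x + F * (- (Grs * δ[ X ] (λ z → g′ z * ((z - (c - 1ℚ - ι (length rs))) * π z))))
      ≡⟨ cong (λ s → Grs * (F * ((x - e) * π x * κ)) * g x + F * (- (Grs * s))) (δ-ext (λ z → trans (cong (λ s → g′ z * ((z - s) * π z)) (row-end c (length rs))) (assoc (g z) (z - (x + 1ℚ)) (inv (z - x)) (z - e) (π z))) X) ⟩
    Grs * (F * ((x - e) * π x * κ)) * g x + F * (- (Grs * δ[ X ] (λ z → g z * ((z - e) * ((z - (x + 1ℚ)) * π z)) * inv (z - x))))
      ≡⟨ shuffle x Grs F (x - e) (π x) κ (g x) _ ⟩
    - (Grs * F * (g x * ((x - e) * ((x - (x + 1ℚ)) * π x)) * κ + δ[ X ] (λ z → g z * ((z - e) * ((z - (x + 1ℚ)) * π z)) * inv (z - x)))) ∎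
    where
    x = c + ι (suc r)
    e = c - ι (suc (length rs))
    X = outer (c - 1ℚ) rs
    Grs = G (c - 1ℚ) rs
    F = rowFactor (suc (suc r)) (c - 1ℚ) rs x
    κ = ∏-inv x X
    π : ℚ → ℚ
    π z = ∏-diff z (raised (c - 1ℚ) rs)
    g′ : ℚ → ℚ
    g′ z = g z * ((z - (x + 1ℚ)) * inv (z - x))
    apart = row-apart c (suc r) rs dec
    assoc : ∀ a b i d p → a * (b * i) * (d * p) ≡ a * (d * (b * p)) * i
    assoc = solve-∀ ℚ-ring
    shuffle : ∀ x G F d p k g s → G * (F * (d * p * k)) * g + F * (- (G * s)) ≡ - (G * F * (g * (d * ((x - (x + 1ℚ)) * p)) * k + s))
    shuffle = solve-∀ ℚ-ring
    first : G c (r ∷ rs) * g x ≡ Grs * (F * ((x - e) * π x * κ)) * g x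
    first = cong (λ s → Grs * s * g x) (trans
      (rowFactor-pred (suc r) (c - 1ℚ) rs (c + ι r) (row-offset c r) (subst (λ z → All (z #_) X) (grow-row c r) apart))
      (trans (cong (λ z → rowFactor (suc (suc r)) (c - 1ℚ) rs z * ((z - (c - 1ℚ - ι (length rs))) * π z * ∏-inv z X)) (sym (grow-row c r)))
        (cong (λ s → F * ((x - s) * π x * κ)) (row-end c (length rs)))))
    regroup : ∀ e x f G g i → (e - x) * (G * (f * ((e - (x + 1ℚ)) * i)) * g) ≡ (- 1ℚ) * (f * (x - e + 1ℚ)) * (G * g) * ((e - x) * i)
    regroup = solve-∀ ℚ-ring
    regroup′ : ∀ e x G f g → (e - x) * (G * f * g) ≡ (- 1ℚ) * (f * (x - e)) * (G * g) * 1ℚ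
    regroup′ = solve-∀ ℚ-ring
    regroup″ : ∀ f G i e x g → G * (f * ((e - (x + 1ℚ)) * i)) * g ≡ f * (G * (g * ((e - (x + 1ℚ)) * i)))
    regroup″ = solve-∀ ℚ-ring
    rest : ∀ i → i ℕ.< length rs →
      G (c - 1ℚ) (lowerRow rs i) * rowFactor (suc (suc r)) (c - 1ℚ) (lowerRow rs i) x * g (ξ (c - 1ℚ) rs i)
        ≡ F * (G (c - 1ℚ) (lowerRow rs i) * g′ (ξ (c - 1ℚ) rs i))
    rest i i<n = trans (*-cancelˡ {y - x} (#-sym x y x#y) (begin
      (y - x) * (Gi * Fi * g y)                                          ≡⟨ regroup′ y x Gi Fi (g y) ⟩
      (- 1ℚ) * (Fi * (x - y)) * (Gi * g y) * 1ℚ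
        ≡⟨ cong₂ (λ s t → (- 1ℚ) * s * (Gi * g y) * t) (rowFactor-lowerRow (suc (suc r)) (c - 1ℚ) rs x i<n pos) (sym (inv-cancel (#-sym x y x#y))) ⟩
      (- 1ℚ) * (F * (x - y + 1ℚ)) * (Gi * g y) * ((y - x) * inv (y - x)) ≡⟨ sym (regroup y x F Gi (g y) (inv (y - x))) ⟩
      (y - x) * (Gi * (F * ((y - (x + 1ℚ)) * inv (y - x))) * g y)        ∎)) (regroup″ F Gi (inv (y - x)) y x (g y))
      where
      y = ξ (c - 1ℚ) rs i
      Gi = G (c - 1ℚ) (lowerRow rs i)
      Fi = rowFactor (suc (suc r)) (c - 1ℚ) (lowerRow rs i) x
      x#y : x # y
      x#y = outer-ξ (c - 1ℚ) rs (ℕ.<⇒≤ i<n) apart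

  ΣQ-raised : ∀ c ρ → ΣQ (outer c ρ) - ΣQ (raised c ρ) ≡ - ι (suc (length ρ))
  ΣQ-raised c []       = trans (simplify c) (cong -_ (sym ι-1))
    where
    simplify : ∀ c → c + 0ℚ - (c + 1ℚ + 0ℚ) ≡ - 1ℚ
    simplify = solve-∀ ℚ-ring
  ΣQ-raised c (r ∷ rs) = begin
    x + ΣQ X - (x + 1ℚ + ΣQ (raised (c - 1ℚ) rs))   ≡⟨ regroup x (ΣQ X) (ΣQ (raised (c - 1ℚ) rs)) ⟩
    ΣQ X - ΣQ (raised (c - 1ℚ) rs) - 1ℚ             ≡⟨ cong (_- 1ℚ) (ΣQ-raised (c - 1ℚ) rs) ⟩
    - ι (suc (length rs)) - 1ℚ                      ≡⟨ negate (ι (suc (length rs))) ⟩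
    - (1ℚ + ι (suc (length rs)))                    ≡⟨ cong -_ (sym (ι-suc (suc (length rs)))) ⟩
    - ι (suc (suc (length rs)))                     ∎
    where
    x = c + ι r
    X = outer (c - 1ℚ) rs
    regroup : ∀ x s t → x + s - (x + 1ℚ + t) ≡ s - t - 1ℚ
    regroup = solve-∀ ℚ-ring
    negate : ∀ l → - l - 1ℚ ≡ - (1ℚ + l)
    negate = solve-∀ ℚ-ring

  length-raised : ∀ c ρ → length (outer c ρ) ≡ length (raised c ρ)
  length-raised c ρ = sym (length-map (_+ 1ℚ) (outer c ρ))

  -- The degree exceeds the number of points by one, so neither `δ-∏-leading` nor `δ-∏-subleading`
  -- applies directly. Since (z - e) (z - x - 1) = (z - x) (z - e - 1) - (x - e), removing the top
  -- row reduces the claim to both of them and to the lower rows.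
  δ-raised : ∀ c ρ → Decreasing ρ →
    δ[ outer c ρ ] (λ z → (z - (c - ι (length ρ))) * ∏-diff z (raised c ρ)) ≡ - ι (size ρ)
  δ-raised c []       _   = trans (cong (λ s → (c - (c - s)) * ((c - (c + 1ℚ)) * 1ℚ) * 1ℚ + 0ℚ) ι-0) (trans (kill c) (cong -_ (sym ι-0)))
    where
    kill : ∀ c → (c - (c - 0ℚ)) * ((c - (c + 1ℚ)) * 1ℚ) * 1ℚ + 0ℚ ≡ - 0ℚ
    kill = solve-∀ ℚ-ring
  δ-raised c (r ∷ rs) dec = begin
    δ[ x ∷ X ] (λ z → (z - e) * ((z - (x + 1ℚ)) * π z))
      ≡⟨ δ-ext (λ z → split z x e (π z)) (x ∷ X) ⟩
    δ[ x ∷ X ] (λ z → 1ℚ * ((z - x) * (1ℚ * ((z - e) * π z) + (- 1ℚ) * π z)) + (- (x - e)) * π z)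
      ≡⟨ δ-linear 1ℚ (- (x - e)) (λ z → (z - x) * (1ℚ * ((z - e) * π z) + (- 1ℚ) * π z)) π (x ∷ X) ⟩
    1ℚ * δ[ x ∷ X ] (λ z → (z - x) * (1ℚ * ((z - e) * π z) + (- 1ℚ) * π z)) + (- (x - e)) * δ[ x ∷ X ] π
      ≡⟨ cong₂ (λ s t → 1ℚ * s + (- (x - e)) * t)
          (trans (δ-drop-head x (λ z → 1ℚ * ((z - e) * π z) + (- 1ℚ) * π z) (row-apart c r rs dec)) (δ-linear 1ℚ (- 1ℚ) (λ z → (z - e) * π z) π X))
          (δ-∏-leading (x ∷ X) (raised (c - 1ℚ) rs) (Distinct-outer c (r ∷ rs) dec) (cong suc (length-raised (c - 1ℚ) rs))) ⟩
    1ℚ * (1ℚ * δ[ X ] (λ z → (z - e) * π z) + (- 1ℚ) * δ[ X ] π) + (- (x - e)) * 1ℚ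
      ≡⟨ cong₂ (λ s t → 1ℚ * (1ℚ * s + (- 1ℚ) * t) + (- (x - e)) * 1ℚ)
          (trans (δ-ext (λ z → cong (λ s → (z - s) * π z) (sym (row-end c (length rs)))) X) (δ-raised (c - 1ℚ) rs (Decreasing-tail dec)))
          (trans (δ-∏-subleading X (raised (c - 1ℚ) rs) (Distinct-outer (c - 1ℚ) rs (Decreasing-tail dec)) (length-raised (c - 1ℚ) rs)) (ΣQ-raised (c - 1ℚ) rs)) ⟩
    1ℚ * (1ℚ * (- ι (size rs)) + (- 1ℚ) * (- ι (suc (length rs)))) + (- (c + ι r - (c - ι (suc (length rs))))) * 1ℚ
      ≡⟨ collect c (ι r) (ι (suc (length rs))) (ι (size rs)) ⟩
    - (ι r + ι (size rs))
      ≡⟨ cong -_ (sym (ι-+ r (size rs))) ⟩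
    - ι (size (r ∷ rs)) ∎
    where
    x = c + ι r
    e = c - ι (suc (length rs))
    X = outer (c - 1ℚ) rs
    π : ℚ → ℚ
    π z = ∏-diff z (raised (c - 1ℚ) rs)
    split : ∀ z x e p → (z - e) * ((z - (x + 1ℚ)) * p) ≡ 1ℚ * ((z - x) * (1ℚ * ((z - e) * p) + (- 1ℚ) * p)) + (- (x - e)) * p
    split = solve-∀ ℚ-ring
    collect : ∀ c r l s → 1ℚ * (1ℚ * (- s) + (- 1ℚ) * (- l)) + (- (c + r - (c - l))) * 1ℚ ≡ - (r + s)
    collect = solve-∀ ℚ-ring

  ∑-G-removable : ∀ ρ → IsPartition ρ →
    ∑ (upTo (length ρ)) (λ i → indicator (removable? ρ i) * G 0ℚ (decrRow ρ i)) ≡ ι (size ρ) * G 0ℚ ρ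
  ∑-G-removable ρ isP@(dec , pos) = begin
    ∑ (upTo (length ρ)) (λ i → indicator (removable? ρ i) * G 0ℚ (decrRow ρ i))
      ≡⟨ ∑-upTo-cong (length ρ) drop-indicator ⟩
    ∑ (upTo (length ρ)) (λ i → G 0ℚ (lowerRow ρ i) * 1ℚ)
      ≡⟨ ∑-G-lowerRow 0ℚ ρ (λ _ → 1ℚ) isP ⟩
    - (G 0ℚ ρ * δ[ outer 0ℚ ρ ] (λ z → 1ℚ * ((z - (0ℚ - ι (length ρ))) * ∏-diff z (raised 0ℚ ρ))))
      ≡⟨ cong (λ s → - (G 0ℚ ρ * s)) (trans (δ-ext (λ z → *-identityˡ ((z - (0ℚ - ι (length ρ))) * ∏-diff z (raised 0ℚ ρ))) (outer 0ℚ ρ)) (δ-raised 0ℚ ρ dec)) ⟩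
    - (G 0ℚ ρ * - ι (size ρ))
      ≡⟨ signs (G 0ℚ ρ) (ι (size ρ)) ⟩
    ι (size ρ) * G 0ℚ ρ ∎
    where
    signs : ∀ g n → - (g * - n) ≡ n * g
    signs = solve-∀ ℚ-ring
    drop-indicator : ∀ i → i ℕ.< length ρ → indicator (removable? ρ i) * G 0ℚ (decrRow ρ i) ≡ G 0ℚ (lowerRow ρ i) * 1ℚ
    drop-indicator i i<n = by-cases (removable? ρ i)
      where
      by-cases : (d : Dec (Removable ρ i)) → indicator d * G 0ℚ (decrRow ρ i) ≡ G 0ℚ (lowerRow ρ i) * 1ℚ
      by-cases d@(yes rem) = begin
        indicator d * G 0ℚ (decrRow ρ i)    ≡⟨ cong (_* G 0ℚ (decrRow ρ i)) (indicator-yes d rem) ⟩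
        1ℚ * G 0ℚ (decrRow ρ i)             ≡⟨ *-comm 1ℚ (G 0ℚ (decrRow ρ i)) ⟩
        G 0ℚ (decrRow ρ i) * 1ℚ             ≡⟨ cong (_* 1ℚ) (G-decrRow 0ℚ ρ i pos rem) ⟩
        G 0ℚ (lowerRow ρ i) * 1ℚ            ∎
      by-cases d@(no ¬rem) = begin
        indicator d * G 0ℚ (decrRow ρ i)    ≡⟨ cong (_* G 0ℚ (decrRow ρ i)) (indicator-no d ¬rem) ⟩
        0ℚ * G 0ℚ (decrRow ρ i)             ≡⟨ *-zeroˡ (G 0ℚ (decrRow ρ i)) ⟩
        0ℚ                                  ≡⟨ sym (trans (cong (_* 1ℚ) (G-not-removable 0ℚ ρ i i<n isP ¬rem)) (*-zeroˡ 1ℚ)) ⟩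
        G 0ℚ (lowerRow ρ i) * 1ℚ            ∎

  -- `chainEnds` branches at the first box, whereas the induction for the hook length formula
  -- removes the last one.
  ∑-chainEnds-last : ∀ n μ (F : Partition → ℚ) → ∑ (chainEnds (suc n) μ) F ≡ ∑ (chainEnds n μ) (λ ρ → ∑ (addBox ρ) F)
  ∑-chainEnds-last zero    μ F = begin
    ∑ (concat (map (chainEnds 0) (addBox μ))) F      ≡⟨ ∑-concat-map F (chainEnds 0) (addBox μ) ⟩
    ∑ (addBox μ) (λ ρ → F ρ + 0ℚ)                    ≡⟨ ∑-cong (λ ρ → +-identityʳ (F ρ)) (addBox μ) ⟩
    ∑ (addBox μ) F                                   ≡⟨ sym (+-identityʳ (∑ (addBox μ) F)) ⟩
    ∑ (addBox μ) F + 0ℚ                              ∎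
  ∑-chainEnds-last (suc n) μ F = begin
    ∑ (chainEnds (suc (suc n)) μ) F                                      ≡⟨ ∑-concat-map F (chainEnds (suc n)) (addBox μ) ⟩
    ∑ (addBox μ) (λ σ → ∑ (chainEnds (suc n) σ) F)                       ≡⟨ ∑-cong (λ σ → ∑-chainEnds-last n σ F) (addBox μ) ⟩
    ∑ (addBox μ) (λ σ → ∑ (chainEnds n σ) (λ ρ → ∑ (addBox ρ) F))
      ≡⟨ sym (∑-concat-map (λ ρ → ∑ (addBox ρ) F) (chainEnds n) (addBox μ)) ⟩
    ∑ (chainEnds (suc n) μ) (λ ρ → ∑ (addBox ρ) F)                       ∎

  indicator-⇔ : ∀ {P Q P′ Q′ : Set} (p : Dec P) (q : Dec Q) (p′ : Dec P′) (q′ : Dec Q′) →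
    (P → Q → P′ × Q′) → (P′ → Q′ → P × Q) → indicator p * indicator q ≡ indicator p′ * indicator q′
  indicator-⇔ (yes p) (yes q) p′ q′ to from = cong₂ _*_ (sym (indicator-yes p′ (proj₁ (to p q)))) (sym (indicator-yes q′ (proj₂ (to p q))))
  indicator-⇔ (yes p) (no ¬q) (yes p′) (yes q′) to from = contradiction (proj₂ (from p′ q′)) ¬q
  indicator-⇔ (yes p) (no ¬q) (yes p′) (no ¬q′) to from = refl
  indicator-⇔ (yes p) (no ¬q) (no ¬p′) q′       to from = sym (*-zeroˡ (indicator q′))
  indicator-⇔ (no ¬p) q       (yes p′) (yes q′) to from = contradiction (proj₁ (from p′ q′)) ¬p
  indicator-⇔ (no ¬p) q       (yes p′) (no ¬q′) to from = *-zeroˡ (indicator q)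
  indicator-⇔ (no ¬p) q       (no ¬p′) q′       to from = trans (*-zeroˡ (indicator q)) (sym (*-zeroˡ (indicator q′)))

  rowLen-≥length : ∀ ρ i → length ρ ℕ.≤ i → rowLen ρ i ≡ 0
  rowLen-≥length []       i       _           = refl
  rowLen-≥length (r ∷ rs) (suc i) (ℕ.s≤s n≤i) = rowLen-≥length rs i n≤i

  -- Adding a box to row i and removing it from row i are inverse to each other, so the two sums
  -- agree term by term in i.
  ∑-addBox-hit : ∀ ρ λ' → IsPartition ρ → IsPartition λ' →
    ∑ (addBox ρ) (λ σ → indicator (σ ≟P λ')) ≡ ∑ (upTo (length λ')) (λ i → indicator (removable? λ' i) * indicator (ρ ≟P decrRow λ' i))
  ∑-addBox-hit ρ λ' (dec , pos) isP = begin
    ∑ (addBox ρ) (λ σ → indicator (σ ≟P λ'))                    ≡⟨ ∑-addBox ρ (λ σ → indicator (σ ≟P λ')) ⟩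
    ∑ (upTo (suc (length ρ))) up
      -- Beyond the first range there is no row to extend; beyond the second, `up` equals `down`,
      -- and there is no box to remove.
      ≡⟨ ∑-upTo-vanish up up-vanish (λ i le → trans (up≡down i) (down-vanish i le)) ⟩
    ∑ (upTo (length λ')) up                                     ≡⟨ ∑-cong up≡down (upTo (length λ')) ⟩
    ∑ (upTo (length λ')) down                                   ∎
    where
    up down : ℕ → ℚ
    up i = indicator (T? (addableᵇ ρ i)) * indicator (incrRow ρ i ≟P λ')
    down i = indicator (removable? λ' i) * indicator (ρ ≟P decrRow λ' i)
    up≡down : ∀ i → up i ≡ down i
    up≡down i = indicator-⇔ (T? (addableᵇ ρ i)) (incrRow ρ i ≟P λ') (removable? λ' i) (ρ ≟P decrRow λ' i)
      (λ { add refl → removable-incrRow ρ i dec add , sym (decrRow-incrRow ρ i pos add) })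
      (λ { rem refl → addable-decrRow λ' i isP rem , incrRow-decrRow λ' i (proj₂ isP) rem })
    up-vanish : ∀ i → suc (length ρ) ℕ.≤ i → up i ≡ 0ℚ
    up-vanish (suc i) (ℕ.s≤s n≤i) = trans (cong (_* indicator (incrRow ρ (suc i) ≟P λ')) (indicator-no (T? (addableᵇ ρ (suc i)))
      (λ add → contradiction (ℕ.<ᵇ⇒< (rowLen ρ (suc i)) (rowLen ρ i) add) (ℕ.≤⇒≯ (ℕ.≤-trans (ℕ.≤-reflexive (rowLen-≥length ρ i n≤i)) ℕ.z≤n)))))
      (*-zeroˡ (indicator (incrRow ρ (suc i) ≟P λ')))
    down-vanish : ∀ i → length λ' ℕ.≤ i → down i ≡ 0ℚ
    down-vanish i n≤i = trans (cong (_* indicator (ρ ≟P decrRow λ' i)) (indicator-no (removable? λ' i)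
      (ℕ.≤⇒≯ (ℕ.≤-trans (ℕ.≤-reflexive (rowLen-≥length λ' i n≤i)) ℕ.z≤n))))
      (*-zeroˡ (indicator (ρ ≟P decrRow λ' i)))

  -- The left side is f_λ, kept as a sum of indicators over chains so that its last box can be
  -- removed. The induction hypothesis contributes n!, and the sum over removable boxes the missing
  -- factor n + 1.
  hook-length-formula : ∀ n λ' → IsPartition λ' → size λ' ≡ n →
    ∑ (chainEnds n []) (λ ρ → indicator (ρ ≟P λ')) ≡ ι (n ℕ.!) * G 0ℚ λ'
  hook-length-formula zero    []          isP _  = cong (_* 1ℚ) (sym ι-1)
  hook-length-formula zero    (zero ∷ λ') (_ , () ∷ _) _
  hook-length-formula zero    (suc r ∷ λ') isP ()
  hook-length-formula (suc n) λ' isP sz = begin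
    ∑ (chainEnds (suc n) []) (λ σ → indicator (σ ≟P λ'))
      ≡⟨ ∑-chainEnds-last n [] (λ σ → indicator (σ ≟P λ')) ⟩
    ∑ (chainEnds n []) (λ ρ → ∑ (addBox ρ) (λ σ → indicator (σ ≟P λ')))
      ≡⟨ ∑-cong-All (All.map (λ {ρ} above → ∑-addBox-hit ρ λ' (proj₁ above) isP) (chainEnds-above n [] ([] , []))) ⟩
    ∑ (chainEnds n []) (λ ρ → ∑ (upTo (length λ')) (λ i → indicator (removable? λ' i) * indicator (ρ ≟P decrRow λ' i)))
      ≡⟨ ∑-swap (λ ρ i → indicator (removable? λ' i) * indicator (ρ ≟P decrRow λ' i)) (chainEnds n []) (upTo (length λ')) ⟩
    ∑ (upTo (length λ')) (λ i → ∑ (chainEnds n []) (λ ρ → indicator (removable? λ' i) * indicator (ρ ≟P decrRow λ' i)))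
      ≡⟨ ∑-cong (λ i → trans (∑-distribˡ-* (indicator (removable? λ' i)) (λ ρ → indicator (ρ ≟P decrRow λ' i)) (chainEnds n [])) (by-cases i (removable? λ' i))) (upTo (length λ')) ⟩
    ∑ (upTo (length λ')) (λ i → ι (n ℕ.!) * (indicator (removable? λ' i) * G 0ℚ (decrRow λ' i)))
      ≡⟨ ∑-distribˡ-* (ι (n ℕ.!)) (λ i → indicator (removable? λ' i) * G 0ℚ (decrRow λ' i)) (upTo (length λ')) ⟩
    ι (n ℕ.!) * ∑ (upTo (length λ')) (λ i → indicator (removable? λ' i) * G 0ℚ (decrRow λ' i))
      ≡⟨ cong (ι (n ℕ.!) *_) (∑-G-removable λ' isP) ⟩
    ι (n ℕ.!) * (ι (size λ') * G 0ℚ λ')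
      ≡⟨ cong (λ s → ι (n ℕ.!) * (ι s * G 0ℚ λ')) sz ⟩
    ι (n ℕ.!) * (ι (suc n) * G 0ℚ λ')
      ≡⟨ shuffle (ι (n ℕ.!)) (ι (suc n)) (G 0ℚ λ') ⟩
    ι (suc n) * ι (n ℕ.!) * G 0ℚ λ'
      ≡⟨ cong (_* G 0ℚ λ') (sym (ι-! n)) ⟩
    ι (suc n ℕ.!) * G 0ℚ λ' ∎
    where
    shuffle : ∀ a b g → a * (b * g) ≡ b * a * g
    shuffle = solve-∀ ℚ-ring
    swap : ∀ a b g → a * (b * g) ≡ b * (a * g)
    swap = solve-∀ ℚ-ring
    by-cases : ∀ i (d : Dec (Removable λ' i)) →
      indicator d * ∑ (chainEnds n []) (λ ρ → indicator (ρ ≟P decrRow λ' i)) ≡ ι (n ℕ.!) * (indicator d * G 0ℚ (decrRow λ' i))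
    by-cases i d@(yes rem) = trans (cong (indicator d *_) (hook-length-formula n (decrRow λ' i) (decrRow-IsPartition λ' i isP rem)
        (ℕ.suc-injective (trans (sym (size-incrRow (decrRow λ' i) i)) (trans (cong size (incrRow-decrRow λ' i (proj₂ isP) rem)) sz)))))
      (swap (indicator d) (ι (n ℕ.!)) (G 0ℚ (decrRow λ' i)))
    by-cases i d@(no ¬rem) = kill (ι (n ℕ.!)) (∑ (chainEnds n []) (λ ρ → indicator (ρ ≟P decrRow λ' i))) (G 0ℚ (decrRow λ' i))
      where
      kill : ∀ a e g → 0ℚ * e ≡ a * (0ℚ * g)
      kill = solve-∀ ℚ-ring

  -- Polynomiality in n

  skewSum-binomial : ∀ μ ν k n → IsPartition μ → IsPartition ν →
    skewSum μ n (Dpow k (gOverH ν)) ≡ sumBelow (suc (sum ν ℕ.+ length ν) ℕ.∸ k) (λ i → Dpow (i ℕ.+ k) (gOverH ν) μ * ι (n C i))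
  skewSum-binomial μ ν k n isPμ (_ , posν) = begin
    skewSum μ n (Dpow k g)
      ≡⟨ skewSum-chains μ n (Dpow k g) isPμ ⟩
    ∑ (chainEnds n μ) (Dpow k g)
      ≡⟨ chain-sum n (Dpow k g) μ ⟩
    ∑ (upTo (suc n)) (λ i → Dpow i (Dpow k g) μ * ι (n C i))
      ≡⟨ ∑-cong (λ i → cong (_* ι (n C i)) (Dpow-+ i k g μ)) (upTo (suc n)) ⟩
    ∑ (upTo (suc n)) summand
      ≡⟨ ∑-upTo-vanish summand beyond-n beyond-degree ⟩
    ∑ (upTo (suc s ℕ.∸ k)) summand ∎
    where
    g = gOverH ν
    s = sum ν ℕ.+ length ν
    summand : ℕ → ℚ
    summand i = Dpow (i ℕ.+ k) g μ * ι (n C i)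
    beyond-n : ∀ i → suc n ℕ.≤ i → summand i ≡ 0ℚ
    beyond-n i n<i = trans (cong (λ b → Dpow (i ℕ.+ k) g μ * b) (trans (cong ι (k>n⇒nCk≡0 n<i)) ι-0)) (*-zeroʳ (Dpow (i ℕ.+ k) g μ))
    -- This gives s < i + k also when k exceeds s; then the subtraction truncates and the sum is
    -- empty.
    beyond-degree : ∀ i → suc s ℕ.∸ k ℕ.≤ i → summand i ≡ 0ℚ
    beyond-degree i le = trans (cong (_* ι (n C i)) (Dpow-zero {g} s (gOverH-HookDegree ν posν) (i ℕ.+ k) μ isPμ
      (subst (suc s ℕ.≤_) (ℕ.+-comm k i) (ℕ.≤-trans (ℕ.m≤n+m∸n (suc s) k) (ℕ.+-monoʳ-≤ k le))))) (*-zeroˡ (ι (n C i)))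

  -- The coefficients form an infinite sequence that vanishes beyond `d`, so that raising the degree
  -- bound leaves them unchanged.
  PolynomialIn : ℕ → (ℕ → ℚ) → Set
  PolynomialIn d F = Σ[ c ∈ (ℕ → ℚ) ] (∀ j → d ℕ.< j → c j ≡ 0ℚ) × (∀ n → F n ≡ ∑ (upTo (suc d)) (λ j → c j * ι (n ℕ.^ j)))

  Polynomial-raise : ∀ {d F} k → PolynomialIn d F → PolynomialIn (k ℕ.+ d) F
  Polynomial-raise {d} {F} k (c , vanish , eq) = c , (λ j lt → vanish j (ℕ.≤-trans (ℕ.s≤s (ℕ.m≤n+m d k)) lt)) , λ n →
    trans (eq n) (∑-upTo-vanish (λ j → c j * ι (n ℕ.^ j)) (λ j → zero-term n j) (λ j lt → zero-term n j (ℕ.≤-trans (ℕ.s≤s (ℕ.m≤n+m d k)) lt)))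
    where
    zero-term : ∀ n j → suc d ℕ.≤ j → c j * ι (n ℕ.^ j) ≡ 0ℚ
    zero-term n j lt = trans (cong (_* ι (n ℕ.^ j)) (vanish j lt)) (*-zeroˡ (ι (n ℕ.^ j)))

  Polynomial-linear : ∀ {d F F′} a b → PolynomialIn d F → PolynomialIn d F′ → PolynomialIn d (λ n → a * F n + b * F′ n)
  Polynomial-linear {d} {F} {F′} a b (c , vanish , eq) (c′ , vanish′ , eq′) =
    (λ j → a * c j + b * c′ j) ,
    (λ j lt → trans (cong₂ (λ s t → a * s + b * t) (vanish j lt) (vanish′ j lt)) (kill a b)) ,
    λ n → begin
      a * F n + b * F′ n
        ≡⟨ cong₂ (λ s t → a * s + b * t) (eq n) (eq′ n) ⟩
      a * ∑ js (λ j → c j * ι (n ℕ.^ j)) + b * ∑ js (λ j → c′ j * ι (n ℕ.^ j))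
        ≡⟨ cong₂ _+_ (sym (∑-distribˡ-* a (λ j → c j * ι (n ℕ.^ j)) js)) (sym (∑-distribˡ-* b (λ j → c′ j * ι (n ℕ.^ j)) js)) ⟩
      ∑ js (λ j → a * (c j * ι (n ℕ.^ j))) + ∑ js (λ j → b * (c′ j * ι (n ℕ.^ j)))
        ≡⟨ sym (∑-distrib-+ (λ j → a * (c j * ι (n ℕ.^ j))) (λ j → b * (c′ j * ι (n ℕ.^ j))) js) ⟩
      ∑ js (λ j → a * (c j * ι (n ℕ.^ j)) + b * (c′ j * ι (n ℕ.^ j)))
        ≡⟨ ∑-cong (λ j → collect a b (c j) (c′ j) (ι (n ℕ.^ j))) js ⟩
      ∑ js (λ j → (a * c j + b * c′ j) * ι (n ℕ.^ j)) ∎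
    where
    js = upTo (suc d)
    kill : ∀ a b → a * 0ℚ + b * 0ℚ ≡ 0ℚ
    kill = solve-∀ ℚ-ring
    collect : ∀ a b c d x → a * (c * x) + b * (d * x) ≡ (a * c + b * d) * x
    collect = solve-∀ ℚ-ring

  Polynomial-*-n : ∀ {d F} → PolynomialIn d F → PolynomialIn (suc d) (λ n → ι n * F n)
  Polynomial-*-n {d} {F} (c , vanish , eq) = shifted , (λ { (suc j) (ℕ.s≤s lt) → vanish j lt }) , λ n → begin
    ι n * F n                                                              ≡⟨ cong (ι n *_) (eq n) ⟩
    ι n * ∑ (upTo (suc d)) (λ j → c j * ι (n ℕ.^ j))
      ≡⟨ sym (∑-distribˡ-* (ι n) (λ j → c j * ι (n ℕ.^ j)) (upTo (suc d))) ⟩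
    ∑ (upTo (suc d)) (λ j → ι n * (c j * ι (n ℕ.^ j)))
      ≡⟨ ∑-cong (λ j → trans (swap (ι n) (c j) (ι (n ℕ.^ j))) (cong (c j *_) (sym (ι-* n (n ℕ.^ j))))) (upTo (suc d)) ⟩
    ∑ (upTo (suc d)) (λ j → c j * ι (n ℕ.^ suc j))
      ≡⟨ pad (∑ (upTo (suc d)) (λ j → c j * ι (n ℕ.^ suc j))) (ι (n ℕ.^ 0)) ⟩
    0ℚ * ι (n ℕ.^ 0) + ∑ (upTo (suc d)) (λ j → c j * ι (n ℕ.^ suc j))
      ≡⟨ sym (∑-upTo-suc (λ j → shifted j * ι (n ℕ.^ j)) (suc d)) ⟩
    ∑ (upTo (suc (suc d))) (λ j → shifted j * ι (n ℕ.^ j))                 ∎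
    where
    shifted : ℕ → ℚ
    shifted zero    = 0ℚ
    shifted (suc j) = c j
    swap : ∀ n c x → n * (c * x) ≡ c * (n * x)
    swap = solve-∀ ℚ-ring
    pad : ∀ s x → s ≡ 0ℚ * x + s
    pad = solve-∀ ℚ-ring

  Polynomial-ext : ∀ {d F F′} → (∀ n → F′ n ≡ F n) → PolynomialIn d F → PolynomialIn d F′
  Polynomial-ext eq′ (c , vanish , eq) = c , vanish , λ n → trans (eq′ n) (eq n)

  -- Over ℚ the difference n - i is not truncated, so the identity holds for all i, by induction
  -- through Pascal's rule.
  absorption : ∀ n i → ι (suc i) * ι (n C suc i) ≡ (ι n - ι i) * ι (n C i)
  absorption zero zero    = begin
    ι 1 * ι 0               ≡⟨ cong₂ _*_ ι-1 ι-0 ⟩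
    0ℚ                      ≡⟨ sym (cong (λ s → (s - s) * 1ℚ) ι-0) ⟩
    (ι 0 - ι 0) * 1ℚ        ≡⟨ cong ((ι 0 - ι 0) *_) (sym ι-1) ⟩
    (ι 0 - ι 0) * ι 1       ∎
  absorption zero (suc i) = trans (cong (ι (suc (suc i)) *_) ι-0) (trans (*-zeroʳ (ι (suc (suc i)))) (sym (trans (cong ((ι 0 - ι (suc i)) *_) ι-0) (*-zeroʳ (ι 0 - ι (suc i))))))
  absorption (suc n) zero = begin
    ι 1 * ι (suc n C 1)                ≡⟨ cong₂ _*_ ι-1 (pascal n 0) ⟩
    1ℚ * (ι (n C 0) + ι (n C 1))       ≡⟨ cong (λ b → 1ℚ * (ι (n C 0) + b)) first-column ⟩
    1ℚ * (ι (n C 0) + (ι n - 0ℚ) * ι (n C 0))     ≡⟨ collect (ι n) (ι (n C 0)) ⟩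
    (1ℚ + ι n - 0ℚ) * ι (n C 0)        ≡⟨ cong₂ (λ s t → (s - t) * ι (n C 0)) (sym (ι-suc n)) (sym ι-0) ⟩
    (ι (suc n) - ι 0) * ι (n C 0)      ≡⟨ cong (λ b → (ι (suc n) - ι 0) * ι b) (trans (nC0≡1 n) (sym (nC0≡1 (suc n)))) ⟩
    (ι (suc n) - ι 0) * ι (suc n C 0)  ∎
    where
    pascal : ∀ n i → ι (suc n C suc i) ≡ ι (n C i) + ι (n C suc i)
    pascal n i = trans (cong ι (sym (nCk+nC[k+1]≡[n+1]C[k+1] n i))) (ι-+ (n C i) (n C suc i))
    first-column : ι (n C 1) ≡ (ι n - 0ℚ) * ι (n C 0)
    first-column = trans (sym (*-identityˡ (ι (n C 1)))) (trans (cong (_* ι (n C 1)) (sym ι-1)) (trans (absorption n 0) (cong (λ s → (ι n - s) * ι (n C 0)) ι-0)))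
    collect : ∀ n b → 1ℚ * (b + (n - 0ℚ) * b) ≡ (1ℚ + n - 0ℚ) * b
    collect = solve-∀ ℚ-ring
  absorption (suc n) (suc i) = begin
    ι (suc (suc i)) * ι (suc n C suc (suc i))
      ≡⟨ cong (ι (suc (suc i)) *_) (pascal n (suc i)) ⟩
    ι (suc (suc i)) * (ι (n C suc i) + ι (n C suc (suc i)))
      ≡⟨ *-distribˡ-+ (ι (suc (suc i))) (ι (n C suc i)) (ι (n C suc (suc i))) ⟩
    ι (suc (suc i)) * ι (n C suc i) + ι (suc (suc i)) * ι (n C suc (suc i))
      ≡⟨ cong₂ _+_ (cong (_* ι (n C suc i)) (ι-suc (suc i))) (absorption n (suc i)) ⟩
    (1ℚ + ι (suc i)) * ι (n C suc i) + (ι n - ι (suc i)) * ι (n C suc i)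
      ≡⟨ rotate (ι (suc i)) (ι n) (ι (n C suc i)) ⟩
    ι (suc i) * ι (n C suc i) + (1ℚ + ι n - ι (suc i)) * ι (n C suc i)
      ≡⟨ cong₂ (λ s t → s + (1ℚ + ι n - t) * ι (n C suc i)) (absorption n i) (ι-suc i) ⟩
    (ι n - ι i) * ι (n C i) + (1ℚ + ι n - (1ℚ + ι i)) * ι (n C suc i)
      ≡⟨ collect (ι n) (ι i) (ι (n C i)) (ι (n C suc i)) ⟩
    (1ℚ + ι n - (1ℚ + ι i)) * (ι (n C i) + ι (n C suc i))
      ≡⟨ cong₂ _*_ (cong₂ _-_ (sym (ι-suc n)) (sym (ι-suc i))) (sym (pascal n i)) ⟩
    (ι (suc n) - ι (suc i)) * ι (suc n C suc i) ∎
    where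
    pascal : ∀ n i → ι (suc n C suc i) ≡ ι (n C i) + ι (n C suc i)
    pascal n i = trans (cong ι (sym (nCk+nC[k+1]≡[n+1]C[k+1] n i))) (ι-+ (n C i) (n C suc i))
    rotate : ∀ i n b → (1ℚ + i) * b + (n - i) * b ≡ i * b + (1ℚ + n - i) * b
    rotate = solve-∀ ℚ-ring
    collect : ∀ n i a b → (n - i) * a + (1ℚ + n - (1ℚ + i)) * b ≡ (1ℚ + n - (1ℚ + i)) * (a + b)
    collect = solve-∀ ℚ-ring

  -- Absorption gives each binomial coefficient from the previous one by the factor (n - i) / (i +
  -- 1), which is linear in n.
  Polynomial-binomial : ∀ i → PolynomialIn i (λ n → ι (n C i))
  Polynomial-binomial zero    = (λ { zero → 1ℚ ; (suc _) → 0ℚ }) , (λ { (suc j) _ → refl }) , λ n →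
    trans (cong ι (nC0≡1 n)) (trans (sym (*-identityˡ (ι 1))) (sym (+-identityʳ (1ℚ * ι 1))))
  Polynomial-binomial (suc i) = Polynomial-ext solve-for
    (Polynomial-linear (inv (ι (suc i))) (- (inv (ι (suc i)) * ι i)) (Polynomial-*-n (Polynomial-binomial i)) (Polynomial-raise 1 (Polynomial-binomial i)))
    where
    distrib : ∀ k n i b → k * ((n - i) * b) ≡ k * (n * b) + (- (k * i)) * b
    distrib = solve-∀ ℚ-ring
    swap : ∀ a k b → a * k * b ≡ k * (a * b)
    swap = solve-∀ ℚ-ring
    solve-for : ∀ n → ι (n C suc i) ≡ inv (ι (suc i)) * (ι n * ι (n C i)) + (- (inv (ι (suc i)) * ι i)) * ι (n C i)
    solve-for n = begin
      ι (n C suc i)                                          ≡⟨ sym (*-identityˡ (ι (n C suc i))) ⟩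
      1ℚ * ι (n C suc i)                                     ≡⟨ cong (_* ι (n C suc i)) (sym (inv-cancel (ι-suc≢0 i))) ⟩
      ι (suc i) * inv (ι (suc i)) * ι (n C suc i)            ≡⟨ swap (ι (suc i)) (inv (ι (suc i))) (ι (n C suc i)) ⟩
      inv (ι (suc i)) * (ι (suc i) * ι (n C suc i))          ≡⟨ cong (inv (ι (suc i)) *_) (absorption n i) ⟩
      inv (ι (suc i)) * ((ι n - ι i) * ι (n C i))            ≡⟨ distrib (inv (ι (suc i))) (ι n) (ι i) (ι (n C i)) ⟩
      inv (ι (suc i)) * (ι n * ι (n C i)) + (- (inv (ι (suc i)) * ι i)) * ι (n C i) ∎

  Polynomial-∑ : ∀ m (a : ℕ → ℚ) → PolynomialIn m (λ n → ∑ (upTo (suc m)) (λ i → a i * ι (n C i)))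
  Polynomial-∑ zero    a = Polynomial-ext (λ n → expand (a 0) (ι (n C 0))) (Polynomial-linear (a 0) 0ℚ (Polynomial-binomial 0) (Polynomial-binomial 0))
    where
    expand : ∀ a b → a * b + 0ℚ ≡ a * b + 0ℚ * b
    expand = solve-∀ ℚ-ring
  Polynomial-∑ (suc m) a = Polynomial-ext
    (λ n → trans (∑-upTo-last (λ i → a i * ι (n C i)) (suc m)) (cong (_+ a (suc m) * ι (n C suc m)) (sym (*-identityˡ (∑ (upTo (suc m)) (λ i → a i * ι (n C i)))))))
    (Polynomial-linear 1ℚ (a (suc m)) (Polynomial-raise 1 (Polynomial-∑ m a)) (Polynomial-binomial (suc m)))

  -- All shapes that occur have size n + |μ|, so the factorial of the hook length formula is
  -- constant, leaves the sum and cancels the normalisation. The passage through chain ends provides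
  -- the size and the partition property.
  weighted-skewSum : ∀ μ ν n → IsPartition μ →
    (1 ÷ ((n ℕ.+ size μ) ℕ.!)) * ∑ (skewShapes μ n) (λ λ' → fromℕ (fStraight λ' ℕ.* f λ' μ ℕ.* pHook ν λ')) ≡ skewSum μ n (gOverH ν)
  weighted-skewSum μ ν n isP = begin
    (1 ÷ N!) * ∑ (skewShapes μ n) (λ λ' → fromℕ (fStraight λ' ℕ.* f λ' μ ℕ.* pHook ν λ'))
      ≡⟨ cong ((1 ÷ N!) *_) (∑-cong separate (skewShapes μ n)) ⟩
    (1 ÷ N!) * skewSum μ n weight
      ≡⟨ cong ((1 ÷ N!) *_) (skewSum-chains μ n weight isP) ⟩
    (1 ÷ N!) * ∑ (chainEnds n μ) weight
      ≡⟨ cong ((1 ÷ N!) *_) (trans (∑-cong-All (All.map (λ {ρ} → hook-length ρ) (chainEnds-above n μ isP))) (∑-distribˡ-* (ι N!) (gOverH ν) (chainEnds n μ))) ⟩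
    (1 ÷ N!) * (ι N! * ∑ (chainEnds n μ) (gOverH ν))
      ≡⟨ regroup (1 ÷ N!) (ι N!) (∑ (chainEnds n μ) (gOverH ν)) ⟩
    ι N! * (1 ÷ N!) * ∑ (chainEnds n μ) (gOverH ν)
      ≡⟨ cong (_* ∑ (chainEnds n μ) (gOverH ν)) (trans (÷-cancel 1 N! {{(n ℕ.+ size μ) ℕ.!≢0}}) ι-1) ⟩
    1ℚ * ∑ (chainEnds n μ) (gOverH ν)
      ≡⟨ *-identityˡ (∑ (chainEnds n μ) (gOverH ν)) ⟩
    ∑ (chainEnds n μ) (gOverH ν)
      ≡⟨ sym (skewSum-chains μ n (gOverH ν) isP) ⟩
    skewSum μ n (gOverH ν) ∎
    where
    N! = (n ℕ.+ size μ) ℕ.!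
    weight : Partition → ℚ
    weight λ' = ι (fStraight λ') * ι (pHook ν λ')
    regroup : ∀ a b s → a * (b * s) ≡ b * a * s
    regroup = solve-∀ ℚ-ring
    swap : ∀ a b c → a * b * c ≡ b * (a * c)
    swap = solve-∀ ℚ-ring
    swap′ : ∀ a g c → a * g * c ≡ a * (c * g)
    swap′ = solve-∀ ℚ-ring
    separate : ∀ λ' → fromℕ (fStraight λ' ℕ.* f λ' μ ℕ.* pHook ν λ') ≡ fromℕ (f λ' μ) * weight λ'
    separate λ' = begin
      fromℕ (fStraight λ' ℕ.* f λ' μ ℕ.* pHook ν λ')     ≡⟨ ι-fromℕ (fStraight λ' ℕ.* f λ' μ ℕ.* pHook ν λ') ⟩
      ι (fStraight λ' ℕ.* f λ' μ ℕ.* pHook ν λ')         ≡⟨ ι-* (fStraight λ' ℕ.* f λ' μ) (pHook ν λ') ⟩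
      ι (fStraight λ' ℕ.* f λ' μ) * ι (pHook ν λ')       ≡⟨ cong (_* ι (pHook ν λ')) (ι-* (fStraight λ') (f λ' μ)) ⟩
      ι (fStraight λ') * ι (f λ' μ) * ι (pHook ν λ')     ≡⟨ swap (ι (fStraight λ')) (ι (f λ' μ)) (ι (pHook ν λ')) ⟩
      ι (f λ' μ) * weight λ'                             ≡⟨ cong (_* weight λ') (sym (ι-fromℕ (f λ' μ))) ⟩
      fromℕ (f λ' μ) * weight λ'                         ∎
    hook-length : ∀ ρ → EndsAbove n μ ρ → weight ρ ≡ ι N! * gOverH ν ρ
    hook-length ρ (isPρ , sz , _) = begin
      ι (fStraight ρ) * ι (pHook ν ρ)
        ≡⟨ cong (_* ι (pHook ν ρ)) (trans (ι-length-filter (λ σ → σ ≟P ρ) (chainEnds (size ρ) [])) (hook-length-formula (size ρ) ρ isPρ refl)) ⟩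
      ι (size ρ ℕ.!) * G 0ℚ ρ * ι (pHook ν ρ)
        ≡⟨ swap′ (ι (size ρ ℕ.!)) (G 0ℚ ρ) (ι (pHook ν ρ)) ⟩
      ι (size ρ ℕ.!) * (ι (pHook ν ρ) * G 0ℚ ρ)
        ≡⟨ cong₂ (λ m g → ι (m ℕ.!) * g) (trans sz (ℕ.+-comm (size μ) n)) (sym (gOverH-G ν ρ (proj₁ isPρ))) ⟩
      ι N! * gOverH ν ρ                                                               ∎

  weighted-skewSum-polynomial : ∀ μ ν → IsPartition μ → IsPartition ν →
    PolynomialIn (sum ν ℕ.+ length ν) (λ n → (1 ÷ ((n ℕ.+ size μ) ℕ.!)) * ∑ (skewShapes μ n) (λ λ' → fromℕ (fStraight λ' ℕ.* f λ' μ ℕ.* pHook ν λ')))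
  weighted-skewSum-polynomial μ ν isPμ isPν = Polynomial-ext
    (λ n → trans (weighted-skewSum μ ν n isPμ) (skewSum-binomial μ ν 0 n isPμ isPν))
    (Polynomial-∑ (sum ν ℕ.+ length ν) (λ i → Dpow (i ℕ.+ 0) (gOverH ν) μ))

  binomial-expansion : (μ ν : Partition) → IsPartition μ → IsPartition ν → (k n : ℕ) →
    skewSum μ n (Dpow k (gOverH ν))
      ≡ sumBelow (suc (sum ν ℕ.+ length ν) ℕ.∸ k) (λ i → Dpow (i ℕ.+ k) (gOverH ν) μ * fromℕ (n C i))
  binomial-expansion μ ν isPμ isPν k n = trans (skewSum-binomial μ ν k n isPμ isPν)
    (∑-cong (λ i → cong (Dpow (i ℕ.+ k) (gOverH ν) μ *_) (sym (ι-fromℕ (n C i)))) (upTo (suc (sum ν ℕ.+ length ν) ℕ.∸ k)))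

  polynomiality : (μ ν : Partition) → IsPartition μ → IsPartition ν →
    Σ (ℕ → ℚ) (λ c → (n : ℕ) →
      (1 ÷ ((n ℕ.+ size μ) ℕ.!)) * ΣQ (map (λ λ' → fromℕ (fStraight λ' ℕ.* f λ' μ ℕ.* pHook ν λ')) (skewShapes μ n))
        ≡ sumBelow (suc (sum ν ℕ.+ length ν)) (λ j → c j * fromℕ (n ℕ.^ j)))
  polynomiality μ ν isPμ isPν =
    let c , _ , eq = weighted-skewSum-polynomial μ ν isPμ isPν in
    c , λ n → trans (eq n) (∑-cong (λ j → cong (c j *_) (sym (ι-fromℕ (n ℕ.^ j)))) (upTo (suc (sum ν ℕ.+ length ν))))

open import Defs
open import Data.Nat using (ℕ; suc; _+_; _∸_; _^_; _!)
import Data.Nat as N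
open import Data.Nat.Combinatorics using (_C_)
open import Data.Nat.ListAction using (sum)
open import Data.List using (length; map)
open import Data.Product using (_×_; Σ; _,_)
open import Data.Rational using (ℚ; _*_)
open import Relation.Binary.PropositionalEquality using (_≡_)

theorem7p4 : (μ ν : Partition) → IsPartition μ → IsPartition ν →
    ((k n : ℕ) →
    skewSum μ n (Dpow k (gOverH ν))
    ≡ sumBelow (suc (sum ν + length ν) ∸ k)
    (λ i → Dpow (i + k) (gOverH ν) μ * fromℕ (n C i)))
    × Σ (ℕ → ℚ) (λ c → (n : ℕ) →
    (1 ÷ ((n + size μ) !))
    * ΣQ (map (λ λ' → fromℕ (fStraight λ' N.* f λ' μ N.* pHook ν λ')) (skewShapes μ n))
    ≡ sumBelow (suc (sum ν + length ν))
    (λ j → c j * fromℕ (n ^ j)))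
theorem7p4 μ ν isPμ isPν = HookDifferences.binomial-expansion μ ν isPμ isPν , HookDifferences.polynomiality μ ν isPμ isPν
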